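{- Let $q'$ be a prime with $q'\leq 73$ and let $q=(q')^{6}$. Then for every odd codimension $r=2t+1\geq 3$ with $r\neq 9,13$ there exists a linear $[n_r,n_r-r]_q$ code $\mathcal{C}_r$ with covering radius $2$ and length $$n_r=\left(2+\frac{2}{\sqrt[6]{q}}+\frac{2}{\sqrt[3]{q}}+\frac{2}{\sqrt{q}}\right)q^{\frac{r-2}{2}}+2\left\lfloor q^{\frac{r-5}{2}}\right\rfloor,$$ and the family satisfies $$\liminf_{r\to\infty}\frac{V_q(n_r,2)}{q^{r}}<2+\frac{4}{\sqrt[6]{q}}+\frac{6}{\sqrt[3]{q}}+\frac{8}{\sqrt{q}}+\frac{6}{\sqrt[3]{q^{2}}}+\frac{5}{\sqrt[6]{q^{5}}}.$$
   Context: For a prime power $q$, an $[n,n-r]_q$ code is a linear subspace of $F_q^n$ of dimension $n-r$; it has covering radius $R$ if every column of $F_q^{r}$ is a linear combination of at most $R$ columns of a parity-check matrix, and $R$ is the smallest such integer. $V_q(n,R)=\sum_{i=0}^{R}(q-1)^i\binom{n}{i}$; $V_q(n,R)/q^r$ is the covering density of an $[n,n-r]_qR$ code. -}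

module Defs where

open import Level using (0ℓ)
open import Algebra.Bundles using (CommutativeRing)
open import Data.Nat as Nat using (ℕ; zero; suc; NonZero)
open import Data.Nat.Properties using (m^n≢0)
open import Data.Nat.Primality using (Prime; prime⇒nonZero)
open import Data.Nat.Combinatorics using (_C_)
open import Data.Integer using (+_)
open import Data.Rational using (ℚ; _/_)
open import Data.Fin as Fin using (Fin)
open import Data.Product using (Σ; ∃; _×_)
open import Function.Bundles using (Bijection)
open import Relation.Nullary using (¬_)
import Relation.Binary.PropositionalEquality as ≡

record FiniteField (q : ℕ) : Set₁ where
  field
    commRing : CommutativeRing 0ℓ 0ℓ
  open CommutativeRing commRing public
  field
    1≉0     : ¬ (1# ≈ 0#)
    inverse : ∀ x → ¬ (x ≈ 0#) → ∃ λ y → (x * y) ≈ 1#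
    card    : Bijection setoid (≡.setoid (Fin q))

module _ {q : ℕ} (F : FiniteField q) where
  open FiniteField F using (Carrier; _≈_; _+_; _*_; 0#)

  ∑ : (k : ℕ) → (Fin k → Carrier) → Carrier
  ∑ zero    f = 0#
  ∑ (suc k) f = f Fin.zero + ∑ k (λ i → f (Fin.suc i))

  Matrix : ℕ → ℕ → Set
  Matrix r n = Fin r → Fin n → Carrier

  -- the column vector s ∈ F^r is a linear combination of at most R columns
  -- of H (R chosen columns, coefficients may be zero, repetitions allowed)
  CombOfAtMost : ∀ {r n} → Matrix r n → ℕ → (Fin r → Carrier) → Set
  CombOfAtMost {r} {n} H R s =
    Σ (Fin R → Fin n) λ idx → Σ (Fin R → Carrier) λ a →
      ∀ (j : Fin r) → s j ≈ ∑ R (λ k → a k * H j (idx k))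

  Covers : ∀ {r n} → Matrix r n → ℕ → Set
  Covers {r} H R = ∀ (s : Fin r → Carrier) → CombOfAtMost H R s

  -- the [n, n-r]_q code with parity-check matrix H has covering radius
  -- exactly R: R suffices and R is the smallest such integer
  HasCoveringRadius : ∀ {r n} → Matrix r n → ℕ → Set
  HasCoveringRadius H zero    = Covers H zero
  HasCoveringRadius H (suc R) = Covers H (suc R) × ¬ Covers H R

open Nat using (_+_; _*_; _∸_; _^_)
-- Arithmetic part.  q = p^6, so q^{1/6} = p, q^{1/3} = p^2, q^{1/2} = p^3.

V : ℕ → ℕ → ℕ → ℕ
V q n zero    = 1
V q n (suc R) = V q n R + (q ∸ 1) ^ suc R * (n C suc R)

-- For r = 2t+1 (t ≥ 1):
--   (2 + 2/p + 2/p^2 + 2/p^3) q^{(r-2)/2}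
--     = (2 + 2/p + 2/p^2 + 2/p^3) p^{6t-3}
--     = 2 (p^3 + p^2 + p + 1) p^{6(t-1)},
--   ⌊q^{(r-5)/2}⌋ = ⌊q^{t-2}⌋ = 0 if t = 1, q^{t-2} if t ≥ 2.
floorPow : ℕ → ℕ → ℕ            -- floorPow q t = ⌊ q^{t-2} ⌋ (t ≥ 1, q ≥ 2)
floorPow q zero          = 0     -- (unused: t = 0)
floorPow q (suc zero)    = 0
floorPow q (suc (suc s)) = q ^ s

nLen : ℕ → ℕ → ℕ                -- n_r for r = 2t+1, as a function of (p, t)
nLen p zero    = 0               -- (unused: t = 0)
nLen p (suc s) = 2 * (p ^ 3 + p ^ 2 + p + 1) * p ^ (6 * s)
               + 2 * floorPow (p ^ 6) (suc s)

density : (p : ℕ) → Prime p → ℕ → ℚ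
density p pp t = (+ V (p ^ 6) (nLen p t) 2) / ((p ^ 6) ^ (2 * t + 1))
  where instance
    _ = prime⇒nonZero pp
    _ = m^n≢0 p 6
    _ = m^n≢0 (p ^ 6) (2 * t + 1)

-- 2 + 4/q^{1/6} + 6/q^{1/3} + 8/q^{1/2} + 6/q^{2/3} + 5/q^{5/6}
bound : (p : ℕ) → Prime p → ℚ
bound p pp = (+ 2) / 1 Data.Rational.+ (+ 4) / p Data.Rational.+ (+ 6) / (p ^ 2)
  Data.Rational.+ (+ 8) / (p ^ 3) Data.Rational.+ (+ 6) / (p ^ 4)
  Data.Rational.+ (+ 5) / (p ^ 5)
  where instance
    _ = prime⇒nonZero pp
    _ = m^n≢0 p 2
    _ = m^n≢0 p 3
    _ = m^n≢0 p 4
    _ = m^n≢0 p 5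

{-# OPTIONS --safe #-}

-- Let K ⊃ k be the subfields of orders p³ and p of F. Two linear sets of rank 4 in PG(2, p³), each of
-- at most p³ + p² + p + 1 points, meet every line; if they are disjoint, every point of PG(2, p⁶) lies
-- on a line of PG(2, p³), and this line is a secant joining the two sets. The sets {(x, f x, a)} and
-- {(y, b, γ g y)}, with x, y ∈ K, a, b ∈ k and bijective k-linear f, g : K → K, are disjoint exactly when
-- x ↦ f(x) g(x / f(x)) omits the value 1/γ on K. For suitable f and g this map is not injective, hence
-- not surjective, and γ exists. This settles r = 3 for every prime p.
--
-- From codimension r to r + 2 a column h becomes the q columns (y, βy, h), or (0, y, h) for β = ∞. Two
-- columns with different slopes β cover everything above a combination of h and h′; vectors vanishing
-- on the old coordinates are differences of columns above a single h, provided each slope occurs. The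
-- slopes must separate the pairs of columns used at the previous step, and four slope classes suffice
-- for this at every step, so that only the step from r = 3 needs the two additional columns.
module Submission where

-- If f is multiplication by a constant of K, then x / f(x) is constant for x ≠ 0 and x ↦ f(x) g(x /
-- f(x)) takes every nonzero value, so no γ exists: f must be k-linear without being K-linear. Given
-- a k-basis 1, m, m² of K, permutations of the basis are already enough. Let f fix 1 and exchange m
-- and m², and let g fix m² and exchange 1 and m. Then x = 1 gives 1 · g(1) = m, and x = m² gives m
-- · g(m) = m, a collision that is available for every p.
--
-- The step from r = 3 is exceptional for a counting reason. The code of codimension 3 has 2(p³ + p²
-- + p + 1) columns, fewer than the q + 1 slopes, so the slopes cannot all occur there. After one
-- step every column has been replaced by q columns, and those above one column from each of the two
-- sets suffice to carry all slopes.

open import Defs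
open import Level using (0ℓ)
open import Algebra.Bundles using (CommutativeRing; RawRing)
open import Algebra.Core using (Op₁; Op₂)
open import Algebra.Morphism.Structures using (IsRingMonomorphism)
import Algebra.Morphism.RingMonomorphism as RingMonomorphism
open import Algebra.Structures using (IsCommutativeRing)
open import Data.Bool using (Bool; true; false)
open import Data.Fin as Fin using (Fin; zero; suc; finToFun; funToFin)
open import Data.Fin.Patterns using (0F; 1F; 2F; 3F)
open import Data.Fin.Permutation using (Permutation; permutation)
import Data.Fin.Properties as Finₚ
open import Data.Maybe using (Maybe; just; nothing)
open import Data.Nat as ℕ using (ℕ; zero; suc; s≤s; z≤n; _!; NonZero)
open import Data.Nat.Combinatorics
  using (_C_; nCk≡n!/k![n-k]!; k![n∸k]!∣n!; nCn≡1; nC1≡n; nCk+nC[k+1]≡[n+1]C[k+1])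
open import Data.Nat.Divisibility using (_∣_; divides; ∣⇒≤; m∣m*n)
open import Data.Nat.DivMod using (m/n*n≡m)
open import Data.Nat.Primality using (Prime; prime⇒nonZero; prime⇒nonTrivial; euclidsLemma)
import Data.Nat.Properties as ℕₚ
open import Data.Nat.Solver using (module +-*-Solver)
open import Data.Product using (Σ; Σ-syntax; ∃; ∃-syntax; ∃₂; _×_; _,_; proj₁; proj₂)
open import Data.Sum using (_⊎_; inj₁; inj₂; [_,_]′)
open import Data.Unit using (⊤; tt)
open import Data.Vec using (Vec; []; _∷_; _++_; replicate)
open import Data.Vec.Functional using (removeAt)
open import Function using (_∘_)
open import Function.Bundles using (Bijection)
open import Function.Definitions using (Injective)
open import Relation.Binary.PropositionalEquality as ≡ using (_≡_; _≢_)
open import Relation.Nullary using (¬_; Dec; yes; no; contradiction; does)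
open import Relation.Nullary.Decidable using (decidable-stable; dec-true; dec-false)
open import Relation.Unary using (Decidable)

-- The coefficients of the standard ring solver must be decidable for terms to cancel;
-- here an integer is a pair (a , b) standing for a − b, kept with a = 0 or b = 0.
module IntegerCoefficientSolver (R : CommutativeRing 0ℓ 0ℓ) where
  open CommutativeRing R hiding (zero)
  open import Algebra.Properties.Ring ring using (-0#≈0#; -‿distribˡ-*; -‿distribʳ-*; -‿involutive)
  open import Algebra.Properties.AbelianGroup +-abelianGroup using (⁻¹-∙-comm)
  open import Algebra.Properties.CommutativeSemigroup +-commutativeSemigroup using (interchange)
  open import Algebra.Properties.Monoid.Mult +-monoid using (×-homo-+) renaming (_×_ to _·_)
  open import Algebra.Properties.Semiring.Mult semiring using (×1-homo-*)
  open import Relation.Binary.Reasoning.Setoid setoid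
  open import Algebra.Solver.Ring.AlmostCommutativeRing
    using (fromCommutativeRing; _-Raw-AlmostCommutative⟶_)

  reduce : ℕ → ℕ → ℕ × ℕ
  reduce zero    b       = zero , b
  reduce (suc a) zero    = suc a , zero
  reduce (suc a) (suc b) = reduce a b

  ⟦_⟧ᶜ : ℕ × ℕ → Carrier
  ⟦ 0 , 0 ⟧ᶜ = 0#
  ⟦ 1 , 0 ⟧ᶜ = 1#
  ⟦ a , b ⟧ᶜ = a · 1# - b · 1#

  ⟦_⟧ᶜ≈ : ∀ x → ⟦ x ⟧ᶜ ≈ proj₁ x · 1# - proj₂ x · 1#
  ⟦ 0 , 0           ⟧ᶜ≈ = sym (-‿inverseʳ 0#)
  ⟦ 0 , suc b       ⟧ᶜ≈ = refl
  ⟦ 1 , 0           ⟧ᶜ≈ = sym (trans (+-cong (+-identityʳ 1#) -0#≈0#) (+-identityʳ 1#))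
  ⟦ 1 , suc b       ⟧ᶜ≈ = refl
  ⟦ suc (suc a) , b ⟧ᶜ≈ = refl

  difference-shift : ∀ x y z → (z + x) - (z + y) ≈ x - y
  difference-shift x y z = begin
    (z + x) - (z + y)     ≈⟨ +-congˡ (⁻¹-∙-comm z y) ⟨
    (z + x) + (- z - y)   ≈⟨ interchange z x (- z) (- y) ⟩
    (z - z) + (x - y)     ≈⟨ +-congʳ (-‿inverseʳ z) ⟩
    0# + (x - y)          ≈⟨ +-identityˡ _ ⟩
    x - y                 ∎

  ⟦reduce⟧ : ∀ a b → ⟦ reduce a b ⟧ᶜ ≈ a · 1# - b · 1#
  ⟦reduce⟧ zero    b       = ⟦ zero , b ⟧ᶜ≈
  ⟦reduce⟧ (suc a) zero    = ⟦ suc a , zero ⟧ᶜ≈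
  ⟦reduce⟧ (suc a) (suc b) = trans (⟦reduce⟧ a b) (sym (difference-shift _ _ 1#))

  coefficients : RawRing 0ℓ 0ℓ
  coefficients = record
    { Carrier = ℕ × ℕ
    ; _≈_     = _≡_
    ; _+_     = λ { (a , b) (c , d) → reduce (a ℕ.+ c) (b ℕ.+ d) }
    ; _*_     = λ { (a , b) (c , d) → reduce (a ℕ.* c ℕ.+ b ℕ.* d) (a ℕ.* d ℕ.+ b ℕ.* c) }
    ; -_      = λ { (a , b) → b , a }
    ; 0#      = 0 , 0
    ; 1#      = 1 , 0
    }

  +-difference : ∀ x y z w → (x + z) - (y + w) ≈ (x - y) + (z - w)
  +-difference x y z w = trans (+-congˡ (sym (⁻¹-∙-comm y w))) (interchange x z (- y) (- w))

  *-difference : ∀ x y z w → (x * z + y * w) - (x * w + y * z) ≈ (x - y) * (z - w)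
  *-difference x y z w = begin
    (x * z + y * w) - (x * w + y * z)          ≈⟨ +-congˡ (-‿cong (+-comm _ _)) ⟩
    (x * z + y * w) - (y * z + x * w)          ≈⟨ +-difference _ _ _ _ ⟩
    (x * z - y * z) + (y * w - x * w)          ≈⟨ +-cong (sub x y z) (sub y x w) ⟩
    (x - y) * z + (y - x) * w                  ≈⟨ +-congˡ (*-congʳ swap) ⟩
    (x - y) * z + (- (x - y)) * w              ≈⟨ +-congˡ (trans (sym (-‿distribˡ-* _ _)) (-‿distribʳ-* _ _)) ⟩
    (x - y) * z + (x - y) * (- w)              ≈⟨ distribˡ _ _ _ ⟨
    (x - y) * (z - w)                          ∎
    where
    sub : ∀ u v t → u * t - v * t ≈ (u - v) * t
    sub u v t = trans (+-congˡ (-‿distribˡ-* v t)) (sym (distribʳ t u (- v)))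
    swap : y - x ≈ - (x - y)
    swap = begin
      y - x           ≈⟨ +-comm _ _ ⟩
      - x + y         ≈⟨ +-congˡ (-‿involutive y) ⟨
      - x + (- - y)   ≈⟨ ⁻¹-∙-comm x (- y) ⟩
      - (x - y)       ∎

  morphism : coefficients -Raw-AlmostCommutative⟶ fromCommutativeRing R
  morphism = record
    { ⟦_⟧    = ⟦_⟧ᶜ
    ; +-homo = λ { (a , b) (c , d) → begin
        ⟦ reduce (a ℕ.+ c) (b ℕ.+ d) ⟧ᶜ                  ≈⟨ ⟦reduce⟧ (a ℕ.+ c) (b ℕ.+ d) ⟩
        (a ℕ.+ c) · 1# - (b ℕ.+ d) · 1#                  ≈⟨ +-cong (×-homo-+ 1# a c) (-‿cong (×-homo-+ 1# b d)) ⟩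
        (a · 1# + c · 1#) - (b · 1# + d · 1#)            ≈⟨ +-difference _ _ _ _ ⟩
        (a · 1# - b · 1#) + (c · 1# - d · 1#)            ≈⟨ +-cong ⟦ a , b ⟧ᶜ≈ ⟦ c , d ⟧ᶜ≈ ⟨
        ⟦ a , b ⟧ᶜ + ⟦ c , d ⟧ᶜ                          ∎ }
    ; *-homo = λ { (a , b) (c , d) → begin
        ⟦ reduce (a ℕ.* c ℕ.+ b ℕ.* d) (a ℕ.* d ℕ.+ b ℕ.* c) ⟧ᶜ
          ≈⟨ ⟦reduce⟧ (a ℕ.* c ℕ.+ b ℕ.* d) (a ℕ.* d ℕ.+ b ℕ.* c) ⟩
        (a ℕ.* c ℕ.+ b ℕ.* d) · 1# - (a ℕ.* d ℕ.+ b ℕ.* c) · 1#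
          ≈⟨ +-cong (sumOfProducts a c b d) (-‿cong (sumOfProducts a d b c)) ⟩
        ((a · 1#) * (c · 1#) + (b · 1#) * (d · 1#)) - ((a · 1#) * (d · 1#) + (b · 1#) * (c · 1#))
          ≈⟨ *-difference _ _ _ _ ⟩
        (a · 1# - b · 1#) * (c · 1# - d · 1#)
          ≈⟨ *-cong ⟦ a , b ⟧ᶜ≈ ⟦ c , d ⟧ᶜ≈ ⟨
        ⟦ a , b ⟧ᶜ * ⟦ c , d ⟧ᶜ ∎ }
    ; -‿homo = λ { (a , b) → begin
        ⟦ b , a ⟧ᶜ                ≈⟨ ⟦ b , a ⟧ᶜ≈ ⟩
        b · 1# - a · 1#           ≈⟨ +-congʳ (-‿involutive _) ⟨
        (- - (b · 1#)) - a · 1#   ≈⟨ ⁻¹-∙-comm _ _ ⟩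
        - (- (b · 1#) + a · 1#)   ≈⟨ -‿cong (+-comm _ _) ⟩
        - (a · 1# - b · 1#)       ≈⟨ -‿cong ⟦ a , b ⟧ᶜ≈ ⟨
        - ⟦ a , b ⟧ᶜ              ∎ }
    ; 0-homo = refl
    ; 1-homo = refl
    }
    where
    sumOfProducts : ∀ a c b d →
      (a ℕ.* c ℕ.+ b ℕ.* d) · 1# ≈ (a · 1#) * (c · 1#) + (b · 1#) * (d · 1#)
    sumOfProducts a c b d =
      trans (×-homo-+ 1# (a ℕ.* c) (b ℕ.* d)) (+-cong (×1-homo-* a c) (×1-homo-* b d))

  _coeff≟_ : ∀ x y → Maybe (⟦ x ⟧ᶜ ≈ ⟦ y ⟧ᶜ)
  (a , b) coeff≟ (c , d) with a ℕ.≟ c | b ℕ.≟ d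
  ... | yes a≡c | yes b≡d = just (reflexive (≡.cong₂ (λ x y → ⟦ x , y ⟧ᶜ) a≡c b≡d))
  ... | _       | _       = nothing

  open import Algebra.Solver.Ring coefficients (fromCommutativeRing R) morphism _coeff≟_ public
    using (solve; _:+_; _:*_; _:-_; :-_; _:=_; con; Polynomial)

  :0 :1 : ∀ {n} → Polynomial n
  :0 = con (0 , 0)
  :1 = con (1 , 0)

open ≡ using (refl; sym; trans; cong; cong₂; subst; subst₂; module ≡-Reasoning)

-- Decidable subsets of finite sets

record Enumeration {q : ℕ} (P : Fin q → Set) (n : ℕ) : Set where
  field
    element   : Fin n → Fin q
    injective : Injective _≡_ _≡_ element
    sound     : ∀ i → P (element i)
    complete  : ∀ x → P x → ∃ λ i → element i ≡ x

module _ {q} {P : Fin (suc q) → Set} {n} (E : Enumeration (P ∘ suc) n) where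
  open Enumeration E

  include-zero : P zero → Enumeration P (suc n)
  include-zero p = record
    { element   = λ { zero → zero ; (suc i) → suc (element i) }
    ; injective = λ { {zero} {zero} _ → refl
                    ; {suc i} {suc j} eq → cong suc (injective (Finₚ.suc-injective eq)) }
    ; sound     = λ { zero → p ; (suc i) → sound i }
    ; complete  = λ { zero _ → zero , refl
                    ; (suc x) px → let i , eq = complete x px in suc i , cong suc eq } }

  exclude-zero : ¬ P zero → Enumeration P n
  exclude-zero ¬p = record
    { element   = suc ∘ element
    ; injective = injective ∘ Finₚ.suc-injective
    ; sound     = sound
    ; complete  = λ { zero p → contradiction p ¬p
                    ; (suc x) px → let i , eq = complete x px in i , cong suc eq } }

-- The complement is listed as well because the order of a fixed field is found by bounding both it
-- and its complement from above by numbers of roots.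
enumerate-split : ∀ q {P : Fin q → Set} → Decidable P →
  ∃ λ m → ∃ λ n → m ℕ.+ n ≡ q × Enumeration P m × Enumeration (¬_ ∘ P) n
enumerate-split zero P? = 0 , 0 , refl , nothing-to-enumerate , nothing-to-enumerate
  where
  nothing-to-enumerate : ∀ {P} → Enumeration {zero} P zero
  nothing-to-enumerate = record
    { element = λ () ; injective = λ { {()} } ; sound = λ () ; complete = λ () }
enumerate-split (suc q) {P} P? with enumerate-split q (P? ∘ suc) | P? zero
... | m , n , eq , E , E′ | yes p = suc m , n , cong suc eq , include-zero E p , exclude-zero E′ (λ ¬p → ¬p p)
... | m , n , eq , E , E′ | no ¬p =
  m , suc n , trans (ℕₚ.+-suc m n) (cong suc eq) , exclude-zero E ¬p , include-zero E′ ¬p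

injective⇒surjective : ∀ {m n} (f : Fin m → Fin n) → Injective _≡_ _≡_ f → n ℕ.≤ m →
  ∀ y → ∃ λ x → f x ≡ y
injective⇒surjective {m} {suc n} f f-inj n<m y with Finₚ.any? (λ x → f x Finₚ.≟ y)
... | yes hit = hit
... | no miss = contradiction (Finₚ.injective⇒≤ {f = f′} f′-injective) (ℕₚ.<⇒≱ n<m)
  where
  y≢f : ∀ x → y ≢ f x
  y≢f x eq = miss (x , sym eq)
  f′ : Fin m → Fin n
  f′ x = Fin.punchOut (y≢f x)
  f′-injective : Injective _≡_ _≡_ f′
  f′-injective eq = f-inj (Finₚ.punchOut-injective (y≢f _) (y≢f _) eq)

-- Finite fields carried by `Fin q`

record FinField (q : ℕ) : Set where
  infixl 6 _+_
  infixl 7 _*_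
  infix 8 -_
  infix 9 _⁻¹
  field
    _+_ _*_           : Op₂ (Fin q)
    -_ _⁻¹            : Op₁ (Fin q)
    0# 1#             : Fin q
    isCommutativeRing : IsCommutativeRing _≡_ _+_ _*_ -_ 0# 1#
    1≢0               : 1# ≢ 0#
    ⁻¹-inverse        : ∀ x → x ≢ 0# → x * x ⁻¹ ≡ 1#

  commutativeRing : CommutativeRing 0ℓ 0ℓ
  commutativeRing = record { isCommutativeRing = isCommutativeRing }

-- On `Fin q` with propositional equality, equality is decidable, every function respects it, and
-- sums over all elements and the pigeonhole principle are directly available.
module Transport {q : ℕ} (F : FiniteField q) where
  private
    module F = FiniteField F
    module card = Bijection F.card

  to : F.Carrier → Fin q
  to = card.to

  from : Fin q → F.Carrier
  from i = proj₁ (card.strictlySurjective i)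

  to∘from : ∀ i → to (from i) ≡ i
  to∘from i = proj₂ (card.strictlySurjective i)

  from∘to : ∀ x → from (to x) F.≈ x
  from∘to x = card.injective (to∘from (to x))

  from-injective : ∀ {i j} → from i F.≈ from j → i ≡ j
  from-injective eq = trans (sym (to∘from _)) (trans (card.cong eq) (to∘from _))

  rawRing : RawRing 0ℓ 0ℓ
  rawRing = record
    { Carrier = Fin q
    ; _≈_ = _≡_
    ; _+_ = λ x y → to (from x F.+ from y)
    ; _*_ = λ x y → to (from x F.* from y)
    ; -_  = λ x → to (F.- from x)
    ; 0#  = to F.0#
    ; 1#  = to F.1#
    }
  open RawRing rawRing

  from-isRingMonomorphism : IsRingMonomorphism rawRing F.rawRing from
  from-isRingMonomorphism = record
    { isRingHomomorphism = record
      { isSemiringHomomorphism = record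
        { isNearSemiringHomomorphism = record
          { +-isMonoidHomomorphism = record
            { isMagmaHomomorphism = record
              { isRelHomomorphism = record { cong = F.reflexive ∘ cong from }
              ; homo = λ _ _ → from∘to _ }
            ; ε-homo = from∘to _ }
          ; *-homo = λ _ _ → from∘to _ }
        ; 1#-homo = from∘to _ }
      ; -‿homo = λ _ → from∘to _ }
    ; injective = from-injective }

  inv : Fin q → Fin q
  inv x with x Finₚ.≟ 0#
  ... | yes _  = 0#
  ... | no x≢0 = to (proj₁ (F.inverse (from x) (λ eq → x≢0 (from-injective (F.trans eq (F.sym (from∘to _)))))))

  inv-inverse : ∀ x → x ≢ 0# → x * inv x ≡ 1#
  inv-inverse x x≢0 with x Finₚ.≟ 0#
  ... | yes x≡0 = contradiction x≡0 x≢0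
  ... | no x≢0′ = card.cong (F.trans (F.*-congˡ (from∘to _)) (proj₂ (F.inverse (from x) _)))

  finField : FinField q
  finField = record
    { _⁻¹ = inv
    ; isCommutativeRing = RingMonomorphism.isCommutativeRing from-isRingMonomorphism F.isCommutativeRing
    ; 1≢0 = λ eq → F.1≉0 (F.trans (F.sym (from∘to _)) (F.trans (F.reflexive (cong from eq)) (from∘to _)))
    ; ⁻¹-inverse = inv-inverse }

-- Finite fields

prime∣!⇒≤ : ∀ {p} → Prime p → ∀ k → p ∣ k ! → p ℕ.≤ k
prime∣!⇒≤ pp zero    p∣1 = contradiction (∣⇒≤ p∣1) (ℕₚ.<⇒≱ (ℕ.nonTrivial⇒n>1 _ {{prime⇒nonTrivial pp}}))
prime∣!⇒≤ pp (suc k) p∣[1+k]! with euclidsLemma (suc k) (k !) pp p∣[1+k]!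
... | inj₁ p∣1+k = ∣⇒≤ p∣1+k
... | inj₂ p∣k!  = ℕₚ.m≤n⇒m≤1+n (prime∣!⇒≤ pp k p∣k!)

prime∣binomial : ∀ {p} → Prime p → ∀ k → 0 ℕ.< k → k ℕ.< p → p ∣ p C k
prime∣binomial {p@(suc p-1)} pp k 0<k k<p
  with euclidsLemma (p C k) (k ! ℕ.* (p ℕ.∸ k) !) pp (subst (p ∣_) (sym product) (m∣m*n (p-1 !)))
  where
  instance _ = k ℕₚ.!* (p ℕ.∸ k) !≢0
  product : (p C k) ℕ.* (k ! ℕ.* (p ℕ.∸ k) !) ≡ p !
  product = trans (cong (λ c → c ℕ.* (k ! ℕ.* (p ℕ.∸ k) !)) (nCk≡n!/k![n-k]! (ℕₚ.<⇒≤ k<p))) (m/n*n≡m (k![n∸k]!∣n! (ℕₚ.<⇒≤ k<p)))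
... | inj₁ p∣pCk = p∣pCk
... | inj₂ p∣k![p-k]! with euclidsLemma (k !) ((p ℕ.∸ k) !) pp p∣k![p-k]!
...   | inj₁ p∣k!     = contradiction (prime∣!⇒≤ pp k p∣k!) (ℕₚ.<⇒≱ k<p)
...   | inj₂ p∣[p-k]! = contradiction (prime∣!⇒≤ pp (p ℕ.∸ k) p∣[p-k]!)
                          (ℕₚ.<⇒≱ (ℕₚ.∸-monoʳ-< 0<k (ℕₚ.<⇒≤ k<p)))
prime∣binomial {zero} pp k 0<k ()

-- `suc k` is the geometric sum 1 + (a + 1) + ... + (a + 1)^e. With a + 1 = p^d this makes q - 1 a
-- positive multiple of p^d - 1.
geometric-exponent : ∀ a e → ∃ λ k → suc a ℕ.^ suc e ≡ suc (suc k ℕ.* a)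
geometric-exponent a zero    = 0 , trans (ℕₚ.*-identityʳ (suc a)) (cong suc (sym (ℕₚ.+-identityʳ a)))
geometric-exponent a (suc e) with geometric-exponent a e
... | k , eq = suc a ℕ.* suc k , (begin
    suc a ℕ.* suc a ℕ.^ suc e               ≡⟨ cong (suc a ℕ.*_) eq ⟩
    suc a ℕ.* suc (suc k ℕ.* a)             ≡⟨ ℕₚ.*-suc (suc a) (suc k ℕ.* a) ⟩
    suc a ℕ.+ suc a ℕ.* (suc k ℕ.* a)       ≡⟨ cong (suc a ℕ.+_) (ℕₚ.*-assoc (suc a) (suc k) a) ⟨
    suc (suc (suc a ℕ.* suc k) ℕ.* a)       ∎)
  where open ≡-Reasoning

module FieldProperties {q : ℕ} (F : FinField q) where
  open FinField F using (1≢0; ⁻¹-inverse; _⁻¹; commutativeRing) public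
  open CommutativeRing commutativeRing public
    hiding (_≉_; refl; sym; trans; reflexive; isEquivalence; setoid; zero) renaming (_-_ to infixl 6 _-_)
  open IntegerCoefficientSolver commutativeRing public
  open import Algebra.Properties.Semiring.Exp semiring public using (_^_; ^-assocʳ)
  open import Algebra.Properties.CommutativeSemiring.Exp commutativeSemiring public using (^-distrib-*)
  open import Algebra.Properties.Semiring.Mult semiring using (×1-homo-*) renaming (_×_ to _·_)
  open import Algebra.Properties.CommutativeMonoid.Sum +-commutativeMonoid
    using (sum; sum-permute; ∑-distrib-+; sum-replicate)
  open import Algebra.Properties.CommutativeMonoid.Sum *-commutativeMonoid using () renaming (sum to product)
  open ≡-Reasoning

  infix 4 _≟_
  _≟_ : (x y : Fin q) → Dec (x ≡ y)
  _≟_ = Finₚ._≟_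

  x-y≡0⇒x≡y : ∀ {x y} → x - y ≡ 0# → x ≡ y
  x-y≡0⇒x≡y {x} {y} eq = begin
    x             ≡⟨ solve 2 (λ x y → x := (x :- y) :+ y) refl x y ⟩
    (x - y) + y   ≡⟨ cong (_+ y) eq ⟩
    0# + y        ≡⟨ +-identityˡ y ⟩
    y             ∎

  x≡y⇒x-y≡0 : ∀ {x y} → x ≡ y → x - y ≡ 0#
  x≡y⇒x-y≡0 {x} refl = -‿inverseʳ x

  *-cancelˡ-≢0 : ∀ a {x y} → a ≢ 0# → a * x ≡ a * y → x ≡ y
  *-cancelˡ-≢0 a {x} {y} a≢0 eq = trans (sym (undo x)) (trans (cong (a ⁻¹ *_) eq) (undo y))
    where
    undo : ∀ z → a ⁻¹ * (a * z) ≡ z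
    undo z = begin
      a ⁻¹ * (a * z)   ≡⟨ solve 3 (λ a b z → b :* (a :* z) := (a :* b) :* z) refl a (a ⁻¹) z ⟩
      (a * a ⁻¹) * z   ≡⟨ cong (_* z) (⁻¹-inverse a a≢0) ⟩
      1# * z           ≡⟨ *-identityˡ z ⟩
      z                ∎

  x*y≡0⇒y≡0 : ∀ {x y} → x ≢ 0# → x * y ≡ 0# → y ≡ 0#
  x*y≡0⇒y≡0 {x} x≢0 eq = *-cancelˡ-≢0 x x≢0 (trans eq (sym (zeroʳ x)))

  *-≢0 : ∀ {x y} → x ≢ 0# → y ≢ 0# → x * y ≢ 0#
  *-≢0 x≢0 y≢0 eq = y≢0 (x*y≡0⇒y≡0 x≢0 eq)

  ⁻¹-≢0 : ∀ {x} → x ≢ 0# → x ⁻¹ ≢ 0#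
  ⁻¹-≢0 {x} x≢0 eq = 1≢0 (trans (sym (⁻¹-inverse x x≢0)) (trans (cong (x *_) eq) (zeroʳ x)))

  ^≡0⇒≡0 : ∀ n {x} → x ^ n ≡ 0# → x ≡ 0#
  ^≡0⇒≡0 zero    eq = contradiction eq 1≢0
  ^≡0⇒≡0 (suc n) {x} eq with x ≟ 0#
  ... | yes x≡0 = x≡0
  ... | no x≢0  = ^≡0⇒≡0 n (x*y≡0⇒y≡0 x≢0 eq)

  1^ : ∀ n → 1# ^ n ≡ 1#
  1^ zero    = refl
  1^ (suc n) = trans (*-identityˡ _) (1^ n)

  -- Translation by 1 permutes the field, so the sum of all elements is unchanged by adding q · 1.
  order·1≡0 : q · 1# ≡ 0#
  order·1≡0 = begin
    q · 1#                              ≡⟨ solve 2 (λ s t → t := (s :+ t) :- s) refl S (q · 1#) ⟩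
    (S + q · 1#) - S                    ≡⟨ cong (_- S) shifted ⟨
    S - S                               ≡⟨ -‿inverseʳ S ⟩
    0#                                  ∎
    where
    S = sum {q} (λ x → x)
    π : Permutation q q
    π = permutation (_+ 1#) (_- 1#)
      (λ x → solve 1 (λ x → (x :- :1) :+ :1 := x) refl x)
      (λ x → solve 1 (λ x → (x :+ :1) :- :1 := x) refl x)
    shifted : S ≡ S + q · 1#
    shifted = begin
      S                              ≡⟨ sum-permute (λ x → x) π ⟩
      sum {q} (λ x → x + 1#)         ≡⟨ ∑-distrib-+ (λ x → x) (λ _ → 1#) ⟩
      S + sum {q} (λ _ → 1#)         ≡⟨ cong (S +_) (sum-replicate q) ⟩
      S + q · 1#                     ∎

  characteristic : ∀ {p} e → q ≡ p ℕ.^ e → p · 1# ≡ 0#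
  -- Since q = p^e, the element q · 1 = 0 is the e-th power of p · 1, and a field has no nilpotent
  -- elements other than 0.
  characteristic {p} e refl = ^≡0⇒≡0 e (trans (sym (·1-^ e)) order·1≡0)
    where
    ·1-^ : ∀ n → (p ℕ.^ n) · 1# ≡ (p · 1#) ^ n
    ·1-^ zero    = +-identityʳ 1#
    ·1-^ (suc n) = trans (×1-homo-* p (p ℕ.^ n)) (cong (p · 1# *_) (·1-^ n))

  ∏≢0 : ∀ {n} (f : Fin n → Fin q) → (∀ i → f i ≢ 0#) → product f ≢ 0#
  ∏≢0 {zero}  f f≢0 = 1≢0
  ∏≢0 {suc n} f f≢0 = *-≢0 (f≢0 zero) (∏≢0 (f ∘ suc) (f≢0 ∘ suc))

replaceZero : ∀ {m} (F : FinField (suc m)) → Fin (suc m) → Fin (suc m) → Fin (suc m)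
replaceZero F x y with x Finₚ.≟ FinField.0# F
... | yes _ = FinField.1# F
... | no  _ = y

-- Multiplication by `a` permutes the field, so it preserves the product of the nonzero elements
-- while contributing one factor `a` for each of them. `replaceZero` lets the zero element
-- contribute 1, so that all products run over the whole field.
lagrange-suc : ∀ {m} (F : FinField (suc m)) → let open FieldProperties F in
  ∀ a → a ≢ 0# → a ^ m ≡ 1#
lagrange-suc {m} F a a≢0 = *-cancelˡ-≢0 (product g) (∏≢0 g g≢0) (begin
  product g * a ^ m                     ≡⟨ cong (product g *_) ∏h ⟨
  product g * product h                 ≡⟨ *-comm _ _ ⟩
  product h * product g                 ≡⟨ product-distrib h g ⟨
  product (λ x → h x * g x)             ≡⟨ product-cong g∘π ⟨
  product (λ x → g (a * x))             ≡⟨ product-permute g π ⟨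
  product g                             ≡⟨ *-identityʳ _ ⟨
  product g * 1#                        ∎)
  where
  open FieldProperties F
  open import Algebra.Properties.CommutativeMonoid.Sum *-commutativeMonoid using ()
    renaming (sum to product; sum-permute to product-permute; ∑-distrib-+ to product-distrib;
          sum-replicate to product-replicate; sum-remove to product-remove; sum-cong-≗ to product-cong)
  open ≡-Reasoning
  g h : Fin (suc m) → Fin (suc m)
  g x = replaceZero F x x
  h x = replaceZero F x a
  g≢0 : ∀ x → g x ≢ 0#
  g≢0 x with x Finₚ.≟ 0#
  ... | yes _  = 1≢0
  ... | no x≢0 = x≢0
  cancel : ∀ {b c} → b * c ≡ 1# → ∀ x → b * (c * x) ≡ x
  cancel {b} {c} eq x = trans (sym (*-assoc b c x)) (trans (cong (_* x) eq) (*-identityˡ x))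
  π : Permutation (suc m) (suc m)
  π = permutation (a *_) (a ⁻¹ *_)
    (cancel (⁻¹-inverse a a≢0))
    (cancel (trans (*-comm (a ⁻¹) a) (⁻¹-inverse a a≢0)))
  g∘π : ∀ x → g (a * x) ≡ h x * g x
  g∘π x with a * x Finₚ.≟ 0# | x Finₚ.≟ 0#
  ... | yes _    | yes _    = sym (*-identityˡ 1#)
  ... | no ax≢0  | yes refl = contradiction (zeroʳ a) ax≢0
  ... | yes ax≡0 | no x≢0   = contradiction ax≡0 (*-≢0 a≢0 x≢0)
  ... | no _     | no _     = refl
  h[0] : h 0# ≡ 1#
  h[0] with 0# Finₚ.≟ 0#
  ... | yes _  = refl
  ... | no 0≢0 = contradiction refl 0≢0
  h[x] : ∀ x → x ≢ 0# → h x ≡ a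
  h[x] x x≢0 with x Finₚ.≟ 0#
  ... | yes x≡0 = contradiction x≡0 x≢0
  ... | no _    = refl
  ∏h : product h ≡ a ^ m
  ∏h = begin
    product h                            ≡⟨ product-remove {i = 0#} h ⟩
    h 0# * product (removeAt h 0#)       ≡⟨ cong₂ _*_ h[0] (product-cong (λ j → h[x] _ (Finₚ.punchInᵢ≢i 0# j))) ⟩
    1# * product {m} (λ _ → a)           ≡⟨ *-identityˡ _ ⟩
    product {m} (λ _ → a)                ≡⟨ product-replicate m ⟩
    a ^ m                                ∎

lagrange : ∀ {q} (F : FinField q) → let open FieldProperties F in
  ∀ a → a ≢ 0# → a ^ ℕ.pred q ≡ 1#
lagrange {suc m} = lagrange-suc

-- Monic polynomials and their roots

module Polynomials {q : ℕ} (F : FinField q) where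
  open FieldProperties F
  open ≡-Reasoning

  -- A vector of length n stands for the monic polynomial of degree n with these lower coefficients,
  -- constant term first.
  eval : ∀ {n} → Vec (Fin q) n → Fin q → Fin q
  eval []      x = 1#
  eval (c ∷ f) x = c + x * eval f x

  -- Synthetic division by x - a; the remainder is `eval f a`.
  quotient : ∀ {n} → Vec (Fin q) (suc n) → Fin q → Vec (Fin q) n
  quotient (c ∷ [])    a = []
  quotient (c ∷ d ∷ f) a = eval (d ∷ f) a ∷ quotient (d ∷ f) a

  eval-quotient : ∀ {n} (f : Vec (Fin q) (suc n)) a x →
    eval f x - eval f a ≡ (x - a) * eval (quotient f a) x
  eval-quotient (c ∷ []) a x =
    solve 4 (λ c a x o → (c :+ x :* o) :- (c :+ a :* o) := (x :- a) :* o) refl c a x 1#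
  eval-quotient (c ∷ f@(_ ∷ _)) a x = begin
    (c + x * X) - (c + a * A)       ≡⟨ solve 5 (λ c a x X A → (c :+ x :* X) :- (c :+ a :* A)
                                                           := (x :- a) :* A :+ x :* (X :- A)) refl c a x X A ⟩
    (x - a) * A + x * (X - A)       ≡⟨ cong (λ z → (x - a) * A + x * z) (eval-quotient f a x) ⟩
    (x - a) * A + x * ((x - a) * Q) ≡⟨ solve 4 (λ a x A Q → (x :- a) :* A :+ x :* ((x :- a) :* Q)
                                                          := (x :- a) :* (A :+ x :* Q)) refl a x A Q ⟩
    (x - a) * (A + x * Q)           ∎
    where
    X = eval f x
    A = eval f a
    Q = eval (quotient f a) x

  rootCount : ∀ {n k} (f : Vec (Fin q) n) (root : Fin k → Fin q) →
    Injective _≡_ _≡_ root → (∀ i → eval f (root i) ≡ 0#) → k ℕ.≤ n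
  rootCount {k = zero}  f  root inj vanish = z≤n
  rootCount {k = suc k} [] root inj vanish = contradiction (vanish zero) 1≢0
  rootCount {k = suc k} f@(_ ∷ _) root inj vanish =
    s≤s (rootCount (quotient f a) (root ∘ suc) (Finₚ.suc-injective ∘ inj) (λ i →
      x*y≡0⇒y≡0 (λ eq → Finₚ.0≢1+n (sym (inj (x-y≡0⇒x≡y eq))))
        (trans (sym (eval-quotient f a (root (suc i))))
               (x≡y⇒x-y≡0 (trans (vanish (suc i)) (sym (vanish zero)))))))
    where a = root zero

  eval-shift : ∀ m {n} (f : Vec (Fin q) n) x → eval (replicate m 0# ++ f) x ≡ x ^ m * eval f x
  eval-shift zero    f x = sym (*-identityˡ _)
  eval-shift (suc m) f x = begin
    0# + x * eval (replicate m 0# ++ f) x   ≡⟨ +-identityˡ _ ⟩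
    x * eval (replicate m 0# ++ f) x        ≡⟨ cong (x *_) (eval-shift m f x) ⟩
    x * (x ^ m * eval f x)                  ≡⟨ *-assoc x (x ^ m) _ ⟨
    x ^ suc m * eval f x                    ∎

  eval-monomial : ∀ m x → eval (replicate m 0#) x ≡ x ^ m
  eval-monomial zero    x = refl
  eval-monomial (suc m) x = trans (+-identityˡ _) (cong (x *_) (eval-monomial m x))

  geometric : ∀ a s → Vec (Fin q) (s ℕ.* suc a)
  geometric a zero    = []
  geometric a (suc s) = 1# ∷ (replicate a 0# ++ geometric a s)

  eval-geometric : ∀ a s x → (x ^ suc a - 1#) * eval (geometric a s) x ≡ (x ^ suc a) ^ suc s - 1#
  eval-geometric a zero    x =
    trans (*-identityʳ _) (cong (_- 1#) (sym (*-identityʳ _)))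
  eval-geometric a (suc s) x = begin
    (z - 1#) * (1# + x * eval (replicate a 0# ++ g) x)
      ≡⟨ cong (λ e → (z - 1#) * (1# + x * e)) (eval-shift a g x) ⟩
    (z - 1#) * (1# + x * (x ^ a * eval g x))
      ≡⟨ solve 5 (λ z o x y g → (z :- o) :* (o :+ x :* (y :* g))
                             := (z :- o) :* o :+ (x :* y) :* ((z :- o) :* g)) refl z 1# x (x ^ a) (eval g x) ⟩
    (z - 1#) * 1# + z * ((z - 1#) * eval g x)
      ≡⟨ cong₂ (λ u v → u + z * v) (*-identityʳ _) (eval-geometric a s x) ⟩
    (z - 1#) + z * (z ^ suc s - 1#)
      ≡⟨ solve 3 (λ z o w → (z :- o) :+ z :* (w :- o) := (z :* w :- o) :+ (z :- z :* o)) refl z 1# (z ^ suc s) ⟩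
    (z ^ suc (suc s) - 1#) + (z - z * 1#)
      ≡⟨ cong ((z ^ suc (suc s) - 1#) +_) (x≡y⇒x-y≡0 (sym (*-identityʳ z))) ⟩
    (z ^ suc (suc s) - 1#) + 0#
      ≡⟨ +-identityʳ _ ⟩
    z ^ suc (suc s) - 1# ∎
    where
    z = x ^ suc a
    g = geometric a s

-- Frobenius maps and their fixed fields

module FixedFields {q : ℕ} (F : FinField q) {p : ℕ} (pp : Prime p) {e : ℕ} (q≡p^e : q ≡ p ℕ.^ e) where
  open FieldProperties F public
  open Polynomials F
  open import Algebra.Properties.CommutativeMonoid.Sum +-commutativeMonoid
    using (sum; sum-init-last; sum-cong-≗; sum-replicate-zero)
  open import Algebra.Properties.Monoid.Mult +-monoid using () renaming (_×_ to _·_; ×-assocˡ to ·-assocˡ)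
  open import Algebra.Properties.Semiring.Mult semiring using () renaming (×-assoc-* to ·-assoc-*)
  import Algebra.Properties.CommutativeSemiring.Binomial commutativeSemiring as Binomial
  open ≡-Reasoning

  ∣⇒·≡0 : ∀ {n} → p ∣ n → ∀ x → n · x ≡ 0#
  ∣⇒·≡0 (divides k refl) x = begin
    (k ℕ.* p) · x          ≡⟨ cong (_· x) (ℕₚ.*-comm k p) ⟩
    (p ℕ.* k) · x          ≡⟨ ·-assocˡ x p k ⟨
    p · (k · x)            ≡⟨ cong (p ·_) (*-identityˡ _) ⟨
    p · (1# * (k · x))     ≡⟨ ·-assoc-* p 1# (k · x) ⟨
    p · 1# * (k · x)       ≡⟨ cong (_* (k · x)) (characteristic e q≡p^e) ⟩
    0# * (k · x)           ≡⟨ zeroˡ _ ⟩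
    0#                     ∎

  frobenius-+ : ∀ x y → (x + y) ^ p ≡ x ^ p + y ^ p
  frobenius-+ x y = go p refl
    where
    go : ∀ n → n ≡ p → (x + y) ^ n ≡ x ^ n + y ^ n
    go zero          n≡p = contradiction (sym n≡p) (ℕ.≢-nonZero⁻¹ p {{prime⇒nonZero pp}})
    go n@(suc m) n≡p = begin
      (x + y) ^ n                                                 ≡⟨ Binomial.theorem n x y ⟩
      term zero + sum {n} (term ∘ suc)                            ≡⟨ cong₂ _+_ first (sum-init-last (term ∘ suc)) ⟩
      y ^ n + (sum (λ j → term (suc (Fin.inject₁ j))) + term (suc (Fin.fromℕ m)))
        ≡⟨ cong₂ (λ u v → y ^ n + (u + v)) (trans (sum-cong-≗ middle) (sum-replicate-zero m)) last-term ⟩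
      y ^ n + (0# + x ^ n)                                        ≡⟨ cong (y ^ n +_) (+-identityˡ _) ⟩
      y ^ n + x ^ n                                               ≡⟨ +-comm _ _ ⟩
      x ^ n + y ^ n                                               ∎
      where
      term : Fin (suc n) → Fin q
      term = Binomial.binomialTerm x y n
      first : term zero ≡ y ^ n
      first = trans (+-identityʳ _) (*-identityˡ _)
      last-term : term (suc (Fin.fromℕ m)) ≡ x ^ n
      last-term rewrite Finₚ.toℕ-fromℕ m | nCn≡1 n | ℕₚ.n∸n≡0 m = trans (+-identityʳ _) (*-identityʳ _)
      middle : ∀ j → term (suc (Fin.inject₁ j)) ≡ 0#
      middle j = ∣⇒·≡0 (subst (_∣ (n C k)) n≡p (prime∣binomial (subst Prime (sym n≡p) pp) k (s≤s z≤n) k<n)) _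
        where
        k : ℕ
        k = suc (Fin.toℕ (Fin.inject₁ j))
        k<n : k ℕ.< n
        k<n = s≤s (subst (ℕ._< m) (sym (Finₚ.toℕ-inject₁ j)) (Finₚ.toℕ<n j))

  φ : ℕ → Fin q → Fin q
  φ d x = x ^ (p ℕ.^ d)

  φ-suc : ∀ d x → φ (suc d) x ≡ φ d (x ^ p)
  φ-suc d x = sym (^-assocʳ x p (p ℕ.^ d))

  φ-+ : ∀ d x y → φ d (x + y) ≡ φ d x + φ d y
  φ-+ zero    x y = trans (*-identityʳ _) (sym (cong₂ _+_ (*-identityʳ x) (*-identityʳ y)))
  φ-+ (suc d) x y = begin
    φ (suc d) (x + y)           ≡⟨ φ-suc d (x + y) ⟩
    φ d ((x + y) ^ p)           ≡⟨ cong (φ d) (frobenius-+ x y) ⟩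
    φ d (x ^ p + y ^ p)         ≡⟨ φ-+ d (x ^ p) (y ^ p) ⟩
    φ d (x ^ p) + φ d (y ^ p)   ≡⟨ cong₂ _+_ (φ-suc d x) (φ-suc d y) ⟨
    φ (suc d) x + φ (suc d) y   ∎

  φ-* : ∀ d x y → φ d (x * y) ≡ φ d x * φ d y
  φ-* d x y = ^-distrib-* x y (p ℕ.^ d)

  1≤p^ : ∀ d → 1 ℕ.≤ p ℕ.^ d
  1≤p^ d = ℕₚ.m^n>0 p {{prime⇒nonZero pp}} d

  φ-0 : ∀ d → φ d 0# ≡ 0#
  φ-0 d with p ℕ.^ d | 1≤p^ d
  ... | suc n | _ = zeroˡ _

  φ-neg : ∀ d x → φ d (- x) ≡ - φ d x
  φ-neg d x = begin
    φ d (- x)                          ≡⟨ solve 2 (λ y z → y := (z :+ y) :- z) refl (φ d (- x)) (φ d x) ⟩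
    (φ d x + φ d (- x)) - φ d x        ≡⟨ cong (_- φ d x) (φ-+ d x (- x)) ⟨
    φ d (x - x) - φ d x                ≡⟨ cong (λ z → φ d z - φ d x) (-‿inverseʳ x) ⟩
    φ d 0# - φ d x                     ≡⟨ cong (_- φ d x) (φ-0 d) ⟩
    0# - φ d x                         ≡⟨ +-identityˡ _ ⟩
    - φ d x                            ∎

  -- For positive d dividing e this is the subfield of order p^d, described by an equation and hence
  -- decidable.
  Fix : ℕ → Fin q → Set
  Fix d x = φ d x ≡ x

  fix? : ∀ d x → Dec (Fix d x)
  fix? d x = φ d x ≟ x

  fix-+ : ∀ d {x y} → Fix d x → Fix d y → Fix d (x + y)
  fix-+ d fx fy = trans (φ-+ d _ _) (cong₂ _+_ fx fy)

  fix-* : ∀ d {x y} → Fix d x → Fix d y → Fix d (x * y)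
  fix-* d fx fy = trans (φ-* d _ _) (cong₂ _*_ fx fy)

  fix-neg : ∀ d {x} → Fix d x → Fix d (- x)
  fix-neg d fx = trans (φ-neg d _) (cong -_ fx)

  fix-minus : ∀ d {x y} → Fix d x → Fix d y → Fix d (x - y)
  fix-minus d fx fy = fix-+ d fx (fix-neg d fy)

  fix-0 : ∀ d → Fix d 0#
  fix-0 = φ-0

  fix-1 : ∀ d → Fix d 1#
  fix-1 d = 1^ (p ℕ.^ d)

  fix-⁻¹ : ∀ d {x} → x ≢ 0# → Fix d x → Fix d (x ⁻¹)
  fix-⁻¹ d {x} x≢0 fx = *-cancelˡ-≢0 x x≢0 (begin
    x * φ d (x ⁻¹)      ≡⟨ cong (_* φ d (x ⁻¹)) fx ⟨
    φ d x * φ d (x ⁻¹)  ≡⟨ φ-* d x (x ⁻¹) ⟨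
    φ d (x * x ⁻¹)      ≡⟨ cong (φ d) (⁻¹-inverse x x≢0) ⟩
    φ d 1#              ≡⟨ fix-1 d ⟩
    1#                  ≡⟨ ⁻¹-inverse x x≢0 ⟨
    x * x ⁻¹            ∎)

  -- X^q - X is the product of X^(p^d) - X and a geometric sum of degree q - p^d. Fixed elements are
  -- roots of the first factor and all others are roots of the second, so there are at most p^d and
  -- at most q - p^d of them; as they add up to q, both bounds are attained.
  fix-enumeration : ∀ d c → 0 ℕ.< d → d ℕ.* suc c ≡ e → Enumeration (Fix d) (p ℕ.^ d)
  fix-enumeration d c 0<d d*[1+c]≡e with enumerate-split q (fix? d)
  ... | m , n , m+n≡q , E , E′ = subst (Enumeration (Fix d)) (ℕₚ.≤-antisym upper lower) E
    where
    2≤p^d : 2 ℕ.≤ p ℕ.^ d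
    2≤p^d = ℕₚ.≤-trans (ℕ.nonTrivial⇒n>1 p {{prime⇒nonTrivial pp}})
      (subst (ℕ._≤ p ℕ.^ d) (ℕₚ.*-identityʳ p) (ℕₚ.^-monoʳ-≤ p {{prime⇒nonZero pp}} 0<d))
    a : ℕ
    a = p ℕ.^ d ℕ.∸ 2
    p^d≡ : p ℕ.^ d ≡ suc (suc a)
    p^d≡ = sym (ℕₚ.m+[n∸m]≡n 2≤p^d)
    upper : m ℕ.≤ p ℕ.^ d
    -- The lower coefficients 0, -1, 0, ..., 0 are those of the monic polynomial X^(p^d) - X.
    upper = subst (m ℕ.≤_) (sym p^d≡) (rootCount (0# ∷ - 1# ∷ replicate a 0#) (Enumeration.element E)
      (Enumeration.injective E) (λ i → vanish (Enumeration.element E i) (Enumeration.sound E i)))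
      where
      vanish : ∀ x → Fix d x → eval (0# ∷ - 1# ∷ replicate a 0#) x ≡ 0#
      vanish x fx = begin
        0# + x * (- 1# + x * eval (replicate a 0#) x)
          ≡⟨ cong (λ t → 0# + x * (- 1# + x * t)) (eval-monomial a x) ⟩
        0# + x * (- 1# + x * x ^ a)
          ≡⟨ solve 3 (λ x o y → :0 :+ x :* (:- o :+ y) := x :* y :- x :* o) refl x 1# (x ^ suc a) ⟩
        x ^ suc (suc a) - x * 1#
          ≡⟨ x≡y⇒x-y≡0 (trans (cong (x ^_) (sym p^d≡)) (trans fx (sym (*-identityʳ x)))) ⟩
        0# ∎
    s : ℕ
    s = proj₁ (geometric-exponent (suc a) c)
    q≡ : q ≡ suc (suc s ℕ.* suc a)
    q≡ = begin
      q                             ≡⟨ q≡p^e ⟩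
      p ℕ.^ e                       ≡⟨ cong (p ℕ.^_) d*[1+c]≡e ⟨
      p ℕ.^ (d ℕ.* suc c)           ≡⟨ ℕₚ.^-*-assoc p d (suc c) ⟨
      (p ℕ.^ d) ℕ.^ suc c           ≡⟨ cong (ℕ._^ suc c) p^d≡ ⟩
      suc (suc a) ℕ.^ suc c         ≡⟨ proj₂ (geometric-exponent (suc a) c) ⟩
      suc (suc s ℕ.* suc a)         ∎
    n≤ : n ℕ.≤ s ℕ.* suc a
    n≤ = rootCount (geometric a s) (Enumeration.element E′) (Enumeration.injective E′)
      (λ i → vanish (Enumeration.element E′ i) (Enumeration.sound E′ i))
      where
      vanish : ∀ x → ¬ Fix d x → eval (geometric a s) x ≡ 0#
      -- With z = x^(p^d - 1), the product of z - 1 and the geometric sum is z^(s + 1) - 1 = x^(q -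
      -- 1) - 1 = 0, and z ≠ 1 because x is not fixed.
      vanish x ¬fx = x*y≡0⇒y≡0 x^[1+a]≢1 (trans (eval-geometric a s x) (x≡y⇒x-y≡0 (begin
        (x ^ suc a) ^ suc s        ≡⟨ ^-assocʳ x (suc a) (suc s) ⟩
        x ^ (suc a ℕ.* suc s)      ≡⟨ cong (x ^_) (ℕₚ.*-comm (suc a) (suc s)) ⟩
        x ^ (suc s ℕ.* suc a)      ≡⟨ cong (λ n → x ^ ℕ.pred n) q≡ ⟨
        x ^ ℕ.pred q               ≡⟨ lagrange F x (λ { refl → ¬fx (fix-0 d) }) ⟩
        1#                         ∎)))
        where
        x^[1+a]≢1 : x ^ suc a - 1# ≢ 0#
        x^[1+a]≢1 eq = ¬fx (trans (cong (x ^_) p^d≡) (trans (cong (x *_) (x-y≡0⇒x≡y eq)) (*-identityʳ x)))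
    lower : p ℕ.^ d ℕ.≤ m
    lower = ℕₚ.+-cancelʳ-≤ (s ℕ.* suc a) (p ℕ.^ d) m (ℕₚ.≤-trans (ℕₚ.≤-reflexive
      (trans (cong (ℕ._+ s ℕ.* suc a) p^d≡) (trans (sym q≡) (sym m+n≡q)))) (ℕₚ.+-monoʳ-≤ m n≤))

-- A tower of subfields

funToFin-cong : ∀ {d n} {f g : Fin d → Fin n} → (∀ i → f i ≡ g i) → funToFin f ≡ funToFin g
funToFin-cong {zero}  eq = refl
funToFin-cong {suc d} eq = cong₂ Fin.combine (eq zero) (funToFin-cong (eq ∘ suc))

finToFun-injective : ∀ {n} d {i j : Fin (n ℕ.^ d)} → (∀ x → finToFun i x ≡ finToFun j x) → i ≡ j
finToFun-injective {n} d {i} {j} eq = begin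
  i                             ≡⟨ Finₚ.funToFin-finToFin {d} i ⟨
  funToFin {d} (finToFun i)     ≡⟨ funToFin-cong {d} eq ⟩
  funToFin {d} (finToFun j)     ≡⟨ Finₚ.funToFin-finToFin {d} j ⟩
  j                             ∎
  where open ≡-Reasoning

-- A surjective `f` has a section, which is injective and therefore, on a finite set, surjective;
-- then `f` would be inverse to it and so injective.
notInjective⇒notSurjective : ∀ {n} (f : Fin n → Fin n) {i j} → i ≢ j → f i ≡ f j →
  ∃ λ y → ∀ x → f x ≢ y
notInjective⇒notSurjective {n} f {i} {j} i≢j fi≡fj
  with Finₚ.all? (λ y → Finₚ.any? (λ x → f x Finₚ.≟ y))
... | no ¬surj =
  let y , ¬hit = Finₚ.¬∀⟶∃¬ n _ (λ y → Finₚ.any? (λ x → f x Finₚ.≟ y)) ¬surj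
  in y , λ x eq → ¬hit (x , eq)
... | yes surj = contradiction i≡j i≢j
  where
  g : Fin n → Fin n
  g y = proj₁ (surj y)
  f∘g : ∀ y → f (g y) ≡ y
  f∘g y = proj₂ (surj y)
  g-surjective : ∀ x → ∃ λ y → g y ≡ x
  g-surjective = injective⇒surjective g (λ {x} {y} eq → trans (sym (f∘g x)) (trans (cong f eq) (f∘g y))) ℕₚ.≤-refl
  section : ∀ x → g (f x) ≡ x
  section x = let y , gy≡x = g-surjective x in
    trans (cong (g ∘ f) (sym gy≡x)) (trans (cong g (f∘g y)) gy≡x)
  i≡j : i ≡ j
  i≡j = trans (sym (section i)) (trans (cong g fi≡fj) (section j))

module _ {q : ℕ} {P : Fin q → Set} {n} (E : Enumeration P n) where
  open Enumeration E

  index-of : ∀ {N} (f : Fin N → Fin q) → (∀ i → P (f i)) → Fin N → Fin n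
  index-of f Pf i = proj₁ (complete (f i) (Pf i))

  element∘index-of : ∀ {N} (f : Fin N → Fin q) (Pf : ∀ i → P (f i)) i → element (index-of f Pf i) ≡ f i
  element∘index-of f Pf i = proj₂ (complete (f i) (Pf i))

  escape : Decidable P → ∀ {N} (f : Fin N → Fin q) → Injective _≡_ _≡_ f → n ℕ.< N → ∃ λ i → ¬ P (f i)
  escape P? {N} f f-inj n<N with Finₚ.all? (P? ∘ f)
  ... | no ¬all = Finₚ.¬∀⟶∃¬ N _ (P? ∘ f) ¬all
  ... | yes Pf  =
    let i , j , i<j , eq = Finₚ.pigeonhole n<N (index-of f Pf)
    in contradiction (f-inj (trans (sym (element∘index-of f Pf i))
                             (trans (cong element eq) (element∘index-of f Pf j)))) (Finₚ.<⇒≢ i<j)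

module SubfieldTower {q : ℕ} (F : FinField q) {p : ℕ} (pp : Prime p) (q≡p^6 : q ≡ p ℕ.^ 6) where
  open FixedFields F pp {6} q≡p^6 public
  open ≡-Reasoning

  private instance
    p≢0 = prime⇒nonZero pp

  1<p : 1 ℕ.< p
  1<p = ℕ.nonTrivial⇒n>1 p {{prime⇒nonTrivial pp}}

  abstract
    K-enumeration : Enumeration (Fix 3) (p ℕ.^ 3)
    K-enumeration = fix-enumeration 3 1 (s≤s z≤n) refl

    k-enumeration : Enumeration (Fix 1) p
    k-enumeration = subst (Enumeration (Fix 1)) (ℕₚ.*-identityʳ p) (fix-enumeration 1 5 (s≤s z≤n) refl)

  module K = Enumeration K-enumeration
  module k = Enumeration k-enumeration

  fix1⇒^p : ∀ {x} → Fix 1 x → x ^ p ≡ x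
  fix1⇒^p {x} fx = trans (cong (x ^_) (sym (ℕₚ.*-identityʳ p))) fx

  ^p⇒fix1 : ∀ {x} → x ^ p ≡ x → Fix 1 x
  ^p⇒fix1 {x} eq = trans (cong (x ^_) (ℕₚ.*-identityʳ p)) eq

  φ3 : ∀ x → φ 3 x ≡ ((x ^ p) ^ p) ^ p
  φ3 x = begin
    φ 3 x                         ≡⟨ φ-suc 2 x ⟩
    φ 2 (x ^ p)                   ≡⟨ φ-suc 1 (x ^ p) ⟩
    φ 1 ((x ^ p) ^ p)             ≡⟨ cong (((x ^ p) ^ p) ^_) (ℕₚ.*-identityʳ p) ⟩
    ((x ^ p) ^ p) ^ p             ∎

  k⊆K : ∀ {x} → Fix 1 x → Fix 3 x
  k⊆K {x} fx = trans (φ3 x) (trans (cong (λ y → (y ^ p) ^ p) e) (trans (cong (_^ p) e) e))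
    where
    e : x ^ p ≡ x
    e = fix1⇒^p fx

  ω-existence : ∃ λ ω → ¬ Fix 3 ω
  ω-existence = escape K-enumeration (fix? 3) (λ x → x) (λ eq → eq)
    (subst (p ℕ.^ 3 ℕ.<_) (sym q≡p^6) (ℕₚ.^-monoʳ-< p 1<p {x = 3} {y = 6} (s≤s (s≤s (s≤s (s≤s z≤n))))))

  m-existence : ∃ λ i → ¬ Fix 1 (K.element i)
  m-existence = escape k-enumeration (fix? 1) K.element K.injective
    (subst (ℕ._< p ℕ.^ 3) (ℕₚ.*-identityʳ p) (ℕₚ.^-monoʳ-< p 1<p {x = 1} {y = 3} (s≤s (s≤s z≤n))))

  abstract
    m : Fin q
    m = K.element (proj₁ m-existence)

    m∈K : Fix 3 m
    m∈K = K.sound (proj₁ m-existence)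

    m^p≢m : m ^ p ≢ m
    m^p≢m eq = proj₂ m-existence (^p⇒fix1 eq)

  lin : (Fin 3 → Fin q) → Fin q
  lin c = c 0F + c 1F * m + c 2F * (m * m)

  -- Two roots m, m^p of c₀ + c₁x + c₂x² have sum −c₁/c₂; applying Frobenius to this relation
  -- gives m^(p²) = m, which together with m^(p³) = m forces m^p = m.
  quadratic-leading≡0 : ∀ {c₀ c₁ c₂} → Fix 1 c₀ → Fix 1 c₁ → Fix 1 c₂ →
    c₀ + c₁ * m + c₂ * (m * m) ≡ 0# → c₂ ≡ 0#
  quadratic-leading≡0 {c₀} {c₁} {c₂} f₀ f₁ f₂ root = decidable-stable (c₂ ≟ 0#) (λ c₂≢0 →
    m^p≢m (begin
      m′               ≡⟨ cong (_^ p) (x-y≡0⇒x≡y (x*y≡0⇒y≡0 c₂≢0 c₂[m″-m]≡0)) ⟨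
      (m′ ^ p) ^ p     ≡⟨ φ3 m ⟨
      φ 3 m            ≡⟨ m∈K ⟩
      m                ∎))
    where
    m′ : Fin q
    m′ = m ^ p
    conjugate : ∀ {c} → Fix 1 c → ∀ x → (c * x) ^ p ≡ c * x ^ p
    conjugate fc x = trans (^-distrib-* _ x p) (cong (_* x ^ p) (fix1⇒^p fc))
    root′ : c₀ + c₁ * m′ + c₂ * (m′ * m′) ≡ 0#
    root′ = begin
      c₀ + c₁ * m′ + c₂ * (m′ * m′)
        ≡⟨ cong₂ _+_ (cong₂ _+_ (sym (fix1⇒^p f₀)) (sym (conjugate f₁ m)))
                     (trans (cong (c₂ *_) (sym (^-distrib-* m m p))) (sym (conjugate f₂ (m * m)))) ⟩
      c₀ ^ p + (c₁ * m) ^ p + (c₂ * (m * m)) ^ p       ≡⟨ cong (_+ (c₂ * (m * m)) ^ p) (frobenius-+ c₀ (c₁ * m)) ⟨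
      (c₀ + c₁ * m) ^ p + (c₂ * (m * m)) ^ p           ≡⟨ frobenius-+ (c₀ + c₁ * m) (c₂ * (m * m)) ⟨
      (c₀ + c₁ * m + c₂ * (m * m)) ^ p                 ≡⟨ cong (_^ p) root ⟩
      0# ^ p                                           ≡⟨ fix1⇒^p (fix-0 1) ⟩
      0#                                               ∎
    sum-of-roots : c₂ * (m′ + m) + c₁ ≡ 0#
    sum-of-roots = x*y≡0⇒y≡0 (λ eq → m^p≢m (x-y≡0⇒x≡y eq)) (begin
      (m′ - m) * (c₂ * (m′ + m) + c₁)
        ≡⟨ solve 5 (λ a b c x y → (y :- x) :* (c :* (y :+ x) :+ b)
             := (a :+ b :* y :+ c :* (y :* y)) :- (a :+ b :* x :+ c :* (x :* x))) refl c₀ c₁ c₂ m m′ ⟩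
      (c₀ + c₁ * m′ + c₂ * (m′ * m′)) - (c₀ + c₁ * m + c₂ * (m * m))
        ≡⟨ x≡y⇒x-y≡0 (trans root′ (sym root)) ⟩
      0# ∎)
    sum-of-roots′ : c₂ * (m′ ^ p + m′) + c₁ ≡ 0#
    sum-of-roots′ = begin
      c₂ * (m′ ^ p + m′) + c₁
        ≡⟨ cong₂ _+_ (trans (cong (c₂ *_) (sym (frobenius-+ m′ m))) (sym (conjugate f₂ (m′ + m)))) (sym (fix1⇒^p f₁)) ⟩
      (c₂ * (m′ + m)) ^ p + c₁ ^ p     ≡⟨ frobenius-+ (c₂ * (m′ + m)) c₁ ⟨
      (c₂ * (m′ + m) + c₁) ^ p         ≡⟨ cong (_^ p) sum-of-roots ⟩
      0# ^ p                           ≡⟨ fix1⇒^p (fix-0 1) ⟩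
      0#                               ∎
    c₂[m″-m]≡0 : c₂ * (m′ ^ p - m) ≡ 0#
    c₂[m″-m]≡0 = begin
      c₂ * (m′ ^ p - m)
        ≡⟨ solve 5 (λ b c x y z → c :* (z :- x) := (c :* (z :+ y) :+ b) :- (c :* (y :+ x) :+ b)) refl c₁ c₂ m m′ (m′ ^ p) ⟩
      (c₂ * (m′ ^ p + m′) + c₁) - (c₂ * (m′ + m) + c₁)
        ≡⟨ x≡y⇒x-y≡0 (trans sum-of-roots′ (sym sum-of-roots)) ⟩
      0# ∎

  independent : ∀ c → (∀ i → Fix 1 (c i)) → lin c ≡ 0# → ∀ i → c i ≡ 0#
  independent c fc eq = λ { 0F → c₀≡0 ; 1F → c₁≡0 ; 2F → c₂≡0 }
    where
    c₂≡0 : c 2F ≡ 0#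
    c₂≡0 = quadratic-leading≡0 (fc 0F) (fc 1F) (fc 2F) eq
    c₁≡0 : c 1F ≡ 0#
    -- With c₂ = 0 the relation is linear; multiplied by m it becomes c₀m + c₁m² = 0, to which the
    -- quadratic case applies again.
    c₁≡0 = quadratic-leading≡0 (fix-0 1) (fc 0F) (fc 1F) (begin
      0# + c 0F * m + c 1F * (m * m)
        ≡⟨ solve 4 (λ a b c m → :0 :+ a :* m :+ b :* (m :* m)
             := m :* (a :+ b :* m :+ c :* (m :* m)) :- c :* (m :* (m :* m))) refl (c 0F) (c 1F) (c 2F) m ⟩
      m * lin c - c 2F * (m * (m * m))
        ≡⟨ cong₂ (λ x y → m * x - y * (m * (m * m))) eq c₂≡0 ⟩
      m * 0# - 0# * (m * (m * m))
        ≡⟨ solve 1 (λ m → m :* :0 :- :0 :* (m :* (m :* m)) := :0) refl m ⟩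
      0# ∎)
    c₀≡0 : c 0F ≡ 0#
    c₀≡0 = begin
      c 0F
        ≡⟨ solve 2 (λ a m → a := a :+ :0 :* m :+ :0 :* (m :* m)) refl (c 0F) m ⟩
      c 0F + 0# * m + 0# * (m * m)
        ≡⟨ cong₂ (λ x y → c 0F + x * m + y * (m * m)) c₁≡0 c₂≡0 ⟨
      lin c
        ≡⟨ eq ⟩
      0# ∎

  lin-minus : ∀ c d → lin (λ j → c j - d j) ≡ lin c - lin d
  lin-minus c d = solve 7 (λ a b c a′ b′ c′ m → (a :- a′) :+ (b :- b′) :* m :+ (c :- c′) :* (m :* m)
         := (a :+ b :* m :+ c :* (m :* m)) :- (a′ :+ b′ :* m :+ c′ :* (m :* m))) refl
         (c 0F) (c 1F) (c 2F) (d 0F) (d 1F) (d 2F) m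

  lin-injective : ∀ c d → (∀ i → Fix 1 (c i)) → (∀ i → Fix 1 (d i)) → lin c ≡ lin d → ∀ i → c i ≡ d i
  lin-injective c d fc fd eq i = x-y≡0⇒x≡y (independent (λ j → c j - d j) (λ j → fix-minus 1 (fc j) (fd j))
    (trans (lin-minus c d) (x≡y⇒x-y≡0 eq)) i)

  lin-cong : ∀ {c d} → (∀ i → c i ≡ d i) → lin c ≡ lin d
  lin-cong eq = cong₂ _+_ (cong₂ (λ x y → x + y * m) (eq 0F) (eq 1F)) (cong (_* (m * m)) (eq 2F))

  lin-scale : ∀ a c → lin (λ j → a * c j) ≡ a * lin c
  lin-scale a c = solve 5 (λ a b c s m → s :* a :+ (s :* b) :* m :+ (s :* c) :* (m :* m)
           := s :* (a :+ b :* m :+ c :* (m :* m))) refl (c 0F) (c 1F) (c 2F) a m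

  lin-fix : ∀ c → (∀ i → Fix 1 (c i)) → Fix 3 (lin c)
  lin-fix c fc = fix-+ 3 (fix-+ 3 (k⊆K (fc 0F)) (fix-* 3 (k⊆K (fc 1F)) m∈K))
                         (fix-* 3 (k⊆K (fc 2F)) (fix-* 3 m∈K m∈K))

  abstract
    -- Counting replaces a dimension argument: `lin` is injective on the p³ coefficient vectors over
    -- k, and K has p³ elements.
    coordinates : ∀ x → Fix 3 x → ∃ λ c → (∀ i → Fix 1 (c i)) × lin c ≡ x
    coordinates x fx =
      let i , eq = injective⇒surjective index index-injective ℕₚ.≤-refl (proj₁ (K.complete x fx))
      in vector i , vector-fix i ,
         trans (sym (element∘index-of K-enumeration (lin ∘ vector) (λ i → lin-fix _ (vector-fix i)) i))
               (trans (cong K.element eq) (proj₂ (K.complete x fx)))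
      where
      vector : Fin (p ℕ.^ 3) → Fin 3 → Fin q
      vector i j = k.element (finToFun {p} {3} i j)
      vector-fix : ∀ i j → Fix 1 (vector i j)
      vector-fix i j = k.sound (finToFun {p} {3} i j)
      index : Fin (p ℕ.^ 3) → Fin (p ℕ.^ 3)
      index = index-of K-enumeration (lin ∘ vector) (λ i → lin-fix _ (vector-fix i))
      index-injective : Injective _≡_ _≡_ index
      index-injective {i} {j} eq = finToFun-injective 3 (λ x → k.injective (lin-injective (vector i) (vector j)
        (vector-fix i) (vector-fix j)
        (trans (sym (element∘index-of K-enumeration (lin ∘ vector) (λ i → lin-fix _ (vector-fix i)) i))
          (trans (cong K.element eq)
            (element∘index-of K-enumeration (lin ∘ vector) (λ i → lin-fix _ (vector-fix i)) j))) x))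

  -- Coordinates refer to the basis 1, m, m². Permuting them yields bijective k-linear maps whose
  -- values on the basis are again basis elements, which makes the collision below computable.
  swap₁₂ swap₀₁ : (Fin 3 → Fin q) → Fin 3 → Fin q
  swap₁₂ c 0F = c 0F
  swap₁₂ c 1F = c 2F
  swap₁₂ c 2F = c 1F
  swap₀₁ c 0F = c 1F
  swap₀₁ c 1F = c 0F
  swap₀₁ c 2F = c 2F

  swap₁₂-all : ∀ {P : Fin q → Set} {c} → (∀ i → P (c i)) → ∀ i → P (swap₁₂ c i)
  swap₁₂-all Pc = λ { 0F → Pc 0F ; 1F → Pc 2F ; 2F → Pc 1F }

  swap₀₁-all : ∀ {P : Fin q → Set} {c} → (∀ i → P (c i)) → ∀ i → P (swap₀₁ c i)
  swap₀₁-all Pc = λ { 0F → Pc 1F ; 1F → Pc 0F ; 2F → Pc 2F }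

  f g : (Fin 3 → Fin q) → Fin q
  f c = lin (swap₁₂ c)
  g c = lin (swap₀₁ c)

  f-cong : ∀ {c d} → (∀ i → c i ≡ d i) → f c ≡ f d
  f-cong {c} {d} eq = lin-cong {swap₁₂ c} {swap₁₂ d} (λ { 0F → eq 0F ; 1F → eq 2F ; 2F → eq 1F })

  g-cong : ∀ {c d} → (∀ i → c i ≡ d i) → g c ≡ g d
  g-cong {c} {d} eq = lin-cong {swap₀₁ c} {swap₀₁ d} (λ { 0F → eq 1F ; 1F → eq 0F ; 2F → eq 2F })

  f-scale : ∀ a c → f (λ j → a * c j) ≡ a * f c
  f-scale a c = trans (lin-cong {swap₁₂ (λ j → a * c j)} {λ j → a * swap₁₂ c j} (λ { 0F → refl ; 1F → refl ; 2F → refl })) (lin-scale a (swap₁₂ c))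

  g-scale : ∀ a c → g (λ j → a * c j) ≡ a * g c
  g-scale a c = trans (lin-cong {swap₀₁ (λ j → a * c j)} {λ j → a * swap₀₁ c j} (λ { 0F → refl ; 1F → refl ; 2F → refl })) (lin-scale a (swap₀₁ c))

  f≡0⇒lin≡0 : ∀ c → (∀ i → Fix 1 (c i)) → f c ≡ 0# → lin c ≡ 0#
  f≡0⇒lin≡0 c fc eq = trans (lin-cong {c} {λ _ → 0#} (λ { 0F → z 0F ; 1F → z 2F ; 2F → z 1F }))
    (solve 1 (λ m → :0 :+ :0 :* m :+ :0 :* (m :* m) := :0) refl m)
    where
    z : ∀ i → swap₁₂ c i ≡ 0#
    z = independent (swap₁₂ c) (swap₁₂-all {Fix 1} {c} fc) eq

  abstract
    -- Elements outside K receive zero coordinates, so that `coordinate` and `value` are total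
    -- functions on the field.
    coordinate-spec : ∀ x → Dec (Fix 3 x) →
      ∃ λ c → (∀ i → Fix 1 (c i)) × (Fix 3 x → lin c ≡ x)
    coordinate-spec x (yes fx) = let c , fc , eq = coordinates x fx in c , fc , λ _ → eq
    coordinate-spec x (no ¬fx) = (λ _ → 0#) , (λ _ → fix-0 1) , λ fx → contradiction fx ¬fx

  coordinate : Fin q → Fin 3 → Fin q
  coordinate x = proj₁ (coordinate-spec x (fix? 3 x))

  coordinate-fix : ∀ x i → Fix 1 (coordinate x i)
  coordinate-fix x = proj₁ (proj₂ (coordinate-spec x (fix? 3 x)))

  lin-coordinate : ∀ x → Fix 3 x → lin (coordinate x) ≡ x
  lin-coordinate x = proj₂ (proj₂ (coordinate-spec x (fix? 3 x)))

  coordinate-lin : ∀ c → (∀ i → Fix 1 (c i)) → ∀ i → coordinate (lin c) i ≡ c i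
  coordinate-lin c fc = lin-injective (coordinate (lin c)) c (coordinate-fix (lin c)) fc (lin-coordinate (lin c) (lin-fix c fc))

  value : Fin q → Fin q
  value x = f (coordinate x) * g (coordinate (x * f (coordinate x) ⁻¹))

  value-fix : ∀ x → Fix 3 (value x)
  value-fix x = fix-* 3 (lin-fix _ (swap₁₂-all {Fix 1} {coordinate x} (coordinate-fix x)))
                        (lin-fix _ (swap₀₁-all {Fix 1} {coordinate y} (coordinate-fix y)))
    where
    y : Fin q
    y = x * f (coordinate x) ⁻¹

  -- Here `d` holds the coordinates of x / f(x) for x = `lin c`; the quotient is expressed by a
  -- multiplicative equation, the form in which it arises from proportional points.
  value-lin : ∀ c d → (∀ i → Fix 1 (c i)) → (∀ i → Fix 1 (d i)) →
    lin c ≢ 0# → lin d * f c ≡ lin c → value (lin c) ≡ f c * g d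
  value-lin c d fc fd c≢0 eq = cong₂ _*_ f≡ (g-cong {coordinate (lin c * f (coordinate (lin c)) ⁻¹)} {d} (λ i → trans (cong (λ y → coordinate y i) ratio) (coordinate-lin d fd i)))
    where
    f≡ : f (coordinate (lin c)) ≡ f c
    f≡ = f-cong {coordinate (lin c)} {c} (coordinate-lin c fc)
    ratio : lin c * f (coordinate (lin c)) ⁻¹ ≡ lin d
    ratio = begin
      lin c * f (coordinate (lin c)) ⁻¹   ≡⟨ cong₂ (λ x y → x * y ⁻¹) (sym eq) f≡ ⟩
      lin d * f c * f c ⁻¹                ≡⟨ *-assoc _ _ _ ⟩
      lin d * (f c * f c ⁻¹)              ≡⟨ cong (lin d *_) (⁻¹-inverse (f c) (c≢0 ∘ f≡0⇒lin≡0 c fc)) ⟩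
      lin d * 1#                          ≡⟨ *-identityʳ _ ⟩
      lin d                               ∎

  triple : Fin q → Fin q → Fin q → Fin 3 → Fin q
  triple a b c 0F = a
  triple a b c 1F = b
  triple a b c 2F = c

  fix-triple : ∀ {a b c} → Fix 1 a → Fix 1 b → Fix 1 c → ∀ j → Fix 1 (triple a b c j)
  fix-triple fa fb fc = λ { 0F → fa ; 1F → fb ; 2F → fc }

  lin-0 : lin (triple 0# 0# 0#) ≡ 0#
  lin-0 = solve 1 (λ m → :0 :+ :0 :* m :+ :0 :* (m :* m) := :0) refl m

  -- The factor f(0) vanishes, whatever the default value of `0# ⁻¹` is. A value missed on K is
  -- therefore nonzero and can be inverted to give γ.
  value-0 : value 0# ≡ 0#
  value-0 = trans (cong (_* g (coordinate (0# * f c ⁻¹))) f≡0) (zeroˡ (g (coordinate (0# * f c ⁻¹))))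
    where
    c zeros : Fin 3 → Fin q
    c = coordinate 0#
    zeros = triple 0# 0# 0#
    c≡0 : ∀ i → c i ≡ zeros i
    c≡0 = lin-injective c zeros (coordinate-fix 0#) (fix-triple (fix-0 1) (fix-0 1) (fix-0 1))
      (trans (lin-coordinate 0# (fix-0 3)) (sym lin-0))
    f≡0 : f c ≡ 0#
    f≡0 = trans (f-cong {c} {zeros} c≡0) lin-0

  e₀ e₁ e₂ : Fin 3 → Fin q
  e₀ = triple 1# 0# 0#
  e₁ = triple 0# 1# 0#
  e₂ = triple 0# 0# 1#

  e₀-fix : ∀ j → Fix 1 (e₀ j)
  e₀-fix = fix-triple (fix-1 1) (fix-0 1) (fix-0 1)
  e₁-fix : ∀ j → Fix 1 (e₁ j)
  e₁-fix = fix-triple (fix-0 1) (fix-1 1) (fix-0 1)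
  e₂-fix : ∀ j → Fix 1 (e₂ j)
  e₂-fix = fix-triple (fix-0 1) (fix-0 1) (fix-1 1)

  lin-e₀ : lin e₀ ≡ 1#
  lin-e₀ = solve 1 (λ m → :1 :+ :0 :* m :+ :0 :* (m :* m) := :1) refl m
  lin-e₁ : lin e₁ ≡ m
  lin-e₁ = solve 1 (λ m → :0 :+ :1 :* m :+ :0 :* (m :* m) := m) refl m
  lin-e₂ : lin e₂ ≡ m * m
  lin-e₂ = solve 1 (λ m → :0 :+ :0 :* m :+ :1 :* (m :* m) := m :* m) refl m

  m≢0 : m ≢ 0#
  m≢0 eq = m^p≢m (trans (cong (_^ p) eq) (trans (fix1⇒^p (fix-0 1)) (sym eq)))

  f-e₀ : f e₀ ≡ 1#
  f-e₀ = lin-e₀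
  f-e₂ : f e₂ ≡ m
  f-e₂ = lin-e₁
  g-e₀ : g e₀ ≡ m
  g-e₀ = lin-e₁
  g-e₁ : g e₁ ≡ 1#
  g-e₁ = lin-e₀

  value-1 : value 1# ≡ m
  value-1 = begin
    value 1#         ≡⟨ cong value lin-e₀ ⟨
    value (lin e₀)   ≡⟨ value-lin e₀ e₀ e₀-fix e₀-fix (λ eq → 1≢0 (trans (sym lin-e₀) eq))
                          (trans (cong (lin e₀ *_) f-e₀) (*-identityʳ (lin e₀))) ⟩
    f e₀ * g e₀      ≡⟨ cong₂ _*_ f-e₀ g-e₀ ⟩
    1# * m           ≡⟨ *-identityˡ m ⟩
    m                ∎

  value-m² : value (m * m) ≡ m
  value-m² = begin
    value (m * m)    ≡⟨ cong value lin-e₂ ⟨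
    value (lin e₂)   ≡⟨ value-lin e₂ e₁ e₂-fix e₁-fix (λ eq → *-≢0 m≢0 m≢0 (trans (sym lin-e₂) eq))
                          (trans (cong₂ _*_ lin-e₁ f-e₂) (sym lin-e₂)) ⟩
    f e₂ * g e₁      ≡⟨ cong₂ _*_ f-e₂ g-e₁ ⟩
    m * 1#           ≡⟨ *-identityʳ m ⟩
    m                ∎

  -- On K the map value sends x to f(x) g(x / f(x)); it takes the value m at both 1 and m²,
  -- so it misses some κ.
  missed-value : ∃ λ κ → Fix 3 κ × κ ≢ 0# × (∀ c d → (∀ i → Fix 1 (c i)) → (∀ i → Fix 1 (d i)) →
    lin c ≢ 0# → lin d * f c ≡ lin c → f c * g d ≢ κ)
  missed-value = K.element i₀ , K.sound i₀ , (λ eq → missed 0# (fix-0 3) (trans value-0 (sym eq))) ,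
    λ c d fc fd c≢0 eq hit → missed (lin c) (lin-fix c fc) (trans (value-lin c d fc fd c≢0 eq) hit)
    where
    values : ∀ i → Fix 3 (value (K.element i))
    values i = value-fix (K.element i)
    Φ : Fin (p ℕ.^ 3) → Fin (p ℕ.^ 3)
    Φ = index-of K-enumeration (value ∘ K.element) values
    Φ-at : ∀ x (fx : Fix 3 x) → K.element (Φ (proj₁ (K.complete x fx))) ≡ value x
    Φ-at x fx = trans (element∘index-of K-enumeration (value ∘ K.element) values _) (cong value (proj₂ (K.complete x fx)))
    i₁ i₂ : Fin (p ℕ.^ 3)
    i₁ = proj₁ (K.complete 1# (fix-1 3))
    i₂ = proj₁ (K.complete (m * m) (fix-* 3 m∈K m∈K))
    i₁≢i₂ : i₁ ≢ i₂
    -- The elements 1 and m² are distinct because their coordinate vectors differ in the first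
    -- entry.
    i₁≢i₂ eq = 1≢0 (lin-injective e₀ e₂ e₀-fix e₂-fix (begin
      lin e₀        ≡⟨ lin-e₀ ⟩
      1#            ≡⟨ proj₂ (K.complete 1# (fix-1 3)) ⟨
      K.element i₁  ≡⟨ cong K.element eq ⟩
      K.element i₂  ≡⟨ proj₂ (K.complete (m * m) (fix-* 3 m∈K m∈K)) ⟩
      m * m         ≡⟨ lin-e₂ ⟨
      lin e₂        ∎) 0F)
    non-surjective : ∃ λ y → ∀ x → Φ x ≢ y
    non-surjective = notInjective⇒notSurjective Φ i₁≢i₂
      (K.injective (trans (Φ-at 1# (fix-1 3)) (trans value-1 (sym (trans (Φ-at (m * m) (fix-* 3 m∈K m∈K)) value-m²)))))
    i₀ : Fin (p ℕ.^ 3)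
    i₀ = proj₁ non-surjective
    missed : ∀ x → Fix 3 x → value x ≢ K.element i₀
    missed x fx eq = proj₂ non-surjective _ (K.injective (trans (Φ-at x fx) eq))

-- Projective planes

module PlaneVectors {q : ℕ} (F : FinField q) where
  open FieldProperties F
  open ≡-Reasoning

  NonZeroVector : ∀ {d} → (Fin d → Fin q) → Set
  NonZeroVector v = ∃ λ i → v i ≢ 0#

  nonZero? : ∀ {d} (v : Fin d → Fin q) → NonZeroVector v ⊎ (∀ i → v i ≡ 0#)
  nonZero? {d} v with Finₚ.all? (λ i → v i ≟ 0#)
  ... | yes v≡0 = inj₂ v≡0
  ... | no ¬v≡0 = inj₁ (Finₚ.¬∀⟶∃¬ d _ (λ i → v i ≟ 0#) ¬v≡0)

  V₃ : Set
  V₃ = Fin 3 → Fin q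

  dot : V₃ → V₃ → Fin q
  dot u v = u 0F * v 0F + u 1F * v 1F + u 2F * v 2F

  cross : V₃ → V₃ → V₃
  cross u v 0F = u 1F * v 2F - u 2F * v 1F
  cross u v 1F = u 2F * v 0F - u 0F * v 2F
  cross u v 2F = u 0F * v 1F - u 1F * v 0F

  dot-minus : ∀ u v s → dot u s ≡ dot v s → dot (λ i → u i - v i) s ≡ 0#
  dot-minus u v s eq = trans
    (solve 9 (λ a b c a′ b′ c′ x y z → (a :- a′) :* x :+ (b :- b′) :* y :+ (c :- c′) :* z
        := (a :* x :+ b :* y :+ c :* z) :- (a′ :* x :+ b′ :* y :+ c′ :* z)) refl
      (u 0F) (u 1F) (u 2F) (v 0F) (v 1F) (v 2F) (s 0F) (s 1F) (s 2F))
    (x≡y⇒x-y≡0 eq)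

  dot-cross-left : ∀ u v → dot (cross u v) u ≡ 0#
  dot-cross-left u v = solve 6 (λ a b c x y z →
      (b :* z :- c :* y) :* a :+ (c :* x :- a :* z) :* b :+ (a :* y :- b :* x) :* c := :0) refl
    (u 0F) (u 1F) (u 2F) (v 0F) (v 1F) (v 2F)

  dot-cross-right : ∀ u v → dot (cross u v) v ≡ 0#
  dot-cross-right u v = solve 6 (λ a b c x y z →
      (b :* z :- c :* y) :* x :+ (c :* x :- a :* z) :* y :+ (a :* y :- b :* x) :* z := :0) refl
    (u 0F) (u 1F) (u 2F) (v 0F) (v 1F) (v 2F)

  cross-parallel : ∀ {u v} b → (∀ j → u j ≡ b * v j) → ∀ j → cross u v j ≡ 0#
  cross-parallel {u} {v} b eq = λ { 0F → minor 1F 2F ; 1F → minor 2F 0F ; 2F → minor 0F 1F }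
    where
    minor : ∀ i j → u i * v j - u j * v i ≡ 0#
    minor i j = begin
      u i * v j - u j * v i              ≡⟨ cong₂ (λ x y → x * v j - y * v i) (eq i) (eq j) ⟩
      b * v i * v j - b * v j * v i      ≡⟨ solve 3 (λ b x y → b :* x :* y :- b :* y :* x := :0) refl b (v i) (v j) ⟩
      0#                                 ∎

  cross-swap : ∀ u v → NonZeroVector (cross u v) → NonZeroVector (cross v u)
  cross-swap u v (i , ≢0) = i , λ eq → ≢0 (trans (anti i) (trans (cong -_ eq) (solve 0 (:- :0 := :0) refl)))
    where
    swapped : ∀ a b c d → a * b - c * d ≡ - (d * c - b * a)
    swapped = solve 4 (λ a b c d → a :* b :- c :* d := :- (d :* c :- b :* a)) refl
    anti : ∀ i → cross u v i ≡ - cross v u i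
    anti 0F = swapped _ _ _ _
    anti 1F = swapped _ _ _ _
    anti 2F = swapped _ _ _ _

  cross-nonZeroʳ : ∀ u v → NonZeroVector (cross u v) → NonZeroVector v
  cross-nonZeroʳ u v (i , ≢0) with nonZero? v
  ... | inj₁ v≢0 = v≢0
  ... | inj₂ v≡0 = contradiction (zeros i) ≢0
    where
    minor : ∀ i j → u i * v j - u j * v i ≡ 0#
    minor i j = begin
      u i * v j - u j * v i   ≡⟨ cong₂ (λ x y → u i * x - u j * y) (v≡0 j) (v≡0 i) ⟩
      u i * 0# - u j * 0#     ≡⟨ solve 2 (λ a b → a :* :0 :- b :* :0 := :0) refl (u i) (u j) ⟩
      0#                      ∎
    zeros : ∀ i → cross u v i ≡ 0#
    zeros = λ { 0F → minor 1F 2F ; 1F → minor 2F 0F ; 2F → minor 0F 1F }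

  -- Cramer's rule for the linear system with rows u, w, s and unknown l: the determinant times l is
  -- a combination of the three right-hand sides, all of which are 0.
  determinant-annihilated : ∀ l u w s → dot l u ≡ 0# → dot l w ≡ 0# → dot l s ≡ 0# →
    ∀ k → l k * dot (cross u w) s ≡ 0#
  determinant-annihilated l u w s lu lw ls k = trans (expand k) (begin
    dot l u * cross w s k + dot l w * cross s u k + dot l s * cross u w k
      ≡⟨ cong₂ _+_ (cong₂ (λ x y → x * cross w s k + y * cross s u k) lu lw) (cong (_* cross u w k) ls) ⟩
    0# * cross w s k + 0# * cross s u k + 0# * cross u w k
      ≡⟨ solve 3 (λ a b c → :0 :* a :+ :0 :* b :+ :0 :* c := :0) refl (cross w s k) (cross s u k) (cross u w k) ⟩
    0# ∎)
    where
    expand : ∀ k → l k * dot (cross u w) s ≡ dot l u * cross w s k + dot l w * cross s u k + dot l s * cross u w k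
    expand 0F = solve 12 (λ l0 l1 l2 u0 u1 u2 w0 w1 w2 s0 s1 s2 →
      l0 :* ((u1 :* w2 :- u2 :* w1) :* s0 :+ (u2 :* w0 :- u0 :* w2) :* s1 :+ (u0 :* w1 :- u1 :* w0) :* s2)
      := (l0 :* u0 :+ l1 :* u1 :+ l2 :* u2) :* (w1 :* s2 :- w2 :* s1)
         :+ (l0 :* w0 :+ l1 :* w1 :+ l2 :* w2) :* (s1 :* u2 :- s2 :* u1)
         :+ (l0 :* s0 :+ l1 :* s1 :+ l2 :* s2) :* (u1 :* w2 :- u2 :* w1)) refl
      (l 0F) (l 1F) (l 2F) (u 0F) (u 1F) (u 2F) (w 0F) (w 1F) (w 2F) (s 0F) (s 1F) (s 2F)
    expand 1F = solve 12 (λ l0 l1 l2 u0 u1 u2 w0 w1 w2 s0 s1 s2 →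
      l1 :* ((u1 :* w2 :- u2 :* w1) :* s0 :+ (u2 :* w0 :- u0 :* w2) :* s1 :+ (u0 :* w1 :- u1 :* w0) :* s2)
      := (l0 :* u0 :+ l1 :* u1 :+ l2 :* u2) :* (w2 :* s0 :- w0 :* s2)
         :+ (l0 :* w0 :+ l1 :* w1 :+ l2 :* w2) :* (s2 :* u0 :- s0 :* u2)
         :+ (l0 :* s0 :+ l1 :* s1 :+ l2 :* s2) :* (u2 :* w0 :- u0 :* w2)) refl
      (l 0F) (l 1F) (l 2F) (u 0F) (u 1F) (u 2F) (w 0F) (w 1F) (w 2F) (s 0F) (s 1F) (s 2F)
    expand 2F = solve 12 (λ l0 l1 l2 u0 u1 u2 w0 w1 w2 s0 s1 s2 →
      l2 :* ((u1 :* w2 :- u2 :* w1) :* s0 :+ (u2 :* w0 :- u0 :* w2) :* s1 :+ (u0 :* w1 :- u1 :* w0) :* s2)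
      := (l0 :* u0 :+ l1 :* u1 :+ l2 :* u2) :* (w0 :* s1 :- w1 :* s0)
         :+ (l0 :* w0 :+ l1 :* w1 :+ l2 :* w2) :* (s0 :* u1 :- s1 :* u0)
         :+ (l0 :* s0 :+ l1 :* s1 :+ l2 :* s2) :* (u0 :* w1 :- u1 :* w0)) refl
      (l 0F) (l 1F) (l 2F) (u 0F) (u 1F) (u 2F) (w 0F) (w 1F) (w 2F) (s 0F) (s 1F) (s 2F)

  -- The linear relation between four vectors of a three-dimensional space, with determinants as
  -- coefficients.
  cramer : ∀ u w s e j → dot (cross u w) e * s j ≡
    dot (cross s w) e * u j + dot (cross u s) e * w j + dot (cross u w) s * e j
  cramer u w s e = λ
    { 0F → solve 12 (λ u0 u1 u2 w0 w1 w2 s0 s1 s2 e0 e1 e2 →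
        det u0 u1 u2 w0 w1 w2 e0 e1 e2 :* s0 := det s0 s1 s2 w0 w1 w2 e0 e1 e2 :* u0
          :+ det u0 u1 u2 s0 s1 s2 e0 e1 e2 :* w0 :+ det u0 u1 u2 w0 w1 w2 s0 s1 s2 :* e0) refl
        (u 0F) (u 1F) (u 2F) (w 0F) (w 1F) (w 2F) (s 0F) (s 1F) (s 2F) (e 0F) (e 1F) (e 2F)
    ; 1F → solve 12 (λ u0 u1 u2 w0 w1 w2 s0 s1 s2 e0 e1 e2 →
        det u0 u1 u2 w0 w1 w2 e0 e1 e2 :* s1 := det s0 s1 s2 w0 w1 w2 e0 e1 e2 :* u1
          :+ det u0 u1 u2 s0 s1 s2 e0 e1 e2 :* w1 :+ det u0 u1 u2 w0 w1 w2 s0 s1 s2 :* e1) refl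
        (u 0F) (u 1F) (u 2F) (w 0F) (w 1F) (w 2F) (s 0F) (s 1F) (s 2F) (e 0F) (e 1F) (e 2F)
    ; 2F → solve 12 (λ u0 u1 u2 w0 w1 w2 s0 s1 s2 e0 e1 e2 →
        det u0 u1 u2 w0 w1 w2 e0 e1 e2 :* s2 := det s0 s1 s2 w0 w1 w2 e0 e1 e2 :* u2
          :+ det u0 u1 u2 s0 s1 s2 e0 e1 e2 :* w2 :+ det u0 u1 u2 w0 w1 w2 s0 s1 s2 :* e2) refl
        (u 0F) (u 1F) (u 2F) (w 0F) (w 1F) (w 2F) (s 0F) (s 1F) (s 2F) (e 0F) (e 1F) (e 2F) }
    where
    det : ∀ {n} (u0 u1 u2 w0 w1 w2 s0 s1 s2 : Polynomial n) → Polynomial n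
    det u0 u1 u2 w0 w1 w2 s0 s1 s2 =
      (u1 :* w2 :- u2 :* w1) :* s0 :+ (u2 :* w0 :- u0 :* w2) :* s1 :+ (u0 :* w1 :- u1 :* w0) :* s2

  unit : Fin 3 → V₃
  unit 0F 0F = 1#
  unit 1F 1F = 1#
  unit 2F 2F = 1#
  unit _  _  = 0#

  dot-unit : ∀ n k → dot n (unit k) ≡ n k
  dot-unit n 0F = solve 3 (λ a b c → a :* :1 :+ b :* :0 :+ c :* :0 := a) refl (n 0F) (n 1F) (n 2F)
  dot-unit n 1F = solve 3 (λ a b c → a :* :0 :+ b :* :1 :+ c :* :0 := b) refl (n 0F) (n 1F) (n 2F)
  dot-unit n 2F = solve 3 (λ a b c → a :* :0 :+ b :* :0 :+ c :* :1 := c) refl (n 0F) (n 1F) (n 2F)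

  abstract
    -- A unit vector at a nonzero entry of `cross u w` completes u, w to a basis. In `cramer` its
    -- term drops out, since the common orthogonal vector `l` forces det(u, w, s) = 0.
    collinear⇒span : ∀ {l u w s} → NonZeroVector (cross u w) → NonZeroVector l →
      dot l u ≡ 0# → dot l w ≡ 0# → dot l s ≡ 0# → ∃₂ λ a b → ∀ j → s j ≡ a * u j + b * w j
    collinear⇒span {l} {u} {w} {s} (k , n≢0) (i , l≢0) lu lw ls = N ⁻¹ * a , N ⁻¹ * b , λ j →
      *-cancelˡ-≢0 N N≢0 (begin
        N * s j
          ≡⟨ cramer u w s (unit k) j ⟩
        a * u j + b * w j + dot (cross u w) s * unit k j
          ≡⟨ cong (λ z → a * u j + b * w j + z * unit k j) (x*y≡0⇒y≡0 l≢0 (determinant-annihilated l u w s lu lw ls i)) ⟩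
        a * u j + b * w j + 0# * unit k j
          ≡⟨ solve 3 (λ x y z → x :+ y :+ :0 :* z := :1 :* (x :+ y)) refl (a * u j) (b * w j) (unit k j) ⟩
        1# * (a * u j + b * w j)
          ≡⟨ cong (_* (a * u j + b * w j)) (⁻¹-inverse N N≢0) ⟨
        N * N ⁻¹ * (a * u j + b * w j)
          ≡⟨ solve 6 (λ N M a b x y → N :* M :* (a :* x :+ b :* y) := N :* (M :* a :* x :+ M :* b :* y)) refl
               N (N ⁻¹) a b (u j) (w j) ⟩
        N * (N ⁻¹ * a * u j + N ⁻¹ * b * w j) ∎)
      where
      N a b : Fin q
      N = dot (cross u w) (unit k)
      a = dot (cross s w) (unit k)
      b = dot (cross u s) (unit k)
      N≢0 : N ≢ 0#
      N≢0 eq = n≢0 (trans (sym (dot-unit (cross u w) k)) eq)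

  abstract
    -- Pigeonhole: a map from n^d vectors to N < n^d values takes some value twice, and the
    -- difference of two such vectors lies in the kernel. It serves once for k⁴ → K and once for K³
    -- → F.
    kernel-vector : ∀ {P Q : Fin q → Set} {n N} → Enumeration P n → Enumeration Q N →
      (∀ {x y} → P x → P y → P (x - y)) → ∀ d → N ℕ.< n ℕ.^ d → (h : (Fin d → Fin q) → Fin q) →
      (∀ v → (∀ i → P (v i)) → Q (h v)) → (∀ u v → h u ≡ h v → h (λ i → u i - v i) ≡ 0#) →
      ∃ λ v → (∀ i → P (v i)) × NonZeroVector v × h v ≡ 0#
    kernel-vector {P} {Q} {n} EP EQ closed d N<n^d h h-Q h-minus =
      let x , x≢ = Finₚ.¬∀⟶∃¬ d _ (λ x → finToFun {n} {d} s x Finₚ.≟ finToFun t x)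
                     (λ eq → Finₚ.<⇒≢ s<t (finToFun-injective d eq))
      in (λ i → vector s i - vector t i) , (λ i → closed (vector-P s i) (vector-P t i)) ,
         (x , λ eq → x≢ (EP.injective (x-y≡0⇒x≡y eq))) ,
         h-minus (vector s) (vector t) (trans (sym (at s)) (trans (cong EQ.element collision) (at t)))
      where
      module EP = Enumeration EP
      module EQ = Enumeration EQ
      vector : Fin (n ℕ.^ d) → Fin d → Fin q
      vector t i = EP.element (finToFun t i)
      vector-P : ∀ t i → P (vector t i)
      vector-P t i = EP.sound (finToFun t i)
      vector-Q : ∀ t → Q (h (vector t))
      vector-Q t = h-Q (vector t) (vector-P t)
      at : ∀ t → EQ.element (index-of EQ (h ∘ vector) vector-Q t) ≡ h (vector t)
      at = element∘index-of EQ (h ∘ vector) vector-Q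
      repetition : ∃₂ λ s t → s Fin.< t × index-of EQ (h ∘ vector) vector-Q s ≡ index-of EQ (h ∘ vector) vector-Q t
      repetition = Finₚ.pigeonhole N<n^d (index-of EQ (h ∘ vector) vector-Q)
      s t : Fin (n ℕ.^ d)
      s = proj₁ repetition
      t = proj₁ (proj₂ repetition)
      s<t : s Fin.< t
      s<t = proj₁ (proj₂ (proj₂ repetition))
      collision : index-of EQ (h ∘ vector) vector-Q s ≡ index-of EQ (h ∘ vector) vector-Q t
      collision = proj₂ (proj₂ (proj₂ repetition))

module DoubleBlockingSet {q : ℕ} (F : FinField q) {p : ℕ} (pp : Prime p) (q≡p^6 : q ≡ p ℕ.^ 6) where
  open SubfieldTower F pp q≡p^6
  open PlaneVectors F
  open ≡-Reasoning

  private instance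
    p≢0 = prime⇒nonZero pp

  V₄ : Set
  V₄ = Fin 4 → Fin q

  Over : ∀ {d} → ℕ → (Fin d → Fin q) → Set
  Over e v = ∀ i → Fix e (v i)

  -- A k-linear map k⁴ → K³; its image is a linear set of rank 4, hence meets every line of PG(2, p³).
  record LinearSet : Set where
    field
      point       : V₄ → V₃
      point-K     : ∀ c → Over 1 c → Over 3 (point c)
      point-minus : ∀ c d i → point (λ j → c j - d j) i ≡ point c i - point d i
      point-scale : ∀ a c i → point (λ j → a * c j) i ≡ a * point c i
      point-cong  : ∀ {c d} → (∀ i → c i ≡ d i) → ∀ i → point c i ≡ point d i
      partner     : ∀ u → NonZeroVector u → ∃ λ c → Over 1 c × NonZeroVector (cross u (point c))

    point-zero : ∀ c → (∀ i → c i ≡ 0#) → ∀ i → point c i ≡ 0#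
    point-zero c c≡0 i = begin
      point c i                  ≡⟨ point-cong (λ j → trans (c≡0 j) (sym (zeroˡ (c j)))) i ⟩
      point (λ j → 0# * c j) i   ≡⟨ point-scale 0# c i ⟩
      0# * point c i             ≡⟨ zeroˡ _ ⟩
      0#                         ∎

  open LinearSet

  abstract
    blocks : ∀ X l → Over 3 l → ∃ λ c → Over 1 c × NonZeroVector c × dot l (point X c) ≡ 0#
    blocks X l l∈K = kernel-vector {Fix 1} {Fix 3} k-enumeration K-enumeration (fix-minus 1) 4
      -- k⁴ has p⁴ elements and the functional takes its values in K, which has p³.
      (ℕₚ.^-monoʳ-< p 1<p {x = 3} {y = 4} (s≤s (s≤s (s≤s (s≤s z≤n)))))
      (λ c → dot l (point X c))
      (λ c c∈k → fix-+ 3 (fix-+ 3 (term c c∈k 0F) (term c c∈k 1F)) (term c c∈k 2F))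
      (λ c d eq → begin
        dot l (point X (λ i → c i - d i))
          ≡⟨ cong₂ _+_ (cong₂ _+_ (cong (l 0F *_) (point-minus X c d 0F)) (cong (l 1F *_) (point-minus X c d 1F)))
                       (cong (l 2F *_) (point-minus X c d 2F)) ⟩
        l 0F * (point X c 0F - point X d 0F) + l 1F * (point X c 1F - point X d 1F) + l 2F * (point X c 2F - point X d 2F)
          ≡⟨ solve 9 (λ l m n a b c x y z → l :* (a :- x) :+ m :* (b :- y) :+ n :* (c :- z)
               := (l :* a :+ m :* b :+ n :* c) :- (l :* x :+ m :* y :+ n :* z)) refl
               (l 0F) (l 1F) (l 2F) (point X c 0F) (point X c 1F) (point X c 2F) (point X d 0F) (point X d 1F) (point X d 2F) ⟩
        dot l (point X c) - dot l (point X d)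
          ≡⟨ x≡y⇒x-y≡0 eq ⟩
        0# ∎)
      where
      term : ∀ c → Over 1 c → ∀ i → Fix 3 (l i * point X c i)
      term c c∈k i = fix-* 3 (l∈K i) (point-K X c c∈k i)

  Disjoint : LinearSet → LinearSet → Set
  Disjoint X Y = ∀ c d → Over 1 c → Over 1 d → NonZeroVector c → NonZeroVector d →
    NonZeroVector (cross (point X c) (point Y d))

  disjoint-sym : ∀ X Y → Disjoint X Y → Disjoint Y X
  disjoint-sym X Y X#Y d c d∈k c∈k d≢0 c≢0 = cross-swap (point X c) (point Y d) (X#Y c d c∈k d∈k c≢0 d≢0)

  cross-K : ∀ {u v} → Over 3 u → Over 3 v → Over 3 (cross u v)
  cross-K {u} {v} u∈K v∈K = λ { 0F → minor 1F 2F ; 1F → minor 2F 0F ; 2F → minor 0F 1F }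
    where
    minor : ∀ i j → Fix 3 (u i * v j - u j * v i)
    minor i j = fix-minus 3 (fix-* 3 (u∈K i) (v∈K j)) (fix-* 3 (u∈K j) (v∈K i))

  -- Every point of PG(2, p⁶) lies on a line with coordinates in K, because q^(3/2) > q.
  abstract
    line-through : ∀ s → ∃ λ l → Over 3 l × NonZeroVector l × dot l s ≡ 0#
    line-through s = kernel-vector {Fix 3} {λ _ → ⊤} K-enumeration everything (fix-minus 3) 3
      (subst₂ ℕ._<_ (sym q≡p^6) (sym (ℕₚ.^-*-assoc p 3 3)) (ℕₚ.^-monoʳ-< p 1<p {x = 6} {y = 9} (ℕₚ.m≤m+n 7 2)))
      (λ l → dot l s) (λ _ _ → tt) (λ u v → dot-minus u v s)
      where
      everything : Enumeration {q} (λ _ → ⊤) q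
      everything = record { element = λ x → x ; injective = λ eq → eq ; sound = λ _ → tt ; complete = λ x _ → x , refl }

  -- Both coefficients must be nonzero: when the codimension is raised, they are divided by in order
  -- to adjust the two new coordinates along the slopes of both columns.
  record Secant (X Y : LinearSet) (s : V₃) : Set where
    field
      {c d}    : V₄
      c∈k      : Over 1 c
      d∈k      : Over 1 d
      c≢0      : NonZeroVector c
      d≢0      : NonZeroVector d
      {a b}    : Fin q
      a≢0      : a ≢ 0#
      b≢0      : b ≢ 0#
      equation : ∀ j → s j ≡ a * point X c j + b * point Y d j

  -- A point of Y lies on a secant: join it to another point of Y; this line meets X, which misses Y.
  secant-at-point : ∀ X Y → Disjoint X Y → ∀ d → Over 1 d → NonZeroVector d → Secant X Y (point Y d)
  secant-at-point X Y X#Y d d∈k d≢0 = record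
    { c = c ; d = d′ ; a = a ; b = b ; c∈k = c∈k ; d∈k = d′∈k ; c≢0 = c≢0 ; d≢0 = d′≢0
    ; a≢0 = λ a≡0 → let i , ≢0 = ww′≢0 in
        ≢0 (cross-parallel {w} {w′} b (λ j → trans (equation j) (trans (cong (λ z → z * x j + b * w′ j) a≡0)
           (solve 2 (λ x y → :0 :* x :+ y := y) refl (x j) (b * w′ j)))) i)
    ; b≢0 = λ b≡0 → let i , ≢0 = disjoint-sym X Y X#Y d c d∈k c∈k d≢0 c≢0 in
        ≢0 (cross-parallel {w} {x} a (λ j → trans (equation j) (trans (cong (λ z → a * x j + z * w′ j) b≡0)
           (solve 2 (λ x y → x :+ :0 :* y := x) refl (a * x j) (w′ j)))) i)
    ; equation = equation }
    where
    w : V₃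
    w = point Y d
    w≢0 : NonZeroVector w
    -- Any line over K supplies a nonzero parameter of `X`, and disjointness from its point forces w
    -- ≠ 0.
    w≢0 with blocks X (unit 0F) (λ { 0F → fix-1 3 ; 1F → fix-0 3 ; 2F → fix-0 3 })
    ... | c , c∈k , c≢0 , _ = cross-nonZeroʳ (point X c) w (X#Y c d c∈k d∈k c≢0 d≢0)
    d′ : V₄
    d′ = proj₁ (partner Y w w≢0)
    d′∈k : Over 1 d′
    d′∈k = proj₁ (proj₂ (partner Y w w≢0))
    w′ : V₃
    w′ = point Y d′
    ww′≢0 : NonZeroVector (cross w w′)
    ww′≢0 = proj₂ (proj₂ (partner Y w w≢0))
    d′≢0 : NonZeroVector d′
    d′≢0 with nonZero? d′
    ... | inj₁ d′≢0 = d′≢0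
    ... | inj₂ d′≡0 = let i , w′≢0 = cross-nonZeroʳ w w′ ww′≢0 in contradiction (point-zero Y d′ d′≡0 i) w′≢0
    l : V₃
    l = cross w w′
    incident : ∃ λ c → Over 1 c × NonZeroVector c × dot l (point X c) ≡ 0#
    incident = blocks X l (cross-K (point-K Y d d∈k) (point-K Y d′ d′∈k))
    c : V₄
    c = proj₁ incident
    c∈k : Over 1 c
    c∈k = proj₁ (proj₂ incident)
    c≢0 : NonZeroVector c
    c≢0 = proj₁ (proj₂ (proj₂ incident))
    x : V₃
    x = point X c
    span : ∃₂ λ a b → ∀ j → w j ≡ a * x j + b * w′ j
    span = collinear⇒span (X#Y c d′ c∈k d′∈k c≢0 d′≢0) ww′≢0 (proj₂ (proj₂ (proj₂ incident)))
             (dot-cross-right w w′) (dot-cross-left w w′)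
    a b : Fin q
    a = proj₁ span
    b = proj₁ (proj₂ span)
    equation : ∀ j → w j ≡ a * x j + b * w′ j
    equation = proj₂ (proj₂ span)

  secant : ∀ X Y → Disjoint X Y → ∀ s → NonZeroVector s → Secant X Y s
  secant X Y X#Y s (i , sᵢ≢0)
    with line-through s
  ... | l , l∈K , l≢0 , ls with blocks X l l∈K | blocks Y l l∈K
  ... | c , c∈k , c≢0 , lx | d , d∈k , d≢0 , ly
    with collinear⇒span {l} {point X c} {point Y d} {s} (X#Y c d c∈k d∈k c≢0 d≢0) l≢0 lx ly ls
  ... | a , b , equation with a ≟ 0# | b ≟ 0#
  ... | no a≢0 | no b≢0 = record
    { c∈k = c∈k ; d∈k = d∈k ; c≢0 = c≢0 ; d≢0 = d≢0 ; a≢0 = a≢0 ; b≢0 = b≢0 ; equation = equation }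
  -- `s` is a multiple of a point of `X`. A secant through that point is found with the two sets
  -- exchanged, hence the exchanged components.
  ... | no a≢0 | yes b≡0 = record
    { c∈k = S.d∈k ; d∈k = S.c∈k ; c≢0 = S.d≢0 ; d≢0 = S.c≢0
    ; a≢0 = *-≢0 a≢0 S.b≢0 ; b≢0 = *-≢0 a≢0 S.a≢0
    ; equation = λ j → begin
        s j                                                              ≡⟨ equation j ⟩
        a * point X c j + b * point Y d j                                ≡⟨ cong₂ (λ x z → a * x + z * point Y d j) (S.equation j) b≡0 ⟩
        a * (S.a * point Y S.c j + S.b * point X S.d j) + 0# * point Y d j
          ≡⟨ solve 6 (λ a a′ b′ y x z → a :* (a′ :* y :+ b′ :* x) :+ :0 :* z := a :* b′ :* x :+ a :* a′ :* y) refl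
               a S.a S.b (point Y S.c j) (point X S.d j) (point Y d j) ⟩
        a * S.b * point X S.d j + a * S.a * point Y S.c j                ∎ }
    where module S = Secant (secant-at-point Y X (disjoint-sym X Y X#Y) c c∈k c≢0)
  ... | yes a≡0 | no b≢0 = record
    { c∈k = S.c∈k ; d∈k = S.d∈k ; c≢0 = S.c≢0 ; d≢0 = S.d≢0
    ; a≢0 = *-≢0 b≢0 S.a≢0 ; b≢0 = *-≢0 b≢0 S.b≢0
    ; equation = λ j → begin
        s j                                                              ≡⟨ equation j ⟩
        a * point X c j + b * point Y d j                                ≡⟨ cong₂ (λ z y → z * point X c j + b * y) a≡0 (S.equation j) ⟩
        0# * point X c j + b * (S.a * point X S.c j + S.b * point Y S.d j)
          ≡⟨ solve 6 (λ b a′ b′ x y z → :0 :* z :+ b :* (a′ :* x :+ b′ :* y) := b :* a′ :* x :+ b :* b′ :* y) refl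
               b S.a S.b (point X S.c j) (point Y S.d j) (point X c j) ⟩
        b * S.a * point X S.c j + b * S.b * point Y S.d j                ∎ }
    where module S = Secant (secant-at-point X Y X#Y d d∈k d≢0)
  ... | yes a≡0 | yes b≡0 = contradiction (begin
        s i                                     ≡⟨ equation i ⟩
        a * point X c i + b * point Y d i       ≡⟨ cong₂ (λ a b → a * point X c i + b * point Y d i) a≡0 b≡0 ⟩
        0# * point X c i + 0# * point Y d i     ≡⟨ solve 2 (λ x y → :0 :* x :+ :0 :* y := :0) refl (point X c i) (point Y d i) ⟩
        0#                                      ∎) sᵢ≢0

-- The code of codimension 3

projectiveSize : ℕ → ℕ → ℕ
projectiveSize p zero    = 0
projectiveSize p (suc d) = p ℕ.^ d ℕ.+ projectiveSize p d

module PlaneCode {q : ℕ} (F : FinField q) {p : ℕ} (pp : Prime p) (q≡p^6 : q ≡ p ℕ.^ 6) where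
  open SubfieldTower F pp q≡p^6
  open PlaneVectors F
  open DoubleBlockingSet F pp q≡p^6
  open ≡-Reasoning

  private instance
    p≢0 = prime⇒nonZero pp

  head₃ : V₄ → V₃
  head₃ c i = c (Fin.inject₁ i)

  f-minus : ∀ c d → f (λ j → c j - d j) ≡ f c - f d
  f-minus c d = trans (lin-cong {swap₁₂ (λ j → c j - d j)} {λ j → swap₁₂ c j - swap₁₂ d j}
    (λ { 0F → refl ; 1F → refl ; 2F → refl })) (lin-minus (swap₁₂ c) (swap₁₂ d))

  g-minus : ∀ c d → g (λ j → c j - d j) ≡ g c - g d
  g-minus c d = trans (lin-cong {swap₀₁ (λ j → c j - d j)} {λ j → swap₀₁ c j - swap₀₁ d j}
    (λ { 0F → refl ; 1F → refl ; 2F → refl })) (lin-minus (swap₀₁ c) (swap₀₁ d))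

  f-fix : ∀ c → Over 1 c → Fix 3 (f c)
  f-fix c c∈k = lin-fix (swap₁₂ c) (swap₁₂-all {Fix 1} {c} c∈k)

  g-fix : ∀ c → Over 1 c → Fix 3 (g c)
  g-fix c c∈k = lin-fix (swap₀₁ c) (swap₀₁-all {Fix 1} {c} c∈k)

  abstract
    κ : Fin q
    κ = proj₁ missed-value

    κ∈K : Fix 3 κ
    κ∈K = proj₁ (proj₂ missed-value)

    κ≢0 : κ ≢ 0#
    κ≢0 = proj₁ (proj₂ (proj₂ missed-value))

    κ-missed : ∀ c d → Over 1 c → Over 1 d → lin c ≢ 0# → lin d * f c ≡ lin c → f c * g d ≢ κ
    κ-missed = proj₂ (proj₂ (proj₂ missed-value))

  γ : Fin q
  γ = κ ⁻¹

  γ∈K : Fix 3 γ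
  γ∈K = fix-⁻¹ 3 κ≢0 κ∈K

  U-point W-point : V₄ → V₃
  U-point c 0F = lin (head₃ c)
  U-point c 1F = f (head₃ c)
  U-point c 2F = c 3F
  W-point d 0F = lin (head₃ d)
  W-point d 1F = d 3F
  W-point d 2F = γ * g (head₃ d)

  e₀⁴ e₃⁴ : V₄
  e₀⁴ 0F = 1#
  e₀⁴ _  = 0#
  e₃⁴ 3F = 1#
  e₃⁴ _  = 0#

  e₀⁴-fix : Over 1 e₀⁴
  e₀⁴-fix = λ { 0F → fix-1 1 ; 1F → fix-0 1 ; 2F → fix-0 1 ; 3F → fix-0 1 }
  e₃⁴-fix : Over 1 e₃⁴
  e₃⁴-fix = λ { 0F → fix-0 1 ; 1F → fix-0 1 ; 2F → fix-0 1 ; 3F → fix-1 1 }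

  neg≡0 : ∀ {x} → - x ≡ 0# → x ≡ 0#
  neg≡0 {x} eq = trans (solve 1 (λ x → x := :- (:- x)) refl x) (trans (cong -_ eq) (solve 0 (:- :0 := :0) refl))

  -- The set contains the points (0, 0, 1) and (1, 1, 0), with parameters `e₃⁴` and `e₀⁴`, and no
  -- nonzero vector is proportional to both. `W-partner` uses (0, 1, 0) and (1, 0, γm) in the same
  -- way.
  U-partner : ∀ u → NonZeroVector u → ∃ λ c → Over 1 c × NonZeroVector (cross u (U-point c))
  U-partner u (i , ≢0) with nonZero? (cross u (U-point e₃⁴))
  ... | inj₁ nz = e₃⁴ , e₃⁴-fix , nz
  ... | inj₂ z  = e₀⁴ , e₀⁴-fix , 0F , λ eq → ≢0 (u≡0 eq i)
    where
    u₁≡0 : u 1F ≡ 0#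
    u₁≡0 = trans (solve 3 (λ x y m → x := x :* :1 :- y :* (:0 :+ :0 :* m :+ :0 :* (m :* m))) refl (u 1F) (u 2F) m) (z 0F)
    u₀≡0 : u 0F ≡ 0#
    u₀≡0 = neg≡0 (trans (solve 3 (λ x y m → :- x := y :* (:0 :+ :0 :* m :+ :0 :* (m :* m)) :- x :* :1) refl (u 0F) (u 2F) m) (z 1F))
    u≡0 : cross u (U-point e₀⁴) 0F ≡ 0# → ∀ i → u i ≡ 0#
    u≡0 eq = λ { 0F → u₀≡0 ; 1F → u₁≡0 ; 2F → neg≡0 (trans
      (solve 3 (λ x y m → :- x := y :* :0 :- x :* (:1 :+ :0 :* m :+ :0 :* (m :* m))) refl (u 2F) (u 1F) m) eq) }

  W-partner : ∀ u → NonZeroVector u → ∃ λ c → Over 1 c × NonZeroVector (cross u (W-point c))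
  W-partner u (i , ≢0) with nonZero? (cross u (W-point e₃⁴))
  ... | inj₁ nz = e₃⁴ , e₃⁴-fix , nz
  ... | inj₂ z  = e₀⁴ , e₀⁴-fix , 2F , λ eq → ≢0 (u≡0 eq i)
    where
    u₂≡0 : u 2F ≡ 0#
    u₂≡0 = neg≡0 (trans (solve 4 (λ x y m g → :- x := y :* (g :* (:0 :+ :0 :* m :+ :0 :* (m :* m))) :- x :* :1)
      refl (u 2F) (u 1F) m γ) (z 0F))
    u₀≡0 : u 0F ≡ 0#
    u₀≡0 = trans (solve 3 (λ x y m → x := x :* :1 :- y :* (:0 :+ :0 :* m :+ :0 :* (m :* m))) refl (u 0F) (u 1F) m) (z 2F)
    u≡0 : cross u (W-point e₀⁴) 2F ≡ 0# → ∀ i → u i ≡ 0#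
    u≡0 eq = λ { 0F → u₀≡0 ; 2F → u₂≡0 ; 1F → neg≡0 (trans
      (solve 3 (λ x y m → :- x := y :* :0 :- x :* (:1 :+ :0 :* m :+ :0 :* (m :* m))) refl (u 1F) (u 0F) m) eq) }

  U W : LinearSet
  U = record
    { point       = U-point
    ; point-K     = λ c c∈k → λ { 0F → lin-fix (head₃ c) (c∈k ∘ Fin.inject₁) ; 1F → f-fix (head₃ c) (c∈k ∘ Fin.inject₁)
                                ; 2F → k⊆K (c∈k 3F) }
    ; point-minus = λ c d → λ { 0F → lin-minus (head₃ c) (head₃ d) ; 1F → f-minus (head₃ c) (head₃ d) ; 2F → refl }
    ; point-scale = λ a c → λ { 0F → lin-scale a (head₃ c) ; 1F → f-scale a (head₃ c) ; 2F → refl }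
    ; point-cong  = λ {c} {d} eq → λ { 0F → lin-cong {head₃ c} {head₃ d} (eq ∘ Fin.inject₁)
                                     ; 1F → f-cong {head₃ c} {head₃ d} (eq ∘ Fin.inject₁) ; 2F → eq 3F }
    ; partner     = U-partner }
  W = record
    { point       = W-point
    ; point-K     = λ c c∈k → λ { 0F → lin-fix (head₃ c) (c∈k ∘ Fin.inject₁) ; 1F → k⊆K (c∈k 3F)
                                ; 2F → fix-* 3 γ∈K (g-fix (head₃ c) (c∈k ∘ Fin.inject₁)) }
    ; point-minus = λ c d → λ { 0F → lin-minus (head₃ c) (head₃ d) ; 1F → refl
                              ; 2F → trans (cong (γ *_) (g-minus (head₃ c) (head₃ d)))
                                 (solve 3 (λ a x y → a :* (x :- y) := a :* x :- a :* y) refl γ (g (head₃ c)) (g (head₃ d))) }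
    ; point-scale = λ a c → λ { 0F → lin-scale a (head₃ c) ; 1F → refl
                              ; 2F → trans (cong (γ *_) (g-scale a (head₃ c)))
                                 (solve 3 (λ a x y → a :* (x :* y) := x :* (a :* y)) refl γ a (g (head₃ c))) }
    ; point-cong  = λ {c} {d} eq → λ { 0F → lin-cong {head₃ c} {head₃ d} (eq ∘ Fin.inject₁) ; 1F → eq 3F
                                     ; 2F → cong (γ *_) (g-cong {head₃ c} {head₃ d} (eq ∘ Fin.inject₁)) }
    ; partner     = W-partner }

  lin≡0⇒head≡0 : ∀ c → Over 1 c → lin (head₃ c) ≡ 0# → ∀ i → head₃ c i ≡ 0#
  lin≡0⇒head≡0 c c∈k = independent (head₃ c) (c∈k ∘ Fin.inject₁)

  all-zero : ∀ (c : V₄) → (∀ i → head₃ c i ≡ 0#) → c 3F ≡ 0# → ∀ i → c i ≡ 0#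
  all-zero c h t = λ { 0F → h 0F ; 1F → h 1F ; 2F → h 2F ; 3F → t }

  -- If (x, f x, a) and (y, b, γ g y) are proportional with f x, a, b nonzero, then rescaling
  -- x and y by a and b gives y = x / f x and γ f(x) g(y) = 1, that is f(x) g(x / f x) = κ.
  U#W : Disjoint U W
  U#W c d c∈k d∈k (i , cᵢ≢0) (j , dⱼ≢0) with nonZero? (cross (U-point c) (W-point d))
  ... | inj₁ nz   = nz
  ... | inj₂ cz   = contradiction (f[c″]g[d″]≡κ) (κ-missed c″ d″ c″∈k d″∈k x″≢0 y″f≡x″)
    where
    c′ d′ : V₃
    c′ = head₃ c
    d′ = head₃ d
    x y fx gy a b : Fin q
    x = lin c′
    y = lin d′
    fx = f c′
    gy = g d′
    a = c 3F
    b = d 3F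
    E₀ : fx * (γ * gy) ≡ a * b
    E₀ = x-y≡0⇒x≡y (cz 0F)
    E₁ : a * y ≡ x * (γ * gy)
    E₁ = x-y≡0⇒x≡y (cz 1F)
    E₂ : x * b ≡ fx * y
    E₂ = x-y≡0⇒x≡y (cz 2F)
    d≡0-if : y ≡ 0# → b ≡ 0# → ∀ {A : Set} → A
    d≡0-if y≡0 b≡0 = contradiction (all-zero d (lin≡0⇒head≡0 d d∈k y≡0) b≡0 j) dⱼ≢0
    x≢0 : x ≢ 0#
    x≢0 x≡0 = d≡0-if y≡0 b≡0
      where
      c′≡0 : ∀ i → c′ i ≡ 0#
      c′≡0 = lin≡0⇒head≡0 c c∈k x≡0
      a≢0 : a ≢ 0#
      a≢0 a≡0 = cᵢ≢0 (all-zero c c′≡0 a≡0 i)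
      fx≡0 : fx ≡ 0#
      fx≡0 = trans (f-cong {c′} {triple 0# 0# 0#} (λ { 0F → c′≡0 0F ; 1F → c′≡0 1F ; 2F → c′≡0 2F })) lin-0
      b≡0 : b ≡ 0#
      b≡0 = x*y≡0⇒y≡0 a≢0 (trans (sym E₀) (trans (cong (_* (γ * gy)) fx≡0) (zeroˡ _)))
      y≡0 : y ≡ 0#
      y≡0 = x*y≡0⇒y≡0 a≢0 (trans E₁ (trans (cong (_* (γ * gy)) x≡0) (zeroˡ _)))
    fx≢0 : fx ≢ 0#
    fx≢0 eq = x≢0 (f≡0⇒lin≡0 c′ (c∈k ∘ Fin.inject₁) eq)
    b≢0 : b ≢ 0#
    b≢0 b≡0 = d≡0-if (x*y≡0⇒y≡0 fx≢0 (trans (sym E₂) (trans (cong (x *_) b≡0) (zeroʳ x)))) b≡0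
    y≢0 : y ≢ 0#
    y≢0 y≡0 = *-≢0 x≢0 b≢0 (trans E₂ (trans (cong (fx *_) y≡0) (zeroʳ fx)))
    gy≢0 : gy ≢ 0#
    gy≢0 gy≡0 = d≡0-if′ (independent (swap₀₁ d′) (swap₀₁-all {Fix 1} {d′} (d∈k ∘ Fin.inject₁)) gy≡0)
      where
      d≡0-if′ : ¬ (∀ i → swap₀₁ d′ i ≡ 0#)
      d≡0-if′ z = y≢0 (trans (lin-cong {d′} {triple 0# 0# 0#} (λ { 0F → z 1F ; 1F → z 0F ; 2F → z 2F })) lin-0)
    a≢0 : a ≢ 0#
    a≢0 a≡0 = *-≢0 fx≢0 (*-≢0 (⁻¹-≢0 κ≢0) gy≢0) (trans E₀ (trans (cong (_* b) a≡0) (zeroˡ b)))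
    a⁻¹ b⁻¹ : Fin q
    a⁻¹ = a ⁻¹
    b⁻¹ = b ⁻¹
    c″ d″ : V₃
    c″ i = a⁻¹ * c′ i
    d″ i = b⁻¹ * d′ i
    c″∈k : Over 1 c″
    c″∈k i = fix-* 1 (fix-⁻¹ 1 a≢0 (c∈k 3F)) (c∈k (Fin.inject₁ i))
    d″∈k : Over 1 d″
    d″∈k i = fix-* 1 (fix-⁻¹ 1 b≢0 (d∈k 3F)) (d∈k (Fin.inject₁ i))
    x″≢0 : lin c″ ≢ 0#
    x″≢0 eq = *-≢0 (⁻¹-≢0 a≢0) x≢0 (trans (sym (lin-scale a⁻¹ c′)) eq)
    y″f≡x″ : lin d″ * f c″ ≡ lin c″
    y″f≡x″ = begin
      lin d″ * f c″               ≡⟨ cong₂ _*_ (lin-scale b⁻¹ d′) (f-scale a⁻¹ c′) ⟩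
      b⁻¹ * y * (a⁻¹ * fx)        ≡⟨ solve 4 (λ A B y u → B :* y :* (A :* u) := A :* B :* (u :* y)) refl a⁻¹ b⁻¹ y fx ⟩
      a⁻¹ * b⁻¹ * (fx * y)        ≡⟨ cong (a⁻¹ * b⁻¹ *_) E₂ ⟨
      a⁻¹ * b⁻¹ * (x * b)         ≡⟨ solve 4 (λ A B x b → A :* B :* (x :* b) := A :* x :* (b :* B)) refl a⁻¹ b⁻¹ x b ⟩
      a⁻¹ * x * (b * b⁻¹)         ≡⟨ cong (a⁻¹ * x *_) (⁻¹-inverse b b≢0) ⟩
      a⁻¹ * x * 1#                ≡⟨ *-identityʳ _ ⟩
      a⁻¹ * x                     ≡⟨ lin-scale a⁻¹ c′ ⟨
      lin c″                      ∎
    f[c″]g[d″]≡κ : f c″ * g d″ ≡ κ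
    f[c″]g[d″]≡κ = begin
      f c″ * g d″                               ≡⟨ cong₂ _*_ (f-scale a⁻¹ c′) (g-scale b⁻¹ d′) ⟩
      a⁻¹ * fx * (b⁻¹ * gy)                     ≡⟨ *-identityˡ _ ⟨
      1# * (a⁻¹ * fx * (b⁻¹ * gy))              ≡⟨ cong (_* (a⁻¹ * fx * (b⁻¹ * gy))) (⁻¹-inverse κ κ≢0) ⟨
      κ * γ * (a⁻¹ * fx * (b⁻¹ * gy))           ≡⟨ solve 6 (λ k g A B u v → k :* g :* (A :* u :* (B :* v))
                                                     := k :* A :* B :* (u :* (g :* v))) refl κ γ a⁻¹ b⁻¹ fx gy ⟩
      κ * a⁻¹ * b⁻¹ * (fx * (γ * gy))           ≡⟨ cong (κ * a⁻¹ * b⁻¹ *_) E₀ ⟩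
      κ * a⁻¹ * b⁻¹ * (a * b)                   ≡⟨ solve 5 (λ k A B a b → k :* A :* B :* (a :* b)
                                                     := k :* (a :* A) :* (b :* B)) refl κ a⁻¹ b⁻¹ a b ⟩
      κ * (a * a⁻¹) * (b * b⁻¹)                 ≡⟨ cong₂ (λ s t → κ * s * t) (⁻¹-inverse a a≢0) (⁻¹-inverse b b≢0) ⟩
      κ * 1# * 1#                               ≡⟨ solve 1 (λ k → k :* :1 :* :1 := k) refl κ ⟩
      κ                                         ∎

  extend : ∀ d → (Fin (projectiveSize p d) → Fin d → Fin q) →
    Fin (p ℕ.^ d) ⊎ Fin (projectiveSize p d) → Fin (suc d) → Fin q
  extend d r (inj₁ t) zero    = 1#
  extend d r (inj₁ t) (suc j) = k.element (finToFun {p} {d} t j)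
  extend d r (inj₂ i) zero    = 0#
  extend d r (inj₂ i) (suc j) = r i j

  extend-fix : ∀ d {r} → (∀ i → Over 1 (r i)) → ∀ s → Over 1 (extend d r s)
  extend-fix d r∈k (inj₁ t) zero    = fix-1 1
  extend-fix d r∈k (inj₁ t) (suc j) = k.sound (finToFun {p} {d} t j)
  extend-fix d r∈k (inj₂ i) zero    = fix-0 1
  extend-fix d r∈k (inj₂ i) (suc j) = r∈k i j

  -- One parameter vector for each point of PG(d - 1, p): its first nonzero entry is 1. Scaling a
  -- parameter by k only scales its point, so for d = 4 these p³ + p² + p + 1 columns represent the
  -- whole linear set. The first p^d indices of `suc d` have leading entry 1, the others leading
  -- entry 0.
  representative : ∀ d → Fin (projectiveSize p d) → Fin d → Fin q
  representative (suc d) i = extend d (representative d) (Fin.splitAt (p ℕ.^ d) i)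

  representative-fix : ∀ d i → Over 1 (representative d i)
  representative-fix (suc d) i = extend-fix d (representative-fix d) (Fin.splitAt (p ℕ.^ d) i)

  Normalised : ∀ d → (Fin d → Fin q) → Set
  Normalised d c = ∃ λ i → ∃ λ a → a ≢ 0# × (∀ j → c j ≡ a * representative d i j)

  normalise-affine : ∀ d c → Over 1 c → c zero ≢ 0# → Normalised (suc d) c
  normalise-affine d c c∈k c₀≢0 = t Fin.↑ˡ projectiveSize p d , c zero , c₀≢0 , λ j →
    trans (equation j) (cong (λ s → c zero * extend d (representative d) s j)
                             (sym (Finₚ.splitAt-↑ˡ (p ℕ.^ d) t (projectiveSize p d))))
    where
    rest : ∀ j → ∃ λ x → k.element x ≡ c zero ⁻¹ * c (suc j)
    rest j = k.complete _ (fix-* 1 (fix-⁻¹ 1 c₀≢0 (c∈k zero)) (c∈k (suc j)))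
    t : Fin (p ℕ.^ d)
    t = funToFin (λ j → proj₁ (rest j))
    equation : ∀ j → c j ≡ c zero * extend d (representative d) (inj₁ t) j
    equation zero    = sym (*-identityʳ _)
    equation (suc j) = sym (begin
      c zero * k.element (finToFun {p} {d} t j)
        ≡⟨ cong (λ x → c zero * k.element x) (Finₚ.finToFun-funToFin (λ j → proj₁ (rest j)) j) ⟩
      c zero * k.element (proj₁ (rest j))  ≡⟨ cong (c zero *_) (proj₂ (rest j)) ⟩
      c zero * (c zero ⁻¹ * c (suc j))     ≡⟨ *-assoc (c zero) (c zero ⁻¹) (c (suc j)) ⟨
      c zero * c zero ⁻¹ * c (suc j)       ≡⟨ cong (_* c (suc j)) (⁻¹-inverse (c zero) c₀≢0) ⟩
      1# * c (suc j)                       ≡⟨ *-identityˡ (c (suc j)) ⟩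
      c (suc j)                            ∎)

  normalise-infinite : ∀ d c → c zero ≡ 0# → Normalised d (c ∘ suc) → Normalised (suc d) c
  normalise-infinite d c c₀≡0 (i , a , a≢0 , eq) = p ℕ.^ d Fin.↑ʳ i , a , a≢0 , λ j →
    trans (equation j) (cong (λ s → a * extend d (representative d) s j)
                             (sym (Finₚ.splitAt-↑ʳ (p ℕ.^ d) (projectiveSize p d) i)))
    where
    equation : ∀ j → c j ≡ a * extend d (representative d) (inj₂ i) j
    equation zero    = trans c₀≡0 (sym (zeroʳ a))
    equation (suc j) = eq j

  abstract
    normalise : ∀ d c → Over 1 c → NonZeroVector c → Normalised d c
    normalise (suc d) c c∈k (i , cᵢ≢0) = split (c zero ≟ 0#) i cᵢ≢0
      where
      split : Dec (c zero ≡ 0#) → ∀ i → c i ≢ 0# → Normalised (suc d) c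
      split (no c₀≢0)  i       cᵢ≢0 = normalise-affine d c c∈k c₀≢0
      split (yes c₀≡0) zero    cᵢ≢0 = contradiction c₀≡0 cᵢ≢0
      split (yes c₀≡0) (suc i) cᵢ≢0 = normalise-infinite d c c₀≡0 (normalise d (c ∘ suc) (c∈k ∘ suc) (i , cᵢ≢0))

  Θ : ℕ
  Θ = projectiveSize p 4

  U-column W-column : Fin Θ → V₃
  U-column i = U-point (representative 4 i)
  W-column i = W-point (representative 4 i)

  plane-covered : ∀ s → NonZeroVector s → ∃₂ λ i j → ∃₂ λ a b → a ≢ 0# × b ≢ 0# ×
    (∀ x → s x ≡ a * U-column i x + b * W-column j x)
  plane-covered s nz with secant U W U#W s nz
  ... | S with normalise 4 (Secant.c S) (Secant.c∈k S) (Secant.c≢0 S) | normalise 4 (Secant.d S) (Secant.d∈k S) (Secant.d≢0 S)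
  ... | i , λ′ , λ′≢0 , c≡ | j , μ , μ≢0 , d≡ =
    i , j , Secant.a S * λ′ , Secant.b S * μ , *-≢0 (Secant.a≢0 S) λ′≢0 , *-≢0 (Secant.b≢0 S) μ≢0 , λ x → begin
      s x
        ≡⟨ Secant.equation S x ⟩
      Secant.a S * U-point (Secant.c S) x + Secant.b S * W-point (Secant.d S) x
        ≡⟨ cong₂ (λ u w → Secant.a S * u + Secant.b S * w)
             (trans (LinearSet.point-cong U c≡ x) (LinearSet.point-scale U λ′ (representative 4 i) x))
             (trans (LinearSet.point-cong W d≡ x) (LinearSet.point-scale W μ (representative 4 j) x)) ⟩
      Secant.a S * (λ′ * U-column i x) + Secant.b S * (μ * W-column j x)
        ≡⟨ cong₂ _+_ (*-assoc _ _ _) (*-assoc _ _ _) ⟨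
      Secant.a S * λ′ * U-column i x + Secant.b S * μ * W-column j x ∎

  -- (1, ω, 0) with ω ∉ K is not proportional to any vector of K³.
  plane-not-single : ¬ (∀ s → ∃₂ λ a (h : V₃) → Over 3 h × (∀ x → s x ≡ a * h x))
  plane-not-single single with single (triple 1# (proj₁ ω-existence) 0#)
  ... | a , h , h∈K , eq = proj₂ ω-existence (subst (Fix 3) (sym ω≡) (fix-* 3 (fix-⁻¹ 3 h₀≢0 (h∈K 0F)) (h∈K 1F)))
    where
    ω : Fin q
    ω = proj₁ ω-existence
    h₀≢0 : h 0F ≢ 0#
    h₀≢0 h₀≡0 = 1≢0 (trans (eq 0F) (trans (cong (a *_) h₀≡0) (zeroʳ a)))
    ω≡ : ω ≡ h 0F ⁻¹ * h 1F
    ω≡ = *-cancelˡ-≢0 (h 0F) h₀≢0 (begin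
      h 0F * ω                    ≡⟨ cong (h 0F *_) (eq 1F) ⟩
      h 0F * (a * h 1F)           ≡⟨ solve 3 (λ x a y → x :* (a :* y) := (a :* x) :* y) refl (h 0F) a (h 1F) ⟩
      a * h 0F * h 1F             ≡⟨ cong (_* h 1F) (eq 0F) ⟨
      1# * h 1F                   ≡⟨ cong (_* h 1F) (⁻¹-inverse (h 0F) h₀≢0) ⟨
      h 0F * h 0F ⁻¹ * h 1F       ≡⟨ *-assoc _ _ _ ⟩
      h 0F * (h 0F ⁻¹ * h 1F)     ∎)

  columns-K : ∀ i → Over 3 (U-column i) × Over 3 (W-column i)
  columns-K i = LinearSet.point-K U (representative 4 i) (representative-fix 4 i) ,
                LinearSet.point-K W (representative 4 i) (representative-fix 4 i)

-- Raising the codimension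

data Side : Set where
  U W : Side

-- The field together with ∞ labels the lines through the origin of a plane; the columns of a code
-- are tagged so that the two columns used to cover a vector are assigned different slopes. Selected
-- columns carry a prescribed slope, plain ones a slope depending only on their side and shade, and
-- free columns are reserved for selection in the next code.
module Lifting {q : ℕ} (F : FinField q) (ρ : Fin q) (ρ≢0 : ρ ≢ FinField.0# F) (ρ≢1 : ρ ≢ FinField.1# F) where
  open FieldProperties F
  open PlaneVectors F using (NonZeroVector; nonZero?)
  open ≡-Reasoning

  data Slope : Set where
    finite : Fin q → Slope
    ∞      : Slope

  data Tag : Set where
    selected : Slope → Tag
    plain    : Side → Bool → Tag
    free     : Side → Tag

  -- Of the q columns above a free column on side `U`, one stays free and the others realise q - 1
  -- slopes, all finite ones except 1. The remaining slopes 1 and ∞ are left to side `W`.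
  slopeSide : Slope → Side
  slopeSide ∞ = W
  slopeSide (finite x) with x ≟ 1#
  ... | yes _ = W
  ... | no _  = U

  slopeSide-U : ∀ {x} → x ≢ 1# → slopeSide (finite x) ≡ U
  slopeSide-U {x} x≢1 with x ≟ 1#
  ... | yes x≡1 = contradiction x≡1 x≢1
  ... | no _    = refl

  slopeSide-W : slopeSide (finite 1#) ≡ W
  slopeSide-W with 1# ≟ 1#
  ... | yes _   = refl
  ... | no 1≢1 = contradiction refl 1≢1

  side : Tag → Side
  side (selected x) = slopeSide x
  side (plain s _)  = s
  side (free s)     = s

  -- Each side owns two slopes, one per shade: 0 and ρ for `U`, ∞ and 1 for `W`. These are the four
  -- classes.
  plainSlope : Side → Bool → Slope
  plainSlope U true  = finite 0#
  plainSlope U false = finite ρ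
  plainSlope W true  = ∞
  plainSlope W false = finite 1#

  slope : Tag → Slope
  slope (selected x) = x
  slope (plain s b)  = plainSlope s b
  slope (free s)     = plainSlope s true

  plainSlope-side : ∀ s b → slopeSide (plainSlope s b) ≡ s
  plainSlope-side U true  = slopeSide-U (λ 0≡1 → 1≢0 (sym 0≡1))
  plainSlope-side U false = slopeSide-U ρ≢1
  plainSlope-side W true  = refl
  plainSlope-side W false = slopeSide-W

  slope-side : ∀ t → slopeSide (slope t) ≡ side t
  slope-side (selected x) = refl
  slope-side (plain s b)  = plainSlope-side s b
  slope-side (free s)     = plainSlope-side s true

  finite-injective : ∀ {x y} → finite x ≡ finite y → x ≡ y
  finite-injective refl = refl

  plainSlope-injective : ∀ s {b b′} → plainSlope s b ≡ plainSlope s b′ → b ≡ b′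
  plainSlope-injective s {true}  {true}  eq = refl
  plainSlope-injective s {false} {false} eq = refl
  plainSlope-injective U {true}  {false} eq = contradiction (sym (finite-injective eq)) ρ≢0
  plainSlope-injective U {false} {true}  eq = contradiction (finite-injective eq) ρ≢0
  plainSlope-injective W {true}  {false} ()
  plainSlope-injective W {false} {true}  ()

  -- Mere inequality of slopes would not survive a step: two selected columns on one side may have
  -- distinct slopes and yet become plain columns of the same shade. The side of any column and the
  -- shade of a plain one do persist.
  data Separated : Tag → Tag → Set where
    by-side  : ∀ {t t′} → side t ≢ side t′ → Separated t t′
    by-shade : ∀ {s b b′} → b ≢ b′ → Separated (plain s b) (plain s b′)

  separated⇒slope≢ : ∀ {t t′} → Separated t t′ → slope t ≢ slope t′
  separated⇒slope≢ {t} {t′} (by-side s≢s′) eq =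
    s≢s′ (trans (sym (slope-side t)) (trans (cong slopeSide eq) (slope-side t′)))
  separated⇒slope≢ (by-shade {s} b≢b′) eq = b≢b′ (plainSlope-injective s eq)

  -- A selected column is spent after one step: the columns above it become plain, with shade
  -- recording whether y = 0, so that those with y ≠ 0 are separated from the one with y = 0. A free
  -- column leaves one free column above it, for the step after next, and the others carry selected
  -- slopes.
  retag : Tag → Fin q → Tag
  retag (selected x) y = plain (slopeSide x) (does (y ≟ 0#))
  retag (plain s b)  y = plain s b
  retag (free U)     y with y ≟ 1#
  ... | yes _ = free U
  ... | no _  = selected (finite y)
  retag (free W)     y with y ≟ 0# | y ≟ 1#
  ... | yes _ | _     = free W
  ... | no _  | yes _ = selected ∞
  ... | no _  | no _  = selected (finite 1#)

  retag-side : ∀ t y → side (retag t y) ≡ side t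
  retag-side (selected x) y = refl
  retag-side (plain s b)  y = refl
  retag-side (free U)     y with y ≟ 1#
  ... | yes _   = refl
  ... | no y≢1  = slopeSide-U y≢1
  retag-side (free W)     y with y ≟ 0# | y ≟ 1#
  ... | yes _ | _     = refl
  ... | no _  | yes _ = refl
  ... | no _  | no _  = slopeSide-W

  retag-separated : ∀ {t t′} y y′ → Separated t t′ → Separated (retag t y) (retag t′ y′)
  retag-separated {t} {t′} y y′ (by-side s≢s′) =
    by-side (λ eq → s≢s′ (trans (sym (retag-side t y)) (trans eq (retag-side t′ y′))))
  retag-separated y y′ (by-shade b≢b′) = by-shade b≢b′

  Occurs : ∀ {I : Set} → (I → Tag) → Tag → Set
  Occurs tag t = ∃ λ i → tag i ≡ t

  retag-free : ∀ s → ∃ λ y → retag (free s) y ≡ free s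
  retag-free U = 1# , eq
    where
    eq : retag (free U) 1# ≡ free U
    eq with 1# ≟ 1#
    ... | yes _   = refl
    ... | no 1≢1 = contradiction refl 1≢1
  retag-free W = 0# , eq
    where
    eq : retag (free W) 0# ≡ free W
    eq with 0# ≟ 0#
    ... | yes _   = refl
    ... | no 0≢0 = contradiction refl 0≢0

  retag-selected : ∀ x → ∃ λ s → ∃ λ y → retag (free s) y ≡ selected x
  retag-selected ∞ = W , 1# , eq
    where
    eq : retag (free W) 1# ≡ selected ∞
    eq with 1# ≟ 0# | 1# ≟ 1#
    ... | yes 1≡0 | _      = contradiction 1≡0 1≢0
    ... | no _    | yes _  = refl
    ... | no _    | no 1≢1 = contradiction refl 1≢1
  retag-selected (finite x) with x ≟ 1#
  -- Above a free column on side `W`, every y other than 0 and 1 yields slope 1; ρ is such a y.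
  ... | yes refl = W , ρ , eq
    where
    eq : retag (free W) ρ ≡ selected (finite 1#)
    eq with ρ ≟ 0# | ρ ≟ 1#
    ... | yes ρ≡0 | _       = contradiction ρ≡0 ρ≢0
    ... | no _    | yes ρ≡1 = contradiction ρ≡1 ρ≢1
    ... | no _    | no _    = refl
  ... | no x≢1 = U , x , eq
    where
    eq : retag (free U) x ≡ selected (finite x)
    eq with x ≟ 1#
    ... | yes x≡1 = contradiction x≡1 x≢1
    ... | no _    = refl

  dir₁ dir₂ : Slope → Fin q
  dir₁ (finite x) = 1#
  dir₁ ∞          = 0#
  dir₂ (finite x) = x
  dir₂ ∞          = 1#

  directions-span : ∀ x x′ → x ≢ x′ → ∀ u v → ∃₂ λ y z →
    u ≡ y * dir₁ x + z * dir₁ x′ × v ≡ y * dir₂ x + z * dir₂ x′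
  directions-span ∞ ∞ x≢x′ u v = contradiction refl x≢x′
  directions-span ∞ (finite x′) _ u v = v - u * x′ , u ,
    solve 3 (λ u v x → u := (v :- u :* x) :* :0 :+ u :* :1) refl u v x′ ,
    solve 3 (λ u v x → v := (v :- u :* x) :* :1 :+ u :* x) refl u v x′
  directions-span (finite x) ∞ _ u v = u , v - u * x ,
    solve 3 (λ u v x → u := u :* :1 :+ (v :- u :* x) :* :0) refl u v x ,
    solve 3 (λ u v x → v := u :* x :+ (v :- u :* x) :* :1) refl u v x
  directions-span (finite x) (finite x′) x≢x′ u v = u - z , z ,
    solve 2 (λ u z → u := (u :- z) :* :1 :+ z :* :1) refl u z ,
    (begin
      v                               ≡⟨ solve 3 (λ u v x → v := (v :- u :* x) :* :1 :+ u :* x) refl u v x ⟩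
      (v - u * x) * 1# + u * x        ≡⟨ cong (λ o → (v - u * x) * o + u * x) (⁻¹-inverse (x′ - x) x′-x≢0) ⟨
      (v - u * x) * ((x′ - x) * (x′ - x) ⁻¹) + u * x
        ≡⟨ solve 5 (λ u v x x′ i → (v :- u :* x) :* ((x′ :- x) :* i) :+ u :* x
             := (u :- (v :- u :* x) :* i) :* x :+ ((v :- u :* x) :* i) :* x′) refl u v x x′ ((x′ - x) ⁻¹) ⟩
      (u - z) * x + z * x′            ∎)
    where
    x′-x≢0 : x′ - x ≢ 0#
    x′-x≢0 eq = x≢x′ (cong finite (sym (x-y≡0⇒x≡y eq)))
    z : Fin q
    z = (v - u * x) * (x′ - x) ⁻¹

  slope-of : ∀ u v → u ≢ 0# ⊎ v ≢ 0# → ∃₂ λ x e → e ≢ 0# × u ≡ e * dir₁ x × v ≡ e * dir₂ x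
  slope-of u v nz with u ≟ 0#
  ... | no u≢0  = finite (u ⁻¹ * v) , u , u≢0 , sym (*-identityʳ u) , sym (begin
      u * (u ⁻¹ * v)   ≡⟨ *-assoc u (u ⁻¹) v ⟨
      u * u ⁻¹ * v     ≡⟨ cong (_* v) (⁻¹-inverse u u≢0) ⟩
      1# * v           ≡⟨ *-identityˡ v ⟩
      v                ∎)
  ... | yes u≡0 = ∞ , v , [ contradiction u≡0 , (λ v≢0 → v≢0) ]′ nz , trans u≡0 (sym (zeroʳ v)) , sym (*-identityʳ v)

  record TaggedPair {I : Set} {r} (column : I → Fin r → Fin q) (tag : I → Tag) (s : Fin r → Fin q) : Set where
    field
      i j       : I
      a b       : Fin q
      a≢0       : a ≢ 0#
      b≢0       : b ≢ 0#
      separated : Separated (tag i) (tag j)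
      equation  : ∀ x → s x ≡ a * column i x + b * column j x

  -- `I` keeps the structure of the columns (two sets, then columns above columns) visible to the
  -- tags; `decode-encode` ensures that each index occurs among the `n` columns. `not-single` is
  -- what excludes covering radius 1.
  record TaggedCode (r n : ℕ) : Set₁ where
    field
      I             : Set
      decode        : Fin n → I
      encode        : I → Fin n
      decode-encode : ∀ i → decode (encode i) ≡ i
      column        : I → Fin r → Fin q
      tag           : I → Tag
      covers        : ∀ s → NonZeroVector s → TaggedPair column tag s
      free-occurs   : ∀ s → Occurs tag (free s)
      not-single    : ¬ (∀ (s : Fin r → Fin q) → ∃₂ λ a i → ∀ x → s x ≡ a * column i x)

  record Extension (e : ℕ) : Set where
    field
      ext₁ ext₂ : Fin e → Fin q
      extTag    : Fin e → Tag

  module Lift {r n} (C : TaggedCode r n) {e} (E : Extension e) where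
    open TaggedCode C
    open Extension E

    I′ : Set
    I′ = (I × Fin q) ⊎ Fin e

    column′ : I′ → Fin (suc (suc r)) → Fin q
    column′ (inj₁ (i , y)) zero          = y * dir₁ (slope (tag i))
    column′ (inj₁ (i , y)) (suc zero)    = y * dir₂ (slope (tag i))
    column′ (inj₁ (i , y)) (suc (suc x)) = column i x
    column′ (inj₂ k)       zero          = ext₁ k
    column′ (inj₂ k)       (suc zero)    = ext₂ k
    column′ (inj₂ k)       (suc (suc x)) = 0#

    tag′ : I′ → Tag
    tag′ (inj₁ (i , y)) = retag (tag i) y
    tag′ (inj₂ k)       = extTag k

    -- The two ways to reach (u, v, 0, ..., 0): a difference of two columns above one selected
    -- column of the matching slope, or a combination of two additional columns.
    data Bottom (u v : Fin q) : Set where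
      from-selected : ∀ x e → Occurs tag (selected x) → e ≢ 0# → u ≡ e * dir₁ x → v ≡ e * dir₂ x → Bottom u v
      from-extension : ∀ k l a b → a ≢ 0# → b ≢ 0# → Separated (extTag k) (extTag l) →
        u ≡ a * ext₁ k + b * ext₁ l → v ≡ a * ext₂ k + b * ext₂ l → Bottom u v

    lift-pair : ∀ s → TaggedPair column tag (λ x → s (suc (suc x))) → TaggedPair column′ tag′ s
    lift-pair s P = record
      { i = inj₁ (P.i , y) ; j = inj₁ (P.j , z) ; a = P.a ; b = P.b ; a≢0 = P.a≢0 ; b≢0 = P.b≢0
      ; separated = retag-separated y z P.separated
      ; equation  = λ { zero → trans (proj₁ (proj₂ (proj₂ span))) (spread (dir₁ x) (dir₁ x′))
                      ; (suc zero) → trans (proj₂ (proj₂ (proj₂ span))) (spread (dir₂ x) (dir₂ x′))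
                      ; (suc (suc k)) → P.equation k } }
      where
      module P = TaggedPair P
      x x′ : Slope
      x = slope (tag P.i)
      x′ = slope (tag P.j)
      span : ∃₂ λ y z → s zero ≡ y * dir₁ x + z * dir₁ x′ × s (suc zero) ≡ y * dir₂ x + z * dir₂ x′
      span = directions-span x x′ (separated⇒slope≢ P.separated) (s zero) (s (suc zero))
      y z : Fin q
      -- The coefficients are already fixed by the old coordinates, so the parameters of the two
      -- columns absorb their inverses.
      y = P.a ⁻¹ * proj₁ span
      z = P.b ⁻¹ * proj₁ (proj₂ span)
      unscale : ∀ a v → a ≢ 0# → ∀ d → v * d ≡ a * (a ⁻¹ * v * d)
      unscale a v a≢0 d = begin
        v * d                   ≡⟨ *-identityˡ _ ⟨
        1# * (v * d)            ≡⟨ cong (_* (v * d)) (⁻¹-inverse a a≢0) ⟨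
        a * a ⁻¹ * (v * d)      ≡⟨ solve 4 (λ a i v d → a :* i :* (v :* d) := a :* (i :* v :* d)) refl a (a ⁻¹) v d ⟩
        a * (a ⁻¹ * v * d)      ∎
      spread : ∀ d d′ → proj₁ span * d + proj₁ (proj₂ span) * d′ ≡ P.a * (y * d) + P.b * (z * d′)
      spread d d′ = cong₂ _+_ (unscale P.a (proj₁ span) P.a≢0 d) (unscale P.b (proj₁ (proj₂ span)) P.b≢0 d′)

    bottom-pair : ∀ s → (∀ x → s (suc (suc x)) ≡ 0#) → Bottom (s zero) (s (suc zero)) → TaggedPair column′ tag′ s
    bottom-pair s s≡0 (from-extension k l a b a≢0 b≢0 sep u≡ v≡) = record
      { i = inj₂ k ; j = inj₂ l ; a = a ; b = b ; a≢0 = a≢0 ; b≢0 = b≢0 ; separated = sep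
      ; equation = λ { zero → u≡ ; (suc zero) → v≡
                     ; (suc (suc x)) → trans (s≡0 x) (solve 2 (λ a b → :0 := a :* :0 :+ b :* :0) refl a b) } }
    bottom-pair s s≡0 (from-selected x e (i , tag≡) e≢0 u≡ v≡) = record
      -- The coefficients 1 and -1 cancel the old coordinates and leave e times the direction of
      -- slope x; as e ≠ 0, the two columns differ in shade.
      { i = inj₁ (i , e) ; j = inj₁ (i , 0#) ; a = 1# ; b = - 1# ; a≢0 = 1≢0
      ; b≢0 = λ eq → 1≢0 (trans (solve 0 (:1 := :- (:- :1)) refl) (trans (cong -_ eq) (solve 0 (:- :0 := :0) refl)))
      ; separated = subst (λ t → Separated (retag t e) (retag t 0#)) (sym tag≡)
          (by-shade (λ eq → contradiction (trans (sym (dec-false (e ≟ 0#) e≢0))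
                                                 (trans eq (dec-true (0# ≟ 0#) refl))) (λ ())))
      ; equation = λ { zero → trans u≡ (at dir₁) ; (suc zero) → trans v≡ (at dir₂)
                     ; (suc (suc x)) → trans (s≡0 x) (solve 1 (λ h → :0 := :1 :* h :+ (:- :1) :* h) refl (column i x)) } }
      where
      at : ∀ (d : Slope → Fin q) → e * d x ≡ 1# * (e * d (slope (tag i))) + - 1# * (0# * d (slope (tag i)))
      at d = trans (cong (λ t → e * d (slope t)) (sym tag≡))
        (solve 2 (λ e d → e :* d := :1 :* (e :* d) :+ (:- :1) :* (:0 :* d)) refl e (d (slope (tag i))))

    lift : (∀ u v → u ≢ 0# ⊎ v ≢ 0# → Bottom u v) → TaggedCode (suc (suc r)) (n ℕ.* q ℕ.+ e)
    lift bottom = record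
      { I = I′ ; decode = decode′ ; encode = encode′ ; decode-encode = decode-encode′
      ; column = column′ ; tag = tag′ ; covers = covers′ ; free-occurs = free-occurs′
      ; not-single = λ single → not-single (λ s → project {s} (single (padded s))) }
      where
      decode″ : Fin (n ℕ.* q) ⊎ Fin e → I′
      decode″ (inj₁ k) = inj₁ (decode (proj₁ (Fin.remQuot {n} q k)) , proj₂ (Fin.remQuot {n} q k))
      decode″ (inj₂ k) = inj₂ k
      decode′ : Fin (n ℕ.* q ℕ.+ e) → I′
      decode′ k = decode″ (Fin.splitAt (n ℕ.* q) k)
      encode′ : I′ → Fin (n ℕ.* q ℕ.+ e)
      encode′ (inj₁ (i , y)) = Fin.combine (encode i) y Fin.↑ˡ e
      encode′ (inj₂ k)       = n ℕ.* q Fin.↑ʳ k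
      decode-encode′ : ∀ j → decode′ (encode′ j) ≡ j
      decode-encode′ (inj₁ (i , y)) = trans (cong decode″ (Finₚ.splitAt-↑ˡ (n ℕ.* q) (Fin.combine (encode i) y) e))
        (cong inj₁ (trans (cong (λ k → decode (proj₁ k) , proj₂ k) (Finₚ.remQuot-combine (encode i) y))
                          (cong (_, y) (decode-encode i))))
      decode-encode′ (inj₂ k) = cong decode″ (Finₚ.splitAt-↑ʳ (n ℕ.* q) e k)

      covers′ : ∀ s → NonZeroVector s → TaggedPair column′ tag′ s
      covers′ s (k , ≢0) with nonZero? (λ x → s (suc (suc x)))
      ... | inj₁ nz  = lift-pair s (covers _ nz)
      ... | inj₂ s≡0 = bottom-pair s s≡0 (bottom (s zero) (s (suc zero)) (nz k ≢0))
        where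
        nz : ∀ k → s k ≢ 0# → s zero ≢ 0# ⊎ s (suc zero) ≢ 0#
        nz zero          ≢0 = inj₁ ≢0
        nz (suc zero)    ≢0 = inj₂ ≢0
        nz (suc (suc k)) ≢0 = contradiction (s≡0 k) ≢0

      free-occurs′ : ∀ s → Occurs tag′ (free s)
      free-occurs′ s with free-occurs s | retag-free s
      ... | i , tag≡ | y , eq = inj₁ (i , y) , trans (cong (λ t → retag t y) tag≡) eq

      padded : (Fin r → Fin q) → Fin (suc (suc r)) → Fin q
      padded s zero          = 0#
      padded s (suc zero)    = 0#
      padded s (suc (suc x)) = s x

      project : ∀ {s} → ∃₂ (λ a j → ∀ x → padded s x ≡ a * column′ j x) → ∃₂ λ a i → ∀ x → s x ≡ a * column i x
      project (a , inj₁ (i , y) , eq) = a , i , λ x → eq (suc (suc x))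
      -- An additional column is zero on the old coordinates, so `s` is the zero vector, that is, 0
      -- times any column.
      project (a , inj₂ k , eq) = 0# , proj₁ (free-occurs U) , λ x →
        trans (eq (suc (suc x))) (trans (zeroʳ a) (sym (zeroˡ _)))

    -- The free columns of the old code alone supply every slope, so each step after the first finds
    -- its selected columns without an extension.
    lift-selected : ∀ bottom x → Occurs (TaggedCode.tag (lift bottom)) (selected x)
    lift-selected bottom x with retag-selected x
    ... | s , y , eq with free-occurs s
    ...   | i , tag≡ = inj₁ (i , y) , trans (cong (λ t → retag t y) tag≡) eq

  record SelectableCode (r n : ℕ) : Set₁ where
    field
      code            : TaggedCode r n
      selected-occurs : ∀ x → Occurs (TaggedCode.tag code) (selected x)

  lift-selectable : ∀ {r n} → SelectableCode r n → SelectableCode (suc (suc r)) (n ℕ.* q ℕ.+ 0)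
  lift-selectable C = record { code = lift bottom ; selected-occurs = lift-selected bottom }
    where
    open SelectableCode C
    noExtension : Extension 0
    noExtension = record { ext₁ = λ () ; ext₂ = λ () ; extTag = λ () }
    open Lift code noExtension
    bottom : ∀ u v → u ≢ 0# ⊎ v ≢ 0# → Bottom u v
    bottom u v nz with slope-of u v nz
    ... | x , e , e≢0 , u≡ , v≡ = from-selected x e (selected-occurs x) e≢0 u≡ v≡

  -- The two additional columns are the unit vectors on the new axes. They cover (u, v, 0, ..., 0)
  -- with u and v nonzero; on an axis one of their coefficients would vanish, and there the selected
  -- columns of slope 0 and ∞ are used instead.
  lift-initial : ∀ {r n} (C : TaggedCode r n) → Occurs (TaggedCode.tag C) (selected (finite 0#)) →
    Occurs (TaggedCode.tag C) (selected ∞) → SelectableCode (suc (suc r)) (n ℕ.* q ℕ.+ 2)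
  lift-initial C occurs-0 occurs-∞ = record { code = lift bottom ; selected-occurs = lift-selected bottom }
    where
    twoColumns : Extension 2
    twoColumns = record { ext₁ = λ { 0F → 1# ; 1F → 0# } ; ext₂ = λ { 0F → 0# ; 1F → 1# }
                        ; extTag = λ { 0F → plain U true ; 1F → plain W true } }
    open Lift C twoColumns
    bottom : ∀ u v → u ≢ 0# ⊎ v ≢ 0# → Bottom u v
    bottom u v nz with u ≟ 0# | v ≟ 0#
    ... | no u≢0  | no v≢0  = from-extension 0F 1F u v u≢0 v≢0 (by-side (λ ()))
                                (solve 2 (λ u v → u := u :* :1 :+ v :* :0) refl u v)
                                (solve 2 (λ u v → v := u :* :0 :+ v :* :1) refl u v)
    ... | no u≢0  | yes v≡0 = from-selected (finite 0#) u occurs-0 u≢0 (sym (*-identityʳ u)) (trans v≡0 (sym (zeroʳ u)))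
    ... | yes u≡0 | no v≢0  = from-selected ∞ v occurs-∞ v≢0 (trans u≡0 (sym (zeroʳ v))) (sym (*-identityʳ v))
    ... | yes u≡0 | yes v≡0 = contradiction v≡0 ([ contradiction u≡0 , (λ v≢0 → v≢0) ]′ nz)

-- The family of codes

module CodeFamily {q : ℕ} (F : FinField q) {p : ℕ} (pp : Prime p) (q≡p^6 : q ≡ p ℕ.^ 6) where
  open SubfieldTower F pp q≡p^6 hiding (solve; con; _:+_; _:*_; _:=_)
  open PlaneVectors F
  open DoubleBlockingSet F pp q≡p^6 using (Over)
  open PlaneCode F pp q≡p^6 using (Θ; U-column; W-column; plane-covered; plane-not-single; columns-K)

  ω : Fin q
  ω = proj₁ ω-existence

  ω∉K : ¬ Fix 3 ω
  ω∉K = proj₂ ω-existence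

  -- ρ may be any element other than 0 and 1; an element outside K qualifies.
  open Lifting F ω (λ eq → ω∉K (subst (Fix 3) (sym eq) (fix-0 3))) (λ eq → ω∉K (subst (Fix 3) (sym eq) (fix-1 3))) public

  1<Θ : 1 ℕ.< Θ
  1<Θ = ℕₚ.≤-trans (ℕₚ.≤-trans (subst (1 ℕ.<_) (sym (ℕₚ.*-identityʳ p)) 1<p)
          (ℕₚ.^-monoʳ-≤ p {{prime⇒nonZero pp}} {x = 1} {y = 3} (s≤s z≤n))) (ℕₚ.m≤m+n (p ℕ.^ 3) _)

  i₀ i₁ : Fin Θ
  i₀ = Fin.fromℕ< (ℕₚ.<-trans ℕₚ.0<1+n 1<Θ)
  i₁ = Fin.fromℕ< 1<Θ

  i₁≢i₀ : i₁ ≢ i₀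
  i₁≢i₀ eq = contradiction (Finₚ.fromℕ<-injective 1 0 1<Θ (ℕₚ.<-trans ℕₚ.0<1+n 1<Θ) eq) (λ ())

  choose : ∀ {i} → Dec (i ≡ i₀) → Slope → Side → Tag
  choose (yes _) x s = selected x
  choose (no _)  x s = free s

  -- One column of each set is selected and the rest are free. The slopes 0 and ∞ lie on the sides
  -- `U` and `W` respectively, so selection does not change the side of a column and every secant
  -- stays separated by side.
  planeTag : Fin Θ ⊎ Fin Θ → Tag
  planeTag (inj₁ i) = choose (i Finₚ.≟ i₀) (finite 0#) U
  planeTag (inj₂ j) = choose (j Finₚ.≟ i₀) ∞ W

  planeTag-U : ∀ i → side (planeTag (inj₁ i)) ≡ U
  planeTag-U i with i Finₚ.≟ i₀
  ... | yes _ = slopeSide-U (λ 0≡1 → 1≢0 (sym 0≡1))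
  ... | no _  = refl

  planeTag-W : ∀ j → side (planeTag (inj₂ j)) ≡ W
  planeTag-W j with j Finₚ.≟ i₀
  ... | yes _ = refl
  ... | no _  = refl

  choose-selected : ∀ x s → choose (i₀ Finₚ.≟ i₀) x s ≡ selected x
  choose-selected x s with i₀ Finₚ.≟ i₀
  ... | yes _ = refl
  ... | no ≢  = contradiction refl ≢

  choose-free : ∀ x s → choose (i₁ Finₚ.≟ i₀) x s ≡ free s
  choose-free x s with i₁ Finₚ.≟ i₀
  ... | yes eq = contradiction eq i₁≢i₀
  ... | no _   = refl

  planeColumn : Fin Θ ⊎ Fin Θ → Fin 3 → Fin q
  planeColumn (inj₁ i) = U-column i
  planeColumn (inj₂ j) = W-column j

  planeColumn-K : ∀ i → Over 3 (planeColumn i)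
  planeColumn-K (inj₁ i) = proj₁ (columns-K i)
  planeColumn-K (inj₂ j) = proj₂ (columns-K j)

  planeCode : TaggedCode 3 (Θ ℕ.+ Θ)
  planeCode = record
    { I = Fin Θ ⊎ Fin Θ ; decode = Fin.splitAt Θ ; encode = Fin.join Θ Θ ; decode-encode = Finₚ.splitAt-join Θ Θ
    ; column = planeColumn ; tag = planeTag
    ; covers = covers
    ; free-occurs = λ { U → inj₁ i₁ , choose-free (finite 0#) U ; W → inj₂ i₁ , choose-free ∞ W }
    ; not-single = λ single → plane-not-single (λ s →
        let a , i , eq = single s in a , planeColumn i , planeColumn-K i , eq) }
    where
    U≢W : U ≢ W
    U≢W ()
    covers : ∀ s → NonZeroVector s → TaggedPair planeColumn planeTag s
    covers s nz = let i , j , a , b , a≢0 , b≢0 , eq = plane-covered s nz in record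
      { i = inj₁ i ; j = inj₂ j ; a = a ; b = b ; a≢0 = a≢0 ; b≢0 = b≢0
      ; separated = by-side (λ eq → U≢W (trans (sym (planeTag-U i)) (trans eq (planeTag-W j))))
      ; equation = eq }

  redundancy codeLength : ℕ → ℕ
  redundancy zero    = 3
  redundancy (suc t) = suc (suc (redundancy t))
  codeLength zero          = Θ ℕ.+ Θ
  codeLength (suc zero)    = (Θ ℕ.+ Θ) ℕ.* q ℕ.+ 2
  codeLength (suc (suc t)) = codeLength (suc t) ℕ.* q ℕ.+ 0

  selectableCodes : ∀ t → SelectableCode (redundancy (suc t)) (codeLength (suc t))
  selectableCodes zero    = lift-initial planeCode (inj₁ i₀ , choose-selected (finite 0#) U) (inj₂ i₀ , choose-selected ∞ W)
  selectableCodes (suc t) = lift-selectable (selectableCodes t)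

  codes : ∀ t → TaggedCode (redundancy t) (codeLength t)
  codes zero    = planeCode
  codes (suc t) = SelectableCode.code (selectableCodes t)

  redundancy≡ : ∀ t → redundancy t ≡ 2 ℕ.* suc t ℕ.+ 1
  redundancy≡ zero    = refl
  redundancy≡ (suc t) = trans (cong (2 ℕ.+_) (redundancy≡ t))
    (solve 1 (λ t → con 2 :+ (con 2 :* (con 1 :+ t) :+ con 1) := con 2 :* (con 2 :+ t) :+ con 1) refl t)
    where open +-*-Solver

  Θ≡ : Θ ≡ p ℕ.^ 3 ℕ.+ p ℕ.^ 2 ℕ.+ p ℕ.+ 1
  Θ≡ = solve 3 (λ x y p → x :+ (y :+ (p :* con 1 :+ (con 1 :+ con 0))) := x :+ y :+ p :+ con 1) refl
         (p ℕ.^ 3) (p ℕ.^ 2) p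
    where open +-*-Solver

  codeLength-suc : ∀ t → codeLength (suc t) ≡ 2 ℕ.* Θ ℕ.* q ℕ.^ suc t ℕ.+ 2 ℕ.* q ℕ.^ t
  codeLength-suc zero    = solve 2 (λ s q → (s :+ s) :* q :+ con 2 := con 2 :* s :* (q :* con 1) :+ con 2 :* con 1) refl Θ q
    where open +-*-Solver
  codeLength-suc (suc t) = trans (cong (λ n → n ℕ.* q ℕ.+ 0) (codeLength-suc t))
    (solve 3 (λ s q x → (con 2 :* s :* (q :* x) :+ con 2 :* x) :* q :+ con 0
                     := con 2 :* s :* (q :* (q :* x)) :+ con 2 :* (q :* x)) refl Θ q (q ℕ.^ t))
    where open +-*-Solver

  codeLength≡ : ∀ t → codeLength t ≡ nLen p (suc t)
  codeLength≡ zero = trans (solve 1 (λ s → s :+ s := con 2 :* s :* con 1 :+ con 2 :* con 0) refl Θ)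
                           (cong (λ s → 2 ℕ.* s ℕ.* 1 ℕ.+ 2 ℕ.* 0) Θ≡)
    where open +-*-Solver
  codeLength≡ (suc t) = trans (codeLength-suc t) (cong₂ ℕ._+_
    (cong₂ (λ s x → 2 ℕ.* s ℕ.* x) Θ≡ (trans (cong (ℕ._^ suc t) q≡p^6) (ℕₚ.^-*-assoc p 6 (suc t))))
    (cong (λ x → 2 ℕ.* x ℕ.^ t) q≡p^6))

-- Covering radius over the given field

module CoveringRadius {q : ℕ} (F : FiniteField q) where
  private module F = FiniteField F
  open Transport F
  open FinField finField using (_+_; _*_; 0#)
  open PlaneVectors finField using (NonZeroVector; nonZero?)
  open import Relation.Binary.Reasoning.Setoid F.setoid

  fromTaggedCode : ∀ {ρ ρ≢0 ρ≢1} → let open Lifting finField ρ ρ≢0 ρ≢1 in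
    ∀ {r n} → TaggedCode r n → Σ (Matrix F r n) λ H → HasCoveringRadius F H 2
  fromTaggedCode {ρ} {ρ≢0} {ρ≢1} {r} {n} C = H , covers-2 , not-covers-1
    where
    open Lifting finField ρ ρ≢0 ρ≢1
    module C = TaggedCode C
    H : Matrix F r n
    H x k = from (C.column (C.decode k) x)
    H-encode : ∀ i x → H x (C.encode i) F.≈ from (C.column i x)
    H-encode i x = F.reflexive (cong (λ j → from (C.column j x)) (C.decode-encode i))

    combination : (s : Fin r → F.Carrier) → NonZeroVector (to ∘ s) ⊎ (∀ x → to (s x) ≡ 0#) → CombOfAtMost F H 2 s
    combination s (inj₁ nz) = (λ { 0F → C.encode P.i ; 1F → C.encode P.j }) , (λ { 0F → from P.a ; 1F → from P.b }) , λ x → begin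
      s x                                                                   ≈⟨ from∘to (s x) ⟨
      from (to (s x))                                                       ≡⟨ cong from (P.equation x) ⟩
      from (P.a * C.column P.i x + P.b * C.column P.j x)                    ≈⟨ from∘to _ ⟩
      from (P.a * C.column P.i x) F.+ from (P.b * C.column P.j x)           ≈⟨ F.+-cong (from∘to _) (from∘to _) ⟩
      from P.a F.* from (C.column P.i x) F.+ from P.b F.* from (C.column P.j x)
        ≈⟨ F.+-cong (F.*-congˡ (H-encode P.i x)) (F.*-congˡ (H-encode P.j x)) ⟨
      from P.a F.* H x (C.encode P.i) F.+ from P.b F.* H x (C.encode P.j)   ≈⟨ F.+-congˡ (F.+-identityʳ _) ⟨
      from P.a F.* H x (C.encode P.i) F.+ (from P.b F.* H x (C.encode P.j) F.+ F.0#) ∎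
      where module P = TaggedPair (C.covers (to ∘ s) nz)
    -- The tagged pairs cover nonzero vectors only; the zero vector takes zero coefficients at an
    -- arbitrary column, which a free tag provides.
    combination s (inj₂ s≡0) = (λ _ → k) , (λ _ → F.0#) , λ x → begin
      s x                                                      ≈⟨ from∘to (s x) ⟨
      from (to (s x))                                          ≡⟨ cong from (s≡0 x) ⟩
      from 0#                                                  ≈⟨ from∘to _ ⟩
      F.0#                                                     ≈⟨ F.+-identityˡ _ ⟨
      F.0# F.+ F.0#                                            ≈⟨ F.+-congˡ (F.+-identityˡ _) ⟨
      F.0# F.+ (F.0# F.+ F.0#)                                 ≈⟨ F.+-cong (F.zeroˡ _) (F.+-congʳ (F.zeroˡ _)) ⟨
      F.0# F.* H x k F.+ (F.0# F.* H x k F.+ F.0#)             ∎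
      where
      k : Fin n
      k = C.encode (proj₁ (C.free-occurs U))

    covers-2 : Covers F H 2
    covers-2 s = combination s (nonZero? (to ∘ s))

    not-covers-1 : ¬ Covers F H 1
    not-covers-1 covers-1 = C.not-single (λ s → let k , a , eq = covers-1 (from ∘ s) in
      to (a 0F) , C.decode (k 0F) , λ x → from-injective (begin
        from (s x)                                                ≈⟨ eq x ⟩
        a 0F F.* H x (k 0F) F.+ F.0#                              ≈⟨ F.+-identityʳ _ ⟩
        a 0F F.* H x (k 0F)                                       ≈⟨ F.*-congʳ (from∘to (a 0F)) ⟨
        from (to (a 0F)) F.* H x (k 0F)                           ≈⟨ from∘to _ ⟨
        from (to (a 0F) * C.column (C.decode (k 0F)) x)           ∎))

covering-codes : ∀ {q} (F : FiniteField q) {p} → Prime p → q ≡ p ℕ.^ 6 → ∀ t → 1 ℕ.≤ t →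
  Σ (Matrix F (2 ℕ.* t ℕ.+ 1) (nLen p t)) λ H → HasCoveringRadius F H 2
covering-codes F pp q≡p^6 (suc t) _ = subst₂ (λ r n → Σ (Matrix F r n) λ H → HasCoveringRadius F H 2)
  (Family.redundancy≡ t) (Family.codeLength≡ t) (CoveringRadius.fromTaggedCode F (Family.codes t))
  where module Family = CodeFamily (Transport.finField F) pp q≡p^6

-- Covering density

open import Data.Integer as ℤ using (+_)
import Data.Integer.Properties as ℤₚ
open import Data.Rational as ℚ using (ℚ; 0ℚ; _/_; toℚᵘ)
import Data.Rational.Properties as ℚₚ
open import Data.Rational.Unnormalised as ℚᵘ using (mkℚᵘ; *≡*; *≤*; *<*)
import Data.Rational.Unnormalised.Properties as ℚᵘₚ

toℚᵘ-/ : ∀ i m .{{_ : NonZero m}} → toℚᵘ (i / m) ℚᵘ.≃ i ℚᵘ./ m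
toℚᵘ-/ i (suc m) = ℚₚ.toℚᵘ-fromℚᵘ (mkℚᵘ i m)

/-mono-< : ∀ {a b m n} .{{_ : NonZero m}} .{{_ : NonZero n}} → a ℕ.* n ℕ.< b ℕ.* m → (+ a) / m ℚ.< (+ b) / n
/-mono-< {a} {b} {m@(suc m′)} {n@(suc n′)} lt = ℚₚ.toℚᵘ-cancel-< (ℚᵘₚ.<-respˡ-≃ (ℚᵘₚ.≃-sym (toℚᵘ-/ (+ a) m))
  (ℚᵘₚ.<-respʳ-≃ (ℚᵘₚ.≃-sym (toℚᵘ-/ (+ b) n)) (*<* (subst₂ ℤ._<_ (ℤₚ.pos-* a n) (ℤₚ.pos-* b m) (ℤ.+<+ lt)))))

/-mono-≤ : ∀ {a b m n} .{{_ : NonZero m}} .{{_ : NonZero n}} → a ℕ.* n ℕ.≤ b ℕ.* m → (+ a) / m ℚ.≤ (+ b) / n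
/-mono-≤ {a} {b} {m@(suc m′)} {n@(suc n′)} le = ℚₚ.toℚᵘ-cancel-≤ (ℚᵘₚ.≤-respˡ-≃ (ℚᵘₚ.≃-sym (toℚᵘ-/ (+ a) m))
  (ℚᵘₚ.≤-respʳ-≃ (ℚᵘₚ.≃-sym (toℚᵘ-/ (+ b) n)) (*≤* (subst₂ ℤ._≤_ (ℤₚ.pos-* a n) (ℤₚ.pos-* b m) (ℤ.+≤+ le)))))

/-+-/ : ∀ a b {m n} c .{{_ : NonZero m}} .{{_ : NonZero n}} → n ≡ c ℕ.* m →
  (+ a) / m ℚ.+ (+ b) / n ≡ (+ (a ℕ.* c ℕ.+ b)) / n
/-+-/ a b {m@(suc m′)} {n@(suc n′)} c n≡c*m = ℚₚ.toℚᵘ-injective (begin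
  toℚᵘ ((+ a) / m ℚ.+ (+ b) / n)             ≈⟨ ℚₚ.toℚᵘ-homo-+ ((+ a) / m) ((+ b) / n) ⟩
  toℚᵘ ((+ a) / m) ℚᵘ.+ toℚᵘ ((+ b) / n)     ≈⟨ ℚᵘₚ.+-cong (toℚᵘ-/ (+ a) m) (toℚᵘ-/ (+ b) n) ⟩
  (+ a) ℚᵘ./ m ℚᵘ.+ (+ b) ℚᵘ./ n             ≈⟨ *≡* numerators ⟩
  (+ (a ℕ.* c ℕ.+ b)) ℚᵘ./ n                 ≈⟨ toℚᵘ-/ (+ (a ℕ.* c ℕ.+ b)) n ⟨
  toℚᵘ ((+ (a ℕ.* c ℕ.+ b)) / n)             ∎)
  where
  open ℚᵘₚ.≃-Reasoning
  numerators : ((+ a) ℤ.* (+ n) ℤ.+ (+ b) ℤ.* (+ m)) ℤ.* (+ n) ≡ (+ (a ℕ.* c ℕ.+ b)) ℤ.* (+ (m ℕ.* n))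
  numerators = trans
    (cong₂ ℤ._*_ (cong₂ ℤ._+_ (sym (ℤₚ.pos-* a n)) (sym (ℤₚ.pos-* b m))) refl)
    (trans (sym (ℤₚ.pos-* (a ℕ.* n ℕ.+ b ℕ.* m) n))
    (trans (cong +_ (trans (cong (λ k → (a ℕ.* k ℕ.+ b ℕ.* m) ℕ.* n) n≡c*m)
                    (solve 5 (λ a b c m n → (a :* (c :* m) :+ b :* m) :* n := (a :* c :+ b) :* (m :* n)) refl a b c m n)))
           (ℤₚ.pos-* (a ℕ.* c ℕ.+ b) (m ℕ.* n))))
    where open +-*-Solver

nC2 : ∀ n → 2 ℕ.* (n C 2) ℕ.+ n ≡ n ℕ.* n
nC2 zero    = refl
nC2 (suc n) = begin
  2 ℕ.* (suc n C 2) ℕ.+ suc n            ≡⟨ cong (λ c → 2 ℕ.* c ℕ.+ suc n) (nCk+nC[k+1]≡[n+1]C[k+1] n 1) ⟨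
  2 ℕ.* (n C 1 ℕ.+ (n C 2)) ℕ.+ suc n    ≡⟨ cong (λ c → 2 ℕ.* (c ℕ.+ (n C 2)) ℕ.+ suc n) (nC1≡n n) ⟩
  2 ℕ.* (n ℕ.+ (n C 2)) ℕ.+ suc n        ≡⟨ solve 2 (λ n c → con 2 :* (n :+ c) :+ (con 1 :+ n)
                                              := (con 2 :* c :+ n) :+ (con 1 :+ con 2 :* n)) refl n (n C 2) ⟩
  (2 ℕ.* (n C 2) ℕ.+ n) ℕ.+ suc (2 ℕ.* n) ≡⟨ cong (ℕ._+ suc (2 ℕ.* n)) (nC2 n) ⟩
  n ℕ.* n ℕ.+ suc (2 ℕ.* n)              ≡⟨ solve 1 (λ n → n :* n :+ (con 1 :+ con 2 :* n)
                                              := (con 1 :+ n) :* (con 1 :+ n)) refl n ⟩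
  suc n ℕ.* suc n                        ∎
  where
  open ≡-Reasoning
  open +-*-Solver

-- 2a² C(n, 2) falls short of (an)² by a²n, and for a ≥ 3 this exceeds the remaining terms 2 + 2an.
V-bound : ∀ a n → 3 ℕ.≤ a → 1 ℕ.≤ n → 2 ℕ.* V (suc a) n 2 ℕ.< (a ℕ.* n) ℕ.* (a ℕ.* n)
V-bound a n 3≤a 1≤n = begin-strict
  2 ℕ.* V (suc a) n 2
    ≡⟨ cong (λ c → 2 ℕ.* (1 ℕ.+ a ℕ.^ 1 ℕ.* c ℕ.+ a ℕ.^ 2 ℕ.* (n C 2))) (nC1≡n n) ⟩
  2 ℕ.* (1 ℕ.+ a ℕ.^ 1 ℕ.* n ℕ.+ a ℕ.^ 2 ℕ.* (n C 2))
    ≡⟨ solve 3 (λ a n c → con 2 :* (con 1 :+ (a :* con 1) :* n :+ (a :* (a :* con 1)) :* c)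
         := (con 2 :+ con 2 :* (a :* n)) :+ a :* a :* (con 2 :* c)) refl a n (n C 2) ⟩
  (2 ℕ.+ 2 ℕ.* (a ℕ.* n)) ℕ.+ a ℕ.* a ℕ.* (2 ℕ.* (n C 2))
    <⟨ ℕₚ.+-monoˡ-< _ small ⟩
  a ℕ.* (a ℕ.* n) ℕ.+ a ℕ.* a ℕ.* (2 ℕ.* (n C 2))
    ≡⟨ solve 3 (λ a n c → a :* (a :* n) :+ a :* a :* c := a :* a :* (c :+ n)) refl a n (2 ℕ.* (n C 2)) ⟩
  a ℕ.* a ℕ.* (2 ℕ.* (n C 2) ℕ.+ n)
    ≡⟨ cong (a ℕ.* a ℕ.*_) (nC2 n) ⟩
  a ℕ.* a ℕ.* (n ℕ.* n)
    ≡⟨ solve 2 (λ a n → a :* a :* (n :* n) := (a :* n) :* (a :* n)) refl a n ⟩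
  (a ℕ.* n) ℕ.* (a ℕ.* n) ∎
  where
  open ℕₚ.≤-Reasoning
  open +-*-Solver
  small : 2 ℕ.+ 2 ℕ.* (a ℕ.* n) ℕ.< a ℕ.* (a ℕ.* n)
  small = begin-strict
    2 ℕ.+ 2 ℕ.* (a ℕ.* n)              <⟨ ℕₚ.+-monoˡ-< _ (ℕₚ.*-mono-≤ 3≤a 1≤n) ⟩
    a ℕ.* n ℕ.+ 2 ℕ.* (a ℕ.* n)        ≡⟨⟩
    3 ℕ.* (a ℕ.* n)                    ≤⟨ ℕₚ.*-monoˡ-≤ (a ℕ.* n) 3≤a ⟩
    a ℕ.* (a ℕ.* n)                    ∎

module Density (p : ℕ) (pp : Prime p) where
  private instance
    p≢0 = prime⇒nonZero pp
    p^2≢0 = ℕₚ.m^n≢0 p 2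
    p^3≢0 = ℕₚ.m^n≢0 p 3
    p^4≢0 = ℕₚ.m^n≢0 p 4
    p^5≢0 = ℕₚ.m^n≢0 p 5
    p^30≢0 = ℕₚ.m^n≢0 p 30

  -- With q = p⁶ and S = p³ + p² + p + 1 the length is n = 2(Sq + 1)qˢ for r = 2s + 5, and
  -- V < ((q − 1)n)² / 2, so the density stays below 2X² / q⁵ where X = (q − 1)(Sq + 1).
  S a X B : ℕ
  S = p ℕ.^ 3 ℕ.+ p ℕ.^ 2 ℕ.+ p ℕ.+ 1
  a = p ℕ.^ 6 ℕ.∸ 1
  X = a ℕ.* (S ℕ.* suc a ℕ.+ 1)
  B = ((((2 ℕ.* p ℕ.+ 4) ℕ.* p ℕ.+ 6) ℕ.* p ℕ.+ 8) ℕ.* p ℕ.+ 6) ℕ.* p ℕ.+ 5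

  2≤p : 2 ℕ.≤ p
  2≤p = ℕ.nonTrivial⇒n>1 p {{prime⇒nonTrivial pp}}

  p^6≡ : p ℕ.^ 6 ≡ suc a
  p^6≡ = sym (ℕₚ.m+[n∸m]≡n (ℕₚ.m^n>0 p 6))

  3≤a : 3 ℕ.≤ a
  3≤a = ℕₚ.≤-trans (ℕₚ.m≤m+n 3 60) (ℕₚ.∸-monoˡ-≤ 1 (ℕₚ.^-monoˡ-≤ 6 2≤p))

  abstract
    -- X is less than Sq², which leaves 2S² ≤ Bp to be compared after the factor q⁴ = p²⁴ is taken
    -- out. Strictness comes from X < Sq², because the second inequality can be an equality.
    2X²<Bp²⁵ : suc (2 ℕ.* (X ℕ.* X)) ℕ.≤ B ℕ.* p ℕ.^ 25
    2X²<Bp²⁵ = begin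
      suc (2 ℕ.* (X ℕ.* X))                ≤⟨ ℕₚ.m≤m+n _ (suc (4 ℕ.* X)) ⟩
      suc (2 ℕ.* (X ℕ.* X)) ℕ.+ suc (4 ℕ.* X)
        ≡⟨ solve 1 (λ x → (con 1 :+ con 2 :* (x :* x)) :+ (con 1 :+ con 4 :* x)
             := con 2 :* ((con 1 :+ x) :* (con 1 :+ x))) refl X ⟩
      2 ℕ.* (suc X ℕ.* suc X)              ≤⟨ ℕₚ.*-monoʳ-≤ 2 (ℕₚ.*-mono-≤ X< X<) ⟩
      2 ℕ.* ((S ℕ.* (q ℕ.* q)) ℕ.* (S ℕ.* (q ℕ.* q)))
        ≡⟨ solve 2 (λ s q → con 2 :* ((s :* (q :* q)) :* (s :* (q :* q)))
             := (con 2 :* (s :* s)) :* (q :* (q :* (q :* (q :* con 1))))) refl S q ⟩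
      (2 ℕ.* (S ℕ.* S)) ℕ.* q ℕ.^ 4        ≤⟨ ℕₚ.*-monoˡ-≤ (q ℕ.^ 4) 2S²≤Bp ⟩
      (B ℕ.* p) ℕ.* q ℕ.^ 4                ≡⟨ cong (λ z → (B ℕ.* p) ℕ.* z ℕ.^ 4) p^6≡ ⟨
      (B ℕ.* p) ℕ.* (p ℕ.^ 6) ℕ.^ 4        ≡⟨ cong ((B ℕ.* p) ℕ.*_) (ℕₚ.^-*-assoc p 6 4) ⟩
      (B ℕ.* p) ℕ.* p ℕ.^ 24               ≡⟨ ℕₚ.*-assoc B p (p ℕ.^ 24) ⟩
      B ℕ.* p ℕ.^ 25                       ∎
      where
      open ℕₚ.≤-Reasoning
      open +-*-Solver
      q : ℕ
      q = suc a
      1≤S : 1 ℕ.≤ S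
      1≤S = ℕₚ.m≤n+m 1 (p ℕ.^ 3 ℕ.+ p ℕ.^ 2 ℕ.+ p)
      X< : suc X ℕ.≤ S ℕ.* (q ℕ.* q)
      X< = begin
        suc (a ℕ.* (S ℕ.* suc a ℕ.+ 1))
          ≡⟨ solve 2 (λ s a → con 1 :+ a :* (s :* (con 1 :+ a) :+ con 1)
               := con 1 :* (con 1 :+ a) :+ a :* (s :* (con 1 :+ a))) refl S a ⟩
        1 ℕ.* suc a ℕ.+ a ℕ.* (S ℕ.* suc a)        ≤⟨ ℕₚ.+-monoˡ-≤ _ (ℕₚ.*-monoˡ-≤ (suc a) 1≤S) ⟩
        S ℕ.* suc a ℕ.+ a ℕ.* (S ℕ.* suc a)
          ≡⟨ solve 2 (λ s a → s :* (con 1 :+ a) :+ a :* (s :* (con 1 :+ a))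
               := s :* ((con 1 :+ a) :* (con 1 :+ a))) refl S a ⟩
        S ℕ.* (q ℕ.* q) ∎
      -- 2S² = 2p⁶ + 4p⁵ + 6p⁴ + 8p³ + 6p² + 4p + 2, whereas Bp ends in 5p: the coefficient 5 of the
      -- bound absorbs the constant 2 because p ≥ 2, with equality at p = 2.
      2S²≤Bp : 2 ℕ.* (S ℕ.* S) ℕ.≤ B ℕ.* p
      2S²≤Bp = ℕₚ.+-cancelʳ-≤ p (2 ℕ.* (S ℕ.* S)) (B ℕ.* p) (begin
        2 ℕ.* (S ℕ.* S) ℕ.+ p
          ≡⟨ solve 1 (λ p → con 2 :* ((p :* (p :* (p :* con 1)) :+ p :* (p :* con 1) :+ p :+ con 1)
                                  :* (p :* (p :* (p :* con 1)) :+ p :* (p :* con 1) :+ p :+ con 1)) :+ p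
               := (((((con 2 :* p :+ con 4) :* p :+ con 6) :* p :+ con 8) :* p :+ con 6) :* p :+ con 5) :* p :+ con 2) refl p ⟩
        B ℕ.* p ℕ.+ 2   ≤⟨ ℕₚ.+-monoʳ-≤ (B ℕ.* p) 2≤p ⟩
        B ℕ.* p ℕ.+ p   ∎)

  -- The Horner form of `B` mirrors the summation: each further term multiplies the common
  -- denominator by p.
  bound≡ : bound p pp ≡ (+ B) / (p ℕ.^ 5)
  bound≡ = begin
    (+ 2) / 1 ℚ.+ (+ 4) / p ℚ.+ (+ 6) / (p ℕ.^ 2) ℚ.+ (+ 8) / (p ℕ.^ 3) ℚ.+ (+ 6) / (p ℕ.^ 4) ℚ.+ (+ 5) / (p ℕ.^ 5)
      ≡⟨ cong (λ x → x ℚ.+ (+ 6) / (p ℕ.^ 2) ℚ.+ (+ 8) / (p ℕ.^ 3) ℚ.+ (+ 6) / (p ℕ.^ 4) ℚ.+ (+ 5) / (p ℕ.^ 5))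
              (/-+-/ 2 4 p (sym (ℕₚ.*-identityʳ p))) ⟩
    (+ (2 ℕ.* p ℕ.+ 4)) / p ℚ.+ (+ 6) / (p ℕ.^ 2) ℚ.+ (+ 8) / (p ℕ.^ 3) ℚ.+ (+ 6) / (p ℕ.^ 4) ℚ.+ (+ 5) / (p ℕ.^ 5)
      ≡⟨ cong (λ x → x ℚ.+ (+ 8) / (p ℕ.^ 3) ℚ.+ (+ 6) / (p ℕ.^ 4) ℚ.+ (+ 5) / (p ℕ.^ 5))
              (/-+-/ (2 ℕ.* p ℕ.+ 4) 6 p (cong (p ℕ.*_) (ℕₚ.*-identityʳ p))) ⟩
    (+ ((2 ℕ.* p ℕ.+ 4) ℕ.* p ℕ.+ 6)) / (p ℕ.^ 2) ℚ.+ (+ 8) / (p ℕ.^ 3) ℚ.+ (+ 6) / (p ℕ.^ 4) ℚ.+ (+ 5) / (p ℕ.^ 5)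
      ≡⟨ cong (λ x → x ℚ.+ (+ 6) / (p ℕ.^ 4) ℚ.+ (+ 5) / (p ℕ.^ 5))
              (/-+-/ ((2 ℕ.* p ℕ.+ 4) ℕ.* p ℕ.+ 6) 8 {p ℕ.^ 2} {p ℕ.^ 3} p refl) ⟩
    (+ (((2 ℕ.* p ℕ.+ 4) ℕ.* p ℕ.+ 6) ℕ.* p ℕ.+ 8)) / (p ℕ.^ 3) ℚ.+ (+ 6) / (p ℕ.^ 4) ℚ.+ (+ 5) / (p ℕ.^ 5)
      ≡⟨ cong (ℚ._+ (+ 5) / (p ℕ.^ 5)) (/-+-/ (((2 ℕ.* p ℕ.+ 4) ℕ.* p ℕ.+ 6) ℕ.* p ℕ.+ 8) 6 {p ℕ.^ 3} {p ℕ.^ 4} p refl) ⟩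
    (+ ((((2 ℕ.* p ℕ.+ 4) ℕ.* p ℕ.+ 6) ℕ.* p ℕ.+ 8) ℕ.* p ℕ.+ 6)) / (p ℕ.^ 4) ℚ.+ (+ 5) / (p ℕ.^ 5)
      ≡⟨ /-+-/ ((((2 ℕ.* p ℕ.+ 4) ℕ.* p ℕ.+ 6) ℕ.* p ℕ.+ 8) ℕ.* p ℕ.+ 6) 5 {p ℕ.^ 4} {p ℕ.^ 5} p refl ⟩
    (+ B) / (p ℕ.^ 5) ∎
    where open ≡-Reasoning

  -- Over the common denominator p³⁰ = q⁵ both `limit` and the bound have integer numerators, so a
  -- strict inequality between them leaves a gap of at least 1 / p³⁰. A gap independent of r is what
  -- a strict bound on the lower limit requires.
  ε limit : ℚ
  ε = (+ 1) / (p ℕ.^ 30)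
  limit = (+ (2 ℕ.* (X ℕ.* X))) / (p ℕ.^ 30)

  ε>0 : 0ℚ ℚ.< ε
  ε>0 = /-mono-< {0} {1} {1} {p ℕ.^ 30} (s≤s z≤n)

  limit≤ : limit ℚ.≤ bound p pp ℚ.- ε
  limit≤ = begin
    limit                                              ≡⟨ ℚₚ.+-identityʳ limit ⟨
    limit ℚ.+ 0ℚ                                       ≡⟨ cong (limit ℚ.+_) (ℚₚ.+-inverseʳ ε) ⟨
    limit ℚ.+ (ε ℚ.- ε)                                ≡⟨ ℚₚ.+-assoc limit ε (ℚ.- ε) ⟨
    limit ℚ.+ ε ℚ.- ε                                  ≡⟨ cong (ℚ._- ε) (/-+-/ (2 ℕ.* (X ℕ.* X)) 1 {p ℕ.^ 30} {p ℕ.^ 30} 1 (sym (ℕₚ.*-identityˡ _))) ⟩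
    (+ (2 ℕ.* (X ℕ.* X) ℕ.* 1 ℕ.+ 1)) / (p ℕ.^ 30) ℚ.- ε  ≤⟨ ℚₚ.+-monoˡ-≤ (ℚ.- ε) (/-mono-≤ {2 ℕ.* (X ℕ.* X) ℕ.* 1 ℕ.+ 1} {B} {p ℕ.^ 30} {p ℕ.^ 5} cross) ⟩
    (+ B) / (p ℕ.^ 5) ℚ.- ε                            ≡⟨ cong (ℚ._- ε) bound≡ ⟨
    bound p pp ℚ.- ε                                   ∎
    where
    open ℚₚ.≤-Reasoning
    cross : (2 ℕ.* (X ℕ.* X) ℕ.* 1 ℕ.+ 1) ℕ.* p ℕ.^ 5 ℕ.≤ B ℕ.* p ℕ.^ 30
    cross = ℕₚ.≤-trans (ℕₚ.*-monoˡ-≤ (p ℕ.^ 5) (subst (ℕ._≤ B ℕ.* p ℕ.^ 25)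
        (trans (cong suc (sym (ℕₚ.*-identityʳ (2 ℕ.* (X ℕ.* X))))) (ℕₚ.+-comm 1 _)) 2X²<Bp²⁵))
      (ℕₚ.≤-reflexive (trans (ℕₚ.*-assoc B (p ℕ.^ 25) (p ℕ.^ 5)) (cong (B ℕ.*_) (sym (ℕₚ.^-distribˡ-+-* p 25 5)))))

  length≡ : ∀ s → nLen p (2 ℕ.+ s) ≡ 2 ℕ.* ((S ℕ.* suc a ℕ.+ 1) ℕ.* suc a ℕ.^ s)
  length≡ s = begin
    2 ℕ.* S ℕ.* p ℕ.^ (6 ℕ.* suc s) ℕ.+ 2 ℕ.* (p ℕ.^ 6) ℕ.^ s
      ≡⟨ cong (λ x → 2 ℕ.* S ℕ.* x ℕ.+ 2 ℕ.* (p ℕ.^ 6) ℕ.^ s) (ℕₚ.^-*-assoc p 6 (suc s)) ⟨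
    2 ℕ.* S ℕ.* (p ℕ.^ 6) ℕ.^ suc s ℕ.+ 2 ℕ.* (p ℕ.^ 6) ℕ.^ s
      ≡⟨ cong (λ q → 2 ℕ.* S ℕ.* q ℕ.^ suc s ℕ.+ 2 ℕ.* q ℕ.^ s) p^6≡ ⟩
    2 ℕ.* S ℕ.* suc a ℕ.^ suc s ℕ.+ 2 ℕ.* suc a ℕ.^ s
      ≡⟨ solve 3 (λ s q x → con 2 :* s :* (q :* x) :+ con 2 :* x := con 2 :* ((s :* q :+ con 1) :* x)) refl S (suc a) (suc a ℕ.^ s) ⟩
    2 ℕ.* ((S ℕ.* suc a ℕ.+ 1) ℕ.* suc a ℕ.^ s) ∎
    where
    open ≡-Reasoning
    open +-*-Solver

  V<  : ∀ s → V (p ℕ.^ 6) (nLen p (2 ℕ.+ s)) 2 ℕ.< 2 ℕ.* (X ℕ.* X) ℕ.* suc a ℕ.^ (2 ℕ.* s)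
  V< s = ℕₚ.*-cancelˡ-< 2 _ _ (begin-strict
    2 ℕ.* V (p ℕ.^ 6) (nLen p (2 ℕ.+ s)) 2
      ≡⟨ cong₂ (λ q n → 2 ℕ.* V q n 2) p^6≡ (length≡ s) ⟩
    2 ℕ.* V (suc a) n 2
      <⟨ V-bound a n 3≤a 1≤n ⟩
    (a ℕ.* n) ℕ.* (a ℕ.* n)
      ≡⟨ solve 3 (λ a y x → (a :* (con 2 :* (y :* x))) :* (a :* (con 2 :* (y :* x)))
           := con 2 :* (con 2 :* ((a :* y) :* (a :* y)) :* (x :* x))) refl a (S ℕ.* suc a ℕ.+ 1) (suc a ℕ.^ s) ⟩
    2 ℕ.* (2 ℕ.* (X ℕ.* X) ℕ.* (suc a ℕ.^ s ℕ.* suc a ℕ.^ s))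
      ≡⟨ cong (λ x → 2 ℕ.* (2 ℕ.* (X ℕ.* X) ℕ.* x)) (trans (sym (ℕₚ.^-distribˡ-+-* (suc a) s s))
           (cong (suc a ℕ.^_) (cong (s ℕ.+_) (sym (ℕₚ.+-identityʳ s))))) ⟩
    2 ℕ.* (2 ℕ.* (X ℕ.* X) ℕ.* suc a ℕ.^ (2 ℕ.* s)) ∎)
    where
    open ℕₚ.≤-Reasoning
    open +-*-Solver
    n : ℕ
    n = 2 ℕ.* ((S ℕ.* suc a ℕ.+ 1) ℕ.* suc a ℕ.^ s)
    1≤n : 1 ℕ.≤ n
    1≤n = ℕₚ.≤-trans (ℕₚ.*-mono-≤ (ℕₚ.m≤n+m 1 (S ℕ.* suc a)) (ℕₚ.m^n>0 (suc a) s)) (ℕₚ.m≤m+n _ _)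

  density< : ∀ s → density p pp (2 ℕ.+ s) ℚ.< bound p pp ℚ.- ε
  density< s = ℚₚ.<-≤-trans (/-mono-< {V (p ℕ.^ 6) (nLen p (2 ℕ.+ s)) 2} {2 ℕ.* (X ℕ.* X)} {(p ℕ.^ 6) ℕ.^ (2 ℕ.* (2 ℕ.+ s) ℕ.+ 1)} {p ℕ.^ 30} cross) limit≤
    where
    instance
      _ = ℕₚ.m^n≢0 p 6
      _ = ℕₚ.m^n≢0 (p ℕ.^ 6) (2 ℕ.* (2 ℕ.+ s) ℕ.+ 1)
    power : suc a ℕ.^ (2 ℕ.* s) ℕ.* p ℕ.^ 30 ≡ (p ℕ.^ 6) ℕ.^ (2 ℕ.* (2 ℕ.+ s) ℕ.+ 1)
    power = begin
      suc a ℕ.^ (2 ℕ.* s) ℕ.* p ℕ.^ 30                ≡⟨ cong₂ (λ q x → q ℕ.^ (2 ℕ.* s) ℕ.* x) (sym p^6≡) (sym (ℕₚ.^-*-assoc p 6 5)) ⟩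
      (p ℕ.^ 6) ℕ.^ (2 ℕ.* s) ℕ.* (p ℕ.^ 6) ℕ.^ 5     ≡⟨ ℕₚ.^-distribˡ-+-* (p ℕ.^ 6) (2 ℕ.* s) 5 ⟨
      (p ℕ.^ 6) ℕ.^ (2 ℕ.* s ℕ.+ 5)                   ≡⟨ cong ((p ℕ.^ 6) ℕ.^_)
        (solve 1 (λ s → con 2 :* s :+ con 5 := con 2 :* (con 2 :+ s) :+ con 1) refl s) ⟩
      (p ℕ.^ 6) ℕ.^ (2 ℕ.* (2 ℕ.+ s) ℕ.+ 1)           ∎
      where
      open ≡-Reasoning
      open +-*-Solver
    cross : V (p ℕ.^ 6) (nLen p (2 ℕ.+ s)) 2 ℕ.* p ℕ.^ 30 ℕ.< 2 ℕ.* (X ℕ.* X) ℕ.* (p ℕ.^ 6) ℕ.^ (2 ℕ.* (2 ℕ.+ s) ℕ.+ 1)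
    cross = subst (V (p ℕ.^ 6) (nLen p (2 ℕ.+ s)) 2 ℕ.* p ℕ.^ 30 ℕ.<_)
      (trans (ℕₚ.*-assoc (2 ℕ.* (X ℕ.* X)) (suc a ℕ.^ (2 ℕ.* s)) (p ℕ.^ 30)) (cong (2 ℕ.* (X ℕ.* X) ℕ.*_) power))
      (ℕₚ.*-monoˡ-< (p ℕ.^ 30) (V< s))

open import Data.Nat using (_+_; _*_; _^_; _≤_)
open import Data.Rational using (_<_; _-_)

theorem14 : (p : ℕ) (pp : Prime p) → p ≤ 73 → (F : FiniteField (p ^ 6)) →
    ((t : ℕ) → 1 ≤ t → 2 * t + 1 ≢ 9 → 2 * t + 1 ≢ 13 →
    Σ[ H ∈ Matrix F (2 * t + 1) (nLen p t) ] HasCoveringRadius F H 2)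
    × (∃[ ε ] (0ℚ < ε × ((N : ℕ) → ∃[ t ] (N ≤ t × 1 ≤ t × 2 * t + 1 ≢ 9 × 2 * t + 1 ≢ 13
    × density p pp t < bound p pp - ε))))
theorem14 p pp _ F = (λ t 1≤t _ _ → covering-codes F pp refl t 1≤t) , D.ε , D.ε>0 , λ N →
  -- t = 7 + N gives r ≥ 15, beyond the exceptional values 9 and 13, and t = 2 + (5 + N) has the
  -- form that the density estimate expects.
  7 + N , ℕₚ.m≤n+m N 7 , s≤s z≤n , ≢-small N (ℕₚ.m≤m+n 10 5) , ≢-small N (ℕₚ.m≤m+n 14 1) , D.density< (5 + N)
  where
  module D = Density p pp
  ≢-small : ∀ N {c} → c ℕ.< 15 → 2 * (7 + N) + 1 ≢ c
  ≢-small N c<15 = ℕₚ.>⇒≢ (ℕₚ.<-≤-trans c<15 (ℕₚ.+-monoˡ-≤ 1 (ℕₚ.*-monoʳ-≤ 2 (ℕₚ.m≤m+n 7 N))))
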